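{- Let $G$ be an $n$-vertex, $K_{r+1}$-free graph where $r \ge 3$. For every $k \ge 0$, if $G$ is not $k$-path Hamiltonian and $$n \ge \begin{cases} 6k+26 & \text{if } r=3\\ 6k+2r+3 & \text{if } 4 \le r \le 7\\ k+4(k+4)/(r-4)+2r & \text{if } r \ge 8,\end{cases}$$ then $e(G) \leq e(T_r(n-1)) + (k+1)$. The set $\mathcal{J}^k_{n,r}$ is nonempty, and equality holds if and only if $G \in \mathcal{J}^k_{n,r}$ or $G \in \widehat{\mathcal{H}}_{n,r}^{k}$.
   Context: Graphs are finite and simple; $n,r,k$ are integers; $e(G)$ is the number of edges of $G$. $T_r(n)$ is the $n$-vertex, $r$-partite Turán graph: the complete $r$-partite graph on $n$ vertices with part sizes differing by at most 1 (if $n<r$ some parts are empty and it is $K_n$). $K_{a_1,\dots,a_s}$ is the complete multipartite graph with parts of sizes $a_1,\dots,a_s$. An $n$-vertex graph is $k$-path Hamiltonian ($0 \le k \le n-2$) if every path of length (number of edges) at most $k$ is contained in a Hamiltonian cycle. A graph is traceable if it contains a Hamiltonian path. $\mathcal{J}^k_{n,r}$ is the set of $n$-vertex, $K_{r+1}$-free graphs consisting of $T_r(n-1)$ plus one additional vertex of degree $k+1$ whose neighborhood (i.e., the subgraph induced by its set of neighbors) is traceable. $\widehat{\mathcal{H}}_{n,r}^{\ell}$ is the set of all graphs $G$ such that $(G,r,n)$ appears in the following list for the given $\ell$ (it is empty for parameters not listed): - $\ell=-1$: $(K_{4,1,1}, 4, 6)$, $(K_{5,1,1,1}, 4, 8)$;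 - $\ell=0$: $(K_{6,2,2,1},4,11)$, $(K_{4,1,1,1},5,7)$, $(K_{5,1,1,1,1},5,9)$; - $\ell=1$: $(K_{4,1,1,1,1},6,8)$, $(K_{5,2,1,1,1},5,10)$, $(K_{5,1,1,1,1,1},6,10)$; - $\ell=2$: $(K_{6,2,2,2,1}, 5, 13)$, $(K_{5,2,1,1,1,1}, 6, 11)$, $(K_{5,1,1,1,1,1,1}, 7, 11)$, $(K_{4,1,1,1,1,1}, 7, 9)$; - $\ell=3$: $(K_{5,2,1,1,1,1,1}, 7, 12)$; - $\ell=4$: $(K_{6,2,2,2,2,1}, 6, 15)$, $(K_{5,2,2,1,1,1,1}, 7, 13)$; - $\ell=6$: $(K_{6,2,2,2,2,2,1}, 7, 17)$. -}

module Defs where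

open import Data.Bool.Base using (Bool; false; not; T)
open import Data.Bool.Properties using (T?)
open import Data.Fin.Base using (Fin; toℕ; splitAt)
import Data.Fin.Properties as Fin
open import Data.Integer.Base using (ℤ; +_; -[1+_])
open import Data.List.Base
  using (List; []; _∷_; _++_; length; lookup; filter; take; allFin; cartesianProduct)
open import Data.List.Membership.Propositional using (_∈_)
open import Data.List.Relation.Binary.Infix.Heterogeneous using (Infix)
open import Data.List.Relation.Unary.Linked using (Linked)
open import Data.List.Relation.Unary.Unique.Propositional using (Unique)
open import Data.Nat.Base using (ℕ; suc; _+_; _*_; _∸_; _≤_; _≥_; NonZero)
open import Data.Nat.DivMod using (_%_)
open import Data.Nat.ListAction using (sum)
import Data.Nat.Properties as ℕ
open import Data.Product.Base using (Σ-syntax; ∃-syntax; _×_; _,_)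
import Data.Rational.Base as ℚ
open import Data.Sum.Base using (_⊎_; inj₁; inj₂)
open import Function.Bundles using (_↔_; Inverse; mk⇔)
open import Function.Definitions using (Injective)
open import Level using (0ℓ)
open import Relation.Binary.PropositionalEquality using (_≡_; refl; sym; cong)
open import Relation.Nullary.Decidable using (does; does-⇔; dec-true; _×-dec_; ¬?)
open import Relation.Nullary.Negation using (¬_)
open import Relation.Unary using (Pred; Decidable)

private
  variable
    m n : ℕ

record Graph (n : ℕ) : Set where
  field
    adj       : Fin n → Fin n → Bool
    symmetric : ∀ i j → adj i j ≡ adj j i
    loopless  : ∀ i → adj i i ≡ false

  Adj : Fin n → Fin n → Set
  Adj i j = T (adj i j)

  adj? : ∀ i → Decidable (Adj i)
  adj? i j = T? (adj i j)

  neighbours : Fin n → List (Fin n)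
  neighbours v = filter (adj? v) (allFin n)

  degree : Fin n → ℕ
  degree v = length (neighbours v)

open Graph public

e : Graph n → ℕ
e {n} G =
  length (filter (λ (i , j) → (i Fin.<? j) ×-dec adj? G i j)
                 (cartesianProduct (allFin n) (allFin n)))

infix 4 _≅_ _⊑_

_≅_ : Graph m → Graph n → Set
_≅_ {m} {n} G H =
  Σ[ f ∈ Fin m ↔ Fin n ]
    (∀ i j → adj G i j ≡ adj H (Inverse.to f i) (Inverse.to f j))

-- Not necessarily induced.
_⊑_ : Graph m → Graph n → Set
_⊑_ {m} {n} H G =
  Σ[ f ∈ (Fin m → Fin n) ]
    Injective _≡_ _≡_ f × (∀ i j → Adj H i j → Adj G (f i) (f j))

-- Vertex i of the induced subgraph is the i-th vertex of G satisfying P.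
induced : (G : Graph n) {P : Pred (Fin n) 0ℓ} (P? : Decidable P) →
          Graph (length (filter P? (allFin n)))
induced {n} G P? = record
  { adj       = λ i j → adj G (vertex i) (vertex j)
  ; symmetric = λ i j → symmetric G (vertex i) (vertex j)
  ; loopless  = λ i → loopless G (vertex i)
  }
  where
  vertex : Fin (length (filter P? (allFin n))) → Fin n
  vertex = lookup (filter P? (allFin n))

neighbourhood : (G : Graph n) (v : Fin n) → Graph (degree G v)
neighbourhood G v = induced G (adj? G v)

infixl 6 _-ᵛ_

_-ᵛ_ : (G : Graph n) (v : Fin n) →
       Graph (length (filter (λ u → ¬? (u Fin.≟ v)) (allFin n)))
G -ᵛ v = induced G (λ u → ¬? (u Fin.≟ v))

-- The parts are the colour classes of c.
multipartite : (Fin n → ℕ) → Graph n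
multipartite {n} c = record
  { adj       = λ i j → not (does (c i ℕ.≟ c j))
  ; symmetric = λ i j → cong not (does-⇔ (mk⇔ sym sym) (c i ℕ.≟ c j) (c j ℕ.≟ c i))
  ; loopless  = λ i → cong not (dec-true (c i ℕ.≟ c i) refl)
  }

complete : (s : ℕ) → Graph s
complete s = multipartite toℕ

-- The residue classes mod r partition {0,…,n-1} into r parts whose sizes
-- differ by at most 1.
turán : (r n : ℕ) .{{_ : NonZero r}} → Graph n
turán r n = multipartite (λ i → toℕ i % r)

part : (as : List ℕ) → Fin (sum as) → ℕ
part (a ∷ as) i with splitAt a i
... | inj₁ _ = 0
... | inj₂ j = suc (part as j)

K : (as : List ℕ) → Graph (sum as)
K as = multipartite (part as)

record IsPath (G : Graph n) (ℓ : ℕ) (xs : List (Fin n)) : Set where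
  field
    length≡  : length xs ≡ suc ℓ
    distinct : Unique xs
    linked   : Linked (Adj G) xs

Spanning : List (Fin n) → Set
Spanning xs = ∀ v → v ∈ xs

Traceable : Graph n → Set
Traceable G = ∃[ ℓ ] ∃[ xs ] IsPath G ℓ xs × Spanning xs

-- A cycle is given by its vertices in cyclic order, without repeating the
-- first one; close traverses it back to its starting point.
close : List (Fin n) → List (Fin n)
close xs = xs ++ take 1 xs

record IsHamiltonianCycle (G : Graph n) (xs : List (Fin n)) : Set where
  field
    length≥3 : length xs ≥ 3
    distinct : Unique xs
    linked   : Linked (Adj G) (close xs)
    spanning : Spanning xs

Consecutive : List (Fin n) → Fin n → Fin n → Set
Consecutive xs u v = Infix _≡_ (u ∷ v ∷ []) xs

-- Containment as subgraphs: vertices and (unoriented) edges.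
record _ContainedInCycle_ (path cycle : List (Fin n)) : Set where
  field
    vertices : ∀ v → v ∈ path → v ∈ cycle
    edges    : ∀ u v → Consecutive path u v →
               Consecutive (close cycle) u v ⊎ Consecutive (close cycle) v u

-- Only meaningful for k ≤ n - 2.
PathHamiltonian : ℕ → Graph n → Set
PathHamiltonian k G =
  ∀ ℓ path → ℓ ≤ k → IsPath G ℓ path →
  ∃[ cycle ] IsHamiltonianCycle G cycle × path ContainedInCycle cycle

-- Membership of a graph in 𝒥ᵏₙ,ᵣ.
record 𝒥 (k n r : ℕ) .{{_ : NonZero r}} (G : Graph n) : Set where
  field
    clique-free : ¬ (complete (suc r) ⊑ G)
    apex        : Fin n
    rest        : G -ᵛ apex ≅ turán r (n ∸ 1)
    apex-degree : degree G apex ≡ k + 1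
    traceable   : Traceable (neighbourhood G apex)

-- Entries (as , r , n) stand for (K_as , r , n).
exceptions : ℤ → List (List ℕ × ℕ × ℕ)
exceptions -[1+ 0 ] =
    (4 ∷ 1 ∷ 1 ∷ [] , 4 , 6)
  ∷ (5 ∷ 1 ∷ 1 ∷ 1 ∷ [] , 4 , 8)
  ∷ []
exceptions (+ 0) =
    (6 ∷ 2 ∷ 2 ∷ 1 ∷ [] , 4 , 11)
  ∷ (4 ∷ 1 ∷ 1 ∷ 1 ∷ [] , 5 , 7)
  ∷ (5 ∷ 1 ∷ 1 ∷ 1 ∷ 1 ∷ [] , 5 , 9)
  ∷ []
exceptions (+ 1) =
    (4 ∷ 1 ∷ 1 ∷ 1 ∷ 1 ∷ [] , 6 , 8)
  ∷ (5 ∷ 2 ∷ 1 ∷ 1 ∷ 1 ∷ [] , 5 , 10)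
  ∷ (5 ∷ 1 ∷ 1 ∷ 1 ∷ 1 ∷ 1 ∷ [] , 6 , 10)
  ∷ []
exceptions (+ 2) =
    (6 ∷ 2 ∷ 2 ∷ 2 ∷ 1 ∷ [] , 5 , 13)
  ∷ (5 ∷ 2 ∷ 1 ∷ 1 ∷ 1 ∷ 1 ∷ [] , 6 , 11)
  ∷ (5 ∷ 1 ∷ 1 ∷ 1 ∷ 1 ∷ 1 ∷ 1 ∷ [] , 7 , 11)
  ∷ (4 ∷ 1 ∷ 1 ∷ 1 ∷ 1 ∷ 1 ∷ [] , 7 , 9)
  ∷ []
exceptions (+ 3) =
    (5 ∷ 2 ∷ 1 ∷ 1 ∷ 1 ∷ 1 ∷ 1 ∷ [] , 7 , 12)
  ∷ []
exceptions (+ 4) =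
    (6 ∷ 2 ∷ 2 ∷ 2 ∷ 2 ∷ 1 ∷ [] , 6 , 15)
  ∷ (5 ∷ 2 ∷ 2 ∷ 1 ∷ 1 ∷ 1 ∷ 1 ∷ [] , 7 , 13)
  ∷ []
exceptions (+ 6) =
    (6 ∷ 2 ∷ 2 ∷ 2 ∷ 2 ∷ 2 ∷ 1 ∷ [] , 7 , 17)
  ∷ []
exceptions _ = []

-- Membership of a graph in Ĥˡₙ,ᵣ, up to isomorphism.
Ĥ : (ℓ : ℤ) (n r : ℕ) → Graph n → Set
Ĥ ℓ n r G = ∃[ as ] (as , r , n) ∈ exceptions ℓ × G ≅ K as

-- The division is rational; NonZero (r ∸ 4) is implied by 8 ≤ r.
data LargeEnough (k n : ℕ) : ℕ → Set where
  r≡3   : n ≥ 6 * k + 26 → LargeEnough k n 3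
  4≤r≤7 : ∀ {r} → 4 ≤ r → r ≤ 7 → n ≥ 6 * k + 2 * r + 3 → LargeEnough k n r
  8≤r   : ∀ {r} .{{_ : NonZero (r ∸ 4)}} → 8 ≤ r →
          (+ n) ℚ./ 1 ℚ.≥
            (+ k) ℚ./ 1 ℚ.+ (+ (4 * (k + 4))) ℚ./ (r ∸ 4) ℚ.+ (+ (2 * r)) ℚ./ 1 →
          LargeEnough k n r

{-# OPTIONS --safe #-}
-- If G is not k-path Hamiltonian, then neither is its Bondy–Chvátal closure at
-- degree sum n + k, and as in Pósa's argument some h with 2h < n + k has at least
-- max(1, h − k) vertices of degree at most h in G.  Deleting j of them and applying
-- Turán's theorem to the rest gives e(G) ≤ jh + e(Tᵣ(n − j)).  For h ≤ k + 1 and j = 1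
-- this is the claimed bound; for h ≥ k + 2 the choice j = min(h − k, 4), or
-- min(h − k, 6) when r = 3, gives a strictly smaller value, except for a tie at
-- k = 0, n = 11, r = 4, h = 5, which leads to K₆₂₂₁.  In the case of equality G
-- is therefore a vertex v of degree k + 1 added to Tᵣ(n − 1); if no path
-- covers exactly the neighbourhood of v, any path with at most k edges can be
-- routed through v, and closing once more turns it into a Hamiltonian cycle.

module Submission where

open import Data.Bool.Base using (Bool; true; false; not; T; if_then_else_; _∨_; _∧_)
open import Data.Bool.Properties using (T?; T-∨; T-∧)
open import Data.Empty using (⊥; ⊥-elim)
open import Data.Fin.Base as Fin using (Fin; toℕ; zero; suc)
import Data.Fin.Permutation as Permutation
import Data.Fin.Properties as Fin
import Data.Integer.Base as ℤ
import Data.Integer.Properties as ℤ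
open import Data.List.Base as List hiding (all; sum; product)
open import Data.List.Membership.Propositional using (_∈_; _∉_)
open import Data.List.Membership.Propositional.Properties
open import Data.List.Membership.Propositional.Properties.WithK using (unique∧set⇒bag)
open import Data.List.Properties
open import Data.List.Relation.Binary.BagAndSetEquality using (∼bag⇒↭)
import Data.List.Relation.Binary.Infix.Heterogeneous as Infix
import Data.List.Relation.Binary.Permutation.Homogeneous as Homogeneous
open import Data.List.Relation.Binary.Permutation.Propositional
  using (_↭_; refl; prep; swap; trans; ↭-refl; ↭-sym; ↭-trans; ↭⇒↭ₛ)
open import Data.List.Relation.Binary.Permutation.Propositional.Properties
  using (↭-length; ∈-resp-↭; shift; ++⁺ˡ; ++⁺ʳ; ++-comm; map⁺; ↭-reverse)
import Data.List.Relation.Binary.Permutation.Setoid as PermutationSetoid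
open import Data.List.Relation.Binary.Permutation.Setoid.Properties using (onIndices-lookup; Unique-resp-↭)
open import Data.List.Relation.Binary.Prefix.Heterogeneous using ([]; _∷_)
open import Data.List.Relation.Unary.All as All using (All; []; _∷_)
open import Data.List.Relation.Unary.AllPairs as AllPairs using (AllPairs; []; _∷_)
import Data.List.Relation.Unary.AllPairs.Properties as AllPairs
open import Data.List.Relation.Unary.Any as Any using (here; there; any?)
open import Data.List.Relation.Unary.Any.Properties using (lookup-index)
open import Data.List.Relation.Unary.Linked using (Linked; []; [-]; _∷_; linked?)
import Data.List.Relation.Unary.Linked.Properties as Linked
open import Data.List.Relation.Unary.Unique.Propositional using (Unique)
import Data.List.Relation.Unary.Unique.Propositional.Properties as Unique
open import Data.Nat.Base
open import Data.Nat.DivMod hiding (result)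
open import Data.Nat.Divisibility using (n∣m*n)
open import Data.Nat.Properties
open import Data.Nat.Tactic.RingSolver using (solve; solve-∀)
open import Data.Product.Base using (∃-syntax; _×_; _,_; proj₁; proj₂)
import Data.Product.Properties as Product
import Data.Rational.Base as ℚ
import Data.Rational.Properties as ℚ
import Data.Rational.Unnormalised.Base as ℚᵘ
import Data.Rational.Unnormalised.Properties as ℚᵘ
open import Data.Sum.Base as Sum using (_⊎_; inj₁; inj₂; [_,_]′)
open import Data.Unit.Base using (tt)
open import Function.Base using (_∘_; id)
open import Function.Bundles using (Equivalence; Inverse; mk⇔; _↔_; _⇔_)
open import Function.Properties.Inverse using (↔-trans)
open import Level using (0ℓ)
open import Relation.Binary.Definitions using (tri<; tri≈; tri>)
open import Relation.Binary.PropositionalEquality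
  using (_≡_; _≢_; refl; sym; cong; cong₂; subst; subst₂; setoid; module ≡-Reasoning)
  renaming (trans to ≡-trans)
open import Relation.Nullary.Decidable as Dec
  using (Dec; yes; no; does; does-⇔; ¬?; dec-true; dec-false; _×-dec_; _⊎-dec_; True; toWitness)
open import Relation.Nullary.Negation using (¬_; contradiction)
open import Relation.Unary using (Pred; Decidable)
open import Defs

-- When `h` is near (n + k) / 2, deleting j low vertices can cost about j(n + k) / 2 edges, while
-- the j - 1 vertices that separate Tᵣ(n - j) from Tᵣ(n - 1) bring about (j - 1)(1 - 1/r)n. At
-- leading order the second wins iff j / 2 < (j - 1)(1 - 1/r). For r = 4 this excludes j ≤ 3 and
-- admits 4; for r = 3 even j = 4 only balances, whereas 6 leaves a margin of n / 3. The closure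
-- threshold n + k comes from the prescribed path: the crossing that closes a Hamiltonian path must
-- not cut any of the at most k prescribed steps, so the degree sum has to exceed the usual n by k.
-- In the equality case the two edges at v are prescribed as well, and the threshold there is n + k
-- + 2. Constructively, an obstruction is reached only by refuting its absence. What is drawn from
-- it is therefore always a decidable statement: an inequality between numbers, or a bound on the
-- number of low vertices.

private
  variable
    A B : Set
    m n : ℕ

-- Counting edges of lists of vertices

⟦_⟧ : Bool → ℕ
⟦ true ⟧  = 1
⟦ false ⟧ = 0

count : (A → Bool) → List A → ℕ
count p []       = 0
count p (x ∷ xs) = ⟦ p x ⟧ + count p xs

-- Each element is compared with its tail only, so every pair of positions counts once. For
-- symmetric `a` the order of the list is immaterial (`edges-↭`), and the vertices to be deleted can
-- be moved to the front.
edges : (A → A → Bool) → List A → ℕ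
edges a []       = 0
edges a (x ∷ xs) = count (a x) xs + edges a xs

cross : (A → A → Bool) → List A → List A → ℕ
cross a []       ys = 0
cross a (x ∷ xs) ys = count (a x) ys + cross a xs ys

⟦T⟧ : ∀ {b} → T b → ⟦ b ⟧ ≡ 1
⟦T⟧ {true} _ = refl

⟦T⟧+ : ∀ {b m} → T b → ⟦ b ⟧ + m ≡ suc m
⟦T⟧+ {true} _ = refl

⟦¬T⟧ : ∀ {b} → ¬ T b → ⟦ b ⟧ ≡ 0
⟦¬T⟧ {true}  ¬t = ⊥-elim (¬t tt)
⟦¬T⟧ {false} _  = refl

⟦⟧≤1 : ∀ b → ⟦ b ⟧ ≤ 1
⟦⟧≤1 true  = s≤s z≤n
⟦⟧≤1 false = z≤n

¬T⇒≡false : ∀ {b} → ¬ T b → b ≡ false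
¬T⇒≡false {true}  ¬t = ⊥-elim (¬t tt)
¬T⇒≡false {false} _  = refl

T⇒≡true : ∀ {b} → T b → b ≡ true
T⇒≡true {true} _ = refl

≡true⇒T : ∀ {b} → b ≡ true → T b
≡true⇒T refl = tt

≡false⇒¬T : ∀ {b} → b ≡ false → ¬ T b
≡false⇒¬T refl ()

count-++ : ∀ (p : A → Bool) xs ys → count p (xs ++ ys) ≡ count p xs + count p ys
count-++ p []       ys = refl
count-++ p (x ∷ xs) ys rewrite count-++ p xs ys = sym (+-assoc ⟦ p x ⟧ _ _)

count-map : ∀ (p : B → Bool) (f : A → B) xs → count p (map f xs) ≡ count (p ∘ f) xs
count-map p f []       = refl
count-map p f (x ∷ xs) = cong (⟦ p (f x) ⟧ +_) (count-map p f xs)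

count-↭ : ∀ (p : A → Bool) {xs ys} → xs ↭ ys → count p xs ≡ count p ys
count-↭ p refl          = refl
count-↭ p (prep x σ)    = cong (⟦ p x ⟧ +_) (count-↭ p σ)
count-↭ p (swap x y σ)  rewrite count-↭ p σ = exchange ⟦ p x ⟧ ⟦ p y ⟧ _
  where
  exchange : ∀ a b c → a + (b + c) ≡ b + (a + c)
  exchange = solve-∀
count-↭ p (trans σ τ)   = ≡-trans (count-↭ p σ) (count-↭ p τ)

count≤length : ∀ (p : A → Bool) xs → count p xs ≤ length xs
count≤length p []       = z≤n
count≤length p (x ∷ xs) = +-mono-≤ (⟦⟧≤1 (p x)) (count≤length p xs)

count-filter : ∀ {P : Pred A 0ℓ} (P? : Decidable P) xs →
               length (filter P? xs) ≡ count (does ∘ P?) xs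
count-filter P? []       = refl
count-filter P? (x ∷ xs) with does (P? x)
... | true  = cong suc (count-filter P? xs)
... | false = count-filter P? xs

count-cong : ∀ (p q : A → Bool) xs → (∀ x → x ∈ xs → p x ≡ q x) → count p xs ≡ count q xs
count-cong p q []       eq = refl
count-cong p q (x ∷ xs) eq =
  cong₂ (λ b c → ⟦ b ⟧ + c) (eq x (here refl)) (count-cong p q xs (λ y y∈ → eq y (there y∈)))

⟦⟧-mono : ∀ {b c} → (T b → T c) → ⟦ b ⟧ ≤ ⟦ c ⟧
⟦⟧-mono {true}  f = ≤-reflexive (sym (⟦T⟧ (f tt)))
⟦⟧-mono {false} f = z≤n

count-mono : ∀ (p q : A → Bool) xs → (∀ x → x ∈ xs → T (p x) → T (q x)) → count p xs ≤ count q xs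
count-mono p q []       f = z≤n
count-mono p q (x ∷ xs) f =
  +-mono-≤ (⟦⟧-mono (f x (here refl))) (count-mono p q xs (λ y y∈ → f y (there y∈)))

count-mono-< : ∀ (p q : A → Bool) xs → (∀ x → x ∈ xs → T (p x) → T (q x)) →
               ∀ {z} → z ∈ xs → ¬ T (p z) → T (q z) → count p xs < count q xs
count-mono-< p q (x ∷ xs) f (here refl) ¬pz qz rewrite ⟦¬T⟧ ¬pz | ⟦T⟧ qz =
  s≤s (count-mono p q xs (λ y y∈ → f y (there y∈)))
count-mono-< p q (x ∷ xs) f (there z∈) ¬pz qz =
  +-mono-≤-< (⟦⟧-mono (f x (here refl)))
             (count-mono-< p q xs (λ y y∈ → f y (there y∈)) z∈ ¬pz qz)

count-true : ∀ (p : A → Bool) xs → (∀ x → x ∈ xs → T (p x)) → count p xs ≡ length xs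
count-true p []       f = refl
count-true p (x ∷ xs) f rewrite ⟦T⟧ (f x (here refl)) =
  cong suc (count-true p xs (λ y y∈ → f y (there y∈)))

count-false : ∀ (p : A → Bool) xs → (∀ x → x ∈ xs → ¬ T (p x)) → count p xs ≡ 0
count-false p []       f = refl
count-false p (x ∷ xs) f rewrite ⟦¬T⟧ (f x (here refl)) =
  count-false p xs (λ y y∈ → f y (there y∈))

count-true⁻ : ∀ (p : A → Bool) xs → count p xs ≡ length xs → ∀ x → x ∈ xs → T (p x)
count-true⁻ p (x ∷ xs) eq y y∈ with p x in px
... | false = ⊥-elim (<-irrefl eq (s≤s (count≤length p xs)))
count-true⁻ p (x ∷ xs) eq y (here refl) | true = ≡true⇒T px
count-true⁻ p (x ∷ xs) eq y (there y∈)  | true = count-true⁻ p xs (suc-injective eq) y y∈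

count-false⁻ : ∀ (p : A → Bool) xs → count p xs ≡ 0 → ∀ x → x ∈ xs → ¬ T (p x)
count-false⁻ p (x ∷ xs) eq y (here refl) t rewrite ⟦T⟧ t with () ← eq
count-false⁻ p (x ∷ xs) eq y (there y∈) =
  count-false⁻ p xs (m+n≡0⇒n≡0 ⟦ p x ⟧ eq) y y∈

count>0⁻ : ∀ (p : A → Bool) xs → 0 < count p xs → ∃[ x ] x ∈ xs × T (p x)
count>0⁻ p (x ∷ xs) pos with p x in px
... | true  = x , here refl , ≡true⇒T px
... | false with y , y∈ , py ← count>0⁻ p xs pos = y , there y∈ , py

count-not : ∀ (p : A → Bool) xs → count p xs + count (not ∘ p) xs ≡ length xs
count-not p []       = refl
count-not p (x ∷ xs) with p x
... | true  = cong suc (count-not p xs)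
... | false = ≡-trans (+-suc (count p xs) _) (cong suc (count-not p xs))

↭-filter-¬ : ∀ {P : Pred A 0ℓ} (P? : Decidable P) xs → xs ↭ filter P? xs ++ filter (¬? ∘ P?) xs
↭-filter-¬ P? []       = ↭-refl
↭-filter-¬ P? (x ∷ xs) with does (P? x)
... | true  = prep x (↭-filter-¬ P? xs)
... | false = ↭-trans (prep x (↭-filter-¬ P? xs)) (↭-sym (shift x (filter P? xs) _))

∈⇒↭ : ∀ {x : A} {xs} → x ∈ xs → ∃[ ys ] xs ↭ x ∷ ys
∈⇒↭ x∈ with as , bs , refl ← ∈-∃++ x∈ = as ++ bs , shift _ as bs

cross-++ʳ : ∀ (a : A → A → Bool) xs ys zs → cross a xs (ys ++ zs) ≡ cross a xs ys + cross a xs zs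
cross-++ʳ a []       ys zs = refl
cross-++ʳ a (x ∷ xs) ys zs rewrite count-++ (a x) ys zs | cross-++ʳ a xs ys zs =
  interchange (count (a x) ys) _ _ _
  where
  interchange : ∀ p q r s → (p + q) + (r + s) ≡ (p + r) + (q + s)
  interchange = solve-∀

edges-++ : ∀ (a : A → A → Bool) xs ys → edges a (xs ++ ys) ≡ edges a xs + (cross a xs ys + edges a ys)
edges-++ a []       ys = refl
edges-++ a (x ∷ xs) ys rewrite count-++ (a x) xs ys | edges-++ a xs ys =
  rearrange (count (a x) xs) _ _ _ _
  where
  rearrange : ∀ p q r s t → (p + q) + (r + (s + t)) ≡ (p + r) + ((q + s) + t)
  rearrange = solve-∀

edges-map : ∀ (a : B → B → Bool) (f : A → B) xs →
            edges a (map f xs) ≡ edges (λ x y → a (f x) (f y)) xs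
edges-map a f []       = refl
edges-map a f (x ∷ xs) = cong₂ _+_ (count-map (a (f x)) f xs) (edges-map a f xs)

edges-cong : ∀ (a b : A → A → Bool) xs → (∀ x y → x ∈ xs → y ∈ xs → a x y ≡ b x y) →
             edges a xs ≡ edges b xs
edges-cong a b []       eq = refl
edges-cong a b (x ∷ xs) eq =
  cong₂ _+_ (count-cong (a x) (b x) xs (λ y y∈ → eq x y (here refl) (there y∈)))
            (edges-cong a b xs (λ y z y∈ z∈ → eq y z (there y∈) (there z∈)))

cross-≤ : ∀ (a : A → A → Bool) d xs ys → (∀ x → x ∈ xs → count (a x) ys ≤ d) →
          cross a xs ys ≤ length xs * d
cross-≤ a d []       ys bd = z≤n
cross-≤ a d (x ∷ xs) ys bd =
  +-mono-≤ (bd x (here refl)) (cross-≤ a d xs ys (λ y y∈ → bd y (there y∈)))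

cross-full : ∀ (a : A → A → Bool) xs ys → (∀ x y → x ∈ xs → y ∈ ys → T (a x y)) →
             cross a xs ys ≡ length xs * length ys
cross-full a []       ys f = refl
cross-full a (x ∷ xs) ys f =
  cong₂ _+_ (count-true (a x) ys (λ y → f x y (here refl)))
            (cross-full a xs ys (λ z y z∈ → f z y (there z∈)))

≤-+-tightˡ : ∀ {a b c d} → a ≤ b → c ≤ d → a + c ≡ b + d → a ≡ b
≤-+-tightˡ {a} {b} {c} {d} a≤b c≤d eq = ≤-antisym a≤b (+-cancelʳ-≤ d b a (begin
  b + d ≡⟨ sym eq ⟩
  a + c ≤⟨ +-monoʳ-≤ a c≤d ⟩
  a + d ∎))
  where open ≤-Reasoning

≤-+-tightʳ : ∀ {a b c d} → a ≤ b → c ≤ d → a + c ≡ b + d → c ≡ d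
≤-+-tightʳ {a} {b} {c} {d} a≤b c≤d eq =
  ≤-+-tightˡ c≤d a≤b (≡-trans (+-comm c a) (≡-trans eq (+-comm b d)))

cross-full⁻ : ∀ (a : A → A → Bool) xs ys → cross a xs ys ≡ length xs * length ys →
              ∀ x y → x ∈ xs → y ∈ ys → T (a x y)
cross-full⁻ a (x ∷ xs) ys eq = split
  where
  bound : cross a xs ys ≤ length xs * length ys
  bound = cross-≤ a (length ys) xs ys (λ z _ → count≤length (a z) ys)
  split : ∀ z y → z ∈ x ∷ xs → y ∈ ys → T (a z y)
  split z y (here refl) = count-true⁻ (a x) ys (≤-+-tightˡ (count≤length (a x) ys) bound eq) y
  split z y (there z∈)  = cross-full⁻ a xs ys (≤-+-tightʳ (count≤length (a x) ys) bound eq) z y z∈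

module _ (a : A → A → Bool) (a-sym : ∀ x y → a x y ≡ a y x) where

  edges-↭ : ∀ {xs ys} → xs ↭ ys → edges a xs ≡ edges a ys
  edges-↭ refl         = refl
  edges-↭ (prep x σ)   = cong₂ _+_ (count-↭ (a x) σ) (edges-↭ σ)
  edges-↭ (swap {xs} {ys} x y σ)
    rewrite count-↭ (a x) σ | count-↭ (a y) σ | edges-↭ σ | a-sym x y =
    exchange ⟦ a y x ⟧ (count (a x) ys) (count (a y) ys) (edges a ys)
    where
    exchange : ∀ p q r s → (p + q) + (r + s) ≡ (p + r) + (q + s)
    exchange = solve-∀
  edges-↭ (trans σ τ)  = ≡-trans (edges-↭ σ) (edges-↭ τ)

  cross-∷ʳ : ∀ y xs ys → cross a xs (y ∷ ys) ≡ count (a y) xs + cross a xs ys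
  cross-∷ʳ y []       ys = refl
  cross-∷ʳ y (x ∷ xs) ys rewrite cross-∷ʳ y xs ys | a-sym x y =
    exchange ⟦ a y x ⟧ (count (a x) ys) (count (a y) xs) (cross a xs ys)
    where
    exchange : ∀ p q r s → (p + q) + (r + s) ≡ (p + r) + (q + s)
    exchange = solve-∀

  module _ (a-irrefl : ∀ x → a x x ≡ false) where

    -- The handshake count: an edge inside `xs` is met from both ends, and the diagonal contributes
    -- nothing.
    cross-self : ∀ xs → cross a xs xs ≡ edges a xs + edges a xs
    cross-self []       = refl
    cross-self (x ∷ xs) rewrite cross-∷ʳ x xs xs | cross-self xs | a-irrefl x =
      double (count (a x) xs) (edges a xs)
      where
      double : ∀ p q → p + (p + (q + q)) ≡ (p + q) + (p + q)
      double = solve-∀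

    edges≡0⁻ : ∀ xs → edges a xs ≡ 0 → ∀ x y → x ∈ xs → y ∈ xs → ¬ T (a x y)
    edges≡0⁻ (z ∷ zs) eq x y (here refl) (here refl) = ≡false⇒¬T (a-irrefl z)
    edges≡0⁻ (z ∷ zs) eq x y (here refl) (there y∈)  =
      count-false⁻ (a z) zs (m+n≡0⇒m≡0 _ eq) y y∈
    edges≡0⁻ (z ∷ zs) eq x y (there x∈) (here refl) t =
      count-false⁻ (a z) zs (m+n≡0⇒m≡0 _ eq) x x∈ (subst T (a-sym x z) t)
    edges≡0⁻ (z ∷ zs) eq x y (there x∈) (there y∈)  =
      edges≡0⁻ zs (m+n≡0⇒n≡0 (count (a z) zs) eq) x y x∈ y∈

argmax : ∀ (f : A → ℕ) x xs → ∃[ v ] v ∈ x ∷ xs × (∀ y → y ∈ x ∷ xs → f y ≤ f v)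
argmax f x []       = x , here refl , λ { y (here refl) → ≤-refl }
argmax f x (y ∷ ys) with v , v∈ , max ← argmax f y ys with ≤-total (f x) (f v)
... | inj₁ x≤v = v , there v∈ , λ { z (here refl) → x≤v ; z (there z∈) → max z z∈ }
... | inj₂ v≤x = x , here refl , λ { z (here refl) → ≤-refl ; z (there z∈) → ≤-trans (max z z∈) v≤x }

-- Turán's theorem with its extremal colouring

infix 5 _≠ᵇ_

_≠ᵇ_ : ℕ → ℕ → Bool
i ≠ᵇ j = not (does (i ≟ j))

≠ᵇ-sym : ∀ i j → i ≠ᵇ j ≡ j ≠ᵇ i
≠ᵇ-sym i j = cong not (does-⇔ (mk⇔ sym sym) (i ≟ j) (j ≟ i))

≠ᵇ-irrefl : ∀ i → i ≠ᵇ i ≡ false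
≠ᵇ-irrefl i = cong not (dec-true (i ≟ i) refl)

≢⇒≠ᵇ : ∀ {i j} → i ≢ j → T (i ≠ᵇ j)
≢⇒≠ᵇ {i} {j} i≢j = ≡true⇒T (cong not (dec-false (i ≟ j) i≢j))

≠ᵇ⇒≢ : ∀ {i j} → T (i ≠ᵇ j) → i ≢ j
≠ᵇ⇒≢ {i} t refl = ≡false⇒¬T (≠ᵇ-irrefl i) t

Clique : (A → A → Bool) → ℕ → List A → Set
Clique a s vs = ∃[ ks ] length ks ≡ s × All (_∈ vs) ks × AllPairs (λ x y → T (a x y)) ks

module _ (a : A → A → Bool) (a-sym : ∀ x y → a x y ≡ a y x) (a-irrefl : ∀ x → a x x ≡ false) where

  -- Erdős's degree majorization: a vertex v of maximum degree contributes its
  -- non-neighbours as one part, and its neighbourhood is treated recursively.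
  majorizing-colouring : ∀ r vs → ¬ Clique a (suc r) vs →
    ∃[ c ] (∀ x → x ∈ vs → c x < r) ×
           (edges a vs ≤ edges (λ x y → c x ≠ᵇ c y) vs) ×
           (edges a vs ≡ edges (λ x y → c x ≠ᵇ c y) vs →
            ∀ x y → x ∈ vs → y ∈ vs → a x y ≡ c x ≠ᵇ c y)
  majorizing-colouring r [] ¬K = (λ _ → 0) , (λ _ ()) , z≤n , (λ _ _ _ ())
  majorizing-colouring zero (v ∷ vs) ¬K =
    contradiction (v ∷ [] , refl , here refl ∷ [] , [] ∷ []) ¬K
  majorizing-colouring (suc r) (u ∷ us) ¬K
    with v , v∈ , max ← argmax (λ x → count (a x) (u ∷ us)) u us
    = c′ , c′<r , bound , tight
    where
    vs N M : List _
    vs = u ∷ us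
    N  = filter (λ x → T? (a v x)) vs
    M  = filter (λ x → ¬? (T? (a v x))) vs

    split : vs ↭ M ++ N
    split = ↭-trans (↭-filter-¬ (λ x → T? (a v x)) vs) (++-comm N M)

    ∈N : ∀ {x} → x ∈ N → x ∈ vs × T (a v x)
    ∈N = ∈-filter⁻ (λ x → T? (a v x)) {xs = vs}

    ∈M : ∀ {x} → x ∈ M → x ∈ vs × ¬ T (a v x)
    ∈M = ∈-filter⁻ (λ x → ¬? (T? (a v x))) {xs = vs}

    ¬K-N : ¬ Clique a (suc r) N
    ¬K-N (ks , len , ks∈ , pairs) = ¬K
      (v ∷ ks , cong suc len , v∈ ∷ All.map (proj₁ ∘ ∈N) ks∈ , All.map (proj₂ ∘ ∈N) ks∈ ∷ pairs)

    IH = majorizing-colouring r N ¬K-N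
    c : A → ℕ
    c = proj₁ IH
    c<r : ∀ x → x ∈ N → c x < r
    c<r = proj₁ (proj₂ IH)
    b : A → A → Bool
    b x y = c x ≠ᵇ c y
    bound-N : edges a N ≤ edges b N
    bound-N = proj₁ (proj₂ (proj₂ IH))

    -- The colours on `N` are below `r`, so `r` is fresh for the non-neighbours of `v`, among them
    -- `v` itself.
    c′ : A → ℕ
    c′ x = if a v x then c x else r

    c′-N : ∀ {x} → T (a v x) → c′ x ≡ c x
    c′-N t rewrite T⇒≡true t = refl

    c′-M : ∀ {x} → ¬ T (a v x) → c′ x ≡ r
    c′-M ¬t rewrite ¬T⇒≡false ¬t = refl

    c′<r : ∀ x → x ∈ vs → c′ x < suc r
    c′<r x x∈ with T? (a v x)
    ... | yes t rewrite c′-N t = m<n⇒m<1+n (c<r x (∈-filter⁺ (λ x → T? (a v x)) x∈ t))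
    ... | no ¬t rewrite c′-M ¬t = ≤-refl

    b′ : A → A → Bool
    b′ x y = c′ x ≠ᵇ c′ y

    M-N : ∀ x y → x ∈ M → y ∈ N → T (b′ x y)
    M-N x y x∈ y∈ = ≢⇒≠ᵇ λ eq → <-irrefl
      (≡-trans (sym (c′-N (proj₂ (∈N y∈)))) (≡-trans (sym eq) (c′-M (proj₂ (∈M x∈)))))
      (c<r y y∈)

    Δ : ℕ
    Δ = count (a v) vs

    Δ≡ : Δ ≡ length N
    Δ≡ = sym (count-filter (λ x → T? (a v x)) vs)

    degree-sum : cross a M (M ++ N) ≤ length M * Δ
    degree-sum = cross-≤ a Δ M (M ++ N) λ x x∈ → begin
      count (a x) (M ++ N) ≡⟨ sym (count-↭ (a x) split) ⟩
      count (a x) vs       ≤⟨ max x (proj₁ (∈M x∈)) ⟩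
      Δ                    ∎
      where open ≤-Reasoning

    -- The degree sum over `M` counts the edges inside `M` twice. The surplus copy is kept on the
    -- left because equality must later force it to vanish, which makes `M` independent.
    edges-a : edges a vs + edges a M ≡ cross a M (M ++ N) + edges a N
    edges-a rewrite edges-↭ a a-sym split | edges-++ a M N | cross-++ʳ a M M N
      | cross-self a a-sym a-irrefl M = rearrange (edges a M) _ _
      where
      rearrange : ∀ p q s → (p + (q + s)) + p ≡ ((p + p) + q) + s
      rearrange = solve-∀

    edges-b′ : edges b′ vs ≡ (length M * Δ + edges b N) + edges b′ M
    edges-b′ = begin
      edges b′ vs                                      ≡⟨ edges-↭ b′ (λ x y → ≠ᵇ-sym (c′ x) (c′ y)) split ⟩
      edges b′ (M ++ N)                                ≡⟨ edges-++ b′ M N ⟩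
      edges b′ M + (cross b′ M N + edges b′ N)         ≡⟨ +-comm (edges b′ M) _ ⟩
      cross b′ M N + edges b′ N + edges b′ M           ≡⟨ cong (_+ edges b′ M) (cong₂ _+_
        (≡-trans (cross-full b′ M N M-N) (cong (length M *_) (sym Δ≡)))
        (edges-cong b′ b N λ x y x∈ y∈ → cong₂ _≠ᵇ_ (c′-N (proj₂ (∈N x∈))) (c′-N (proj₂ (∈N y∈))))) ⟩
      length M * Δ + edges b N + edges b′ M            ∎
      where open ≡-Reasoning

    bound+ : edges a vs + edges a M ≤ length M * Δ + edges b N
    bound+ rewrite edges-a = +-mono-≤ degree-sum bound-N

    bound : edges a vs ≤ edges b′ vs
    bound = begin
      edges a vs                                  ≤⟨ m≤m+n _ _ ⟩
      edges a vs + edges a M                      ≤⟨ bound+ ⟩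
      length M * Δ + edges b N                    ≤⟨ m≤m+n _ _ ⟩
      (length M * Δ + edges b N) + edges b′ M     ≡⟨ sym edges-b′ ⟩
      edges b′ vs                                 ∎
      where open ≤-Reasoning

    tight : edges a vs ≡ edges b′ vs → ∀ x y → x ∈ vs → y ∈ vs → a x y ≡ b′ x y
    tight eq x y x∈ y∈ = adjacency (T? (a v x)) (T? (a v y))
      where
      excess : edges a vs + (edges a M + edges b′ M) ≤ edges a vs + 0
      excess = begin
        edges a vs + (edges a M + edges b′ M)   ≡⟨ sym (+-assoc (edges a vs) _ _) ⟩
        edges a vs + edges a M + edges b′ M     ≤⟨ +-monoˡ-≤ (edges b′ M) bound+ ⟩
        length M * Δ + edges b N + edges b′ M   ≡⟨ sym edges-b′ ⟩
        edges b′ vs                             ≡⟨ sym eq ⟩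
        edges a vs                              ≡⟨ sym (+-identityʳ _) ⟩
        edges a vs + 0                          ∎
        where open ≤-Reasoning
      none : edges a M + edges b′ M ≡ 0
      none = n≤0⇒n≡0 (+-cancelˡ-≤ (edges a vs) _ _ excess)
      aM≡0 : edges a M ≡ 0
      aM≡0 = m+n≡0⇒m≡0 _ none
      b′M≡0 : edges b′ M ≡ 0
      b′M≡0 = m+n≡0⇒n≡0 (edges a M) none
      total : cross a M (M ++ N) + edges a N ≡ length M * Δ + edges b N
      total = begin
        cross a M (M ++ N) + edges a N            ≡⟨ sym edges-a ⟩
        edges a vs + edges a M                    ≡⟨ cong (edges a vs +_) aM≡0 ⟩
        edges a vs + 0                            ≡⟨ +-identityʳ _ ⟩
        edges a vs                                ≡⟨ eq ⟩
        edges b′ vs                               ≡⟨ edges-b′ ⟩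
        length M * Δ + edges b N + edges b′ M     ≡⟨ cong (length M * Δ + edges b N +_) b′M≡0 ⟩
        length M * Δ + edges b N + 0              ≡⟨ +-identityʳ _ ⟩
        length M * Δ + edges b N                  ∎
        where open ≡-Reasoning
      N-tight : ∀ x y → x ∈ N → y ∈ N → a x y ≡ b x y
      N-tight = proj₂ (proj₂ (proj₂ IH)) (≤-+-tightʳ degree-sum bound-N total)
      cross-tight : cross a M N ≡ length M * length N
      cross-tight = begin
        cross a M N                 ≡⟨⟩
        0 + 0 + cross a M N         ≡⟨ cong (λ z → z + z + cross a M N) (sym aM≡0) ⟩
        edges a M + edges a M + cross a M N ≡⟨ cong (_+ cross a M N) (sym (cross-self a a-sym a-irrefl M)) ⟩
        cross a M M + cross a M N   ≡⟨ sym (cross-++ʳ a M M N) ⟩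
        cross a M (M ++ N)          ≡⟨ ≤-+-tightˡ degree-sum bound-N total ⟩
        length M * Δ                ≡⟨ cong (length M *_) Δ≡ ⟩
        length M * length N         ∎
        where open ≡-Reasoning
      a-M-N : ∀ x y → x ∈ M → y ∈ N → T (a x y)
      a-M-N = cross-full⁻ a M N cross-tight
      inN : ∀ {z} → z ∈ vs → T (a v z) → z ∈ N
      inN = ∈-filter⁺ (λ z → T? (a v z))
      inM : ∀ {z} → z ∈ vs → ¬ T (a v z) → z ∈ M
      inM = ∈-filter⁺ (λ z → ¬? (T? (a v z)))
      adjacency : Dec (T (a v x)) → Dec (T (a v y)) → a x y ≡ b′ x y
      adjacency (yes s) (yes t) =
        ≡-trans (N-tight x y (inN x∈ s) (inN y∈ t)) (sym (cong₂ _≠ᵇ_ (c′-N s) (c′-N t)))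
      adjacency (no s) (yes t) =
        ≡-trans (T⇒≡true (a-M-N x y (inM x∈ s) (inN y∈ t)))
                (sym (T⇒≡true (M-N x y (inM x∈ s) (inN y∈ t))))
      adjacency (yes s) (no t) =
        ≡-trans (a-sym x y) (≡-trans (T⇒≡true (a-M-N y x (inM y∈ t) (inN x∈ s)))
          (≡-trans (sym (T⇒≡true (M-N y x (inM y∈ t) (inN x∈ s)))) (≠ᵇ-sym (c′ y) (c′ x))))
      adjacency (no s) (no t) =
        ≡-trans (¬T⇒≡false (edges≡0⁻ a a-sym a-irrefl M aM≡0 x y (inM x∈ s) (inM y∈ t)))
          (sym (≡-trans (cong₂ _≠ᵇ_ (c′-M s) (c′-M t)) (≠ᵇ-irrefl r)))

-- Balanced colourings have the most edges

infix 5 _=ᵇ_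

_=ᵇ_ : ℕ → ℕ → Bool
i =ᵇ j = does (i ≟ j)

=ᵇ-refl : ∀ i → T (i =ᵇ i)
=ᵇ-refl i = ≡true⇒T (dec-true (i ≟ i) refl)

=ᵇ⇒≡ : ∀ {i j} → T (i =ᵇ j) → i ≡ j
=ᵇ⇒≡ {i} {j} = ≡ᵇ⇒≡ i j

=ᵇ-cong-⇔ : ∀ {i j k l} → (i ≡ j → k ≡ l) → (k ≡ l → i ≡ j) → i =ᵇ j ≡ k =ᵇ l
=ᵇ-cong-⇔ {i} {j} {k} {l} f g = does-⇔ (mk⇔ f g) (i ≟ j) (k ≟ l)

pigeonhole : ∀ (c : A → ℕ) q r vs → (∀ x → x ∈ vs → c x < r) → r * q < length vs →
             ∃[ i ] q < count (λ x → c x =ᵇ i) vs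
pigeonhole c q zero    (x ∷ vs) c<r _ with () ← c<r x (here refl)
pigeonhole c q (suc r) vs c<r big with q <? count (λ x → c x =ᵇ r) vs
... | yes q<  = r , q<
... | no ¬q< = proj₁ IH , <-≤-trans (proj₂ IH) shrink
  where
  r? : Decidable (λ x → c x ≡ r)
  r? x = c x ≟ r
  rest : List _
  rest = filter (¬? ∘ r?) vs
  rest<r : ∀ x → x ∈ rest → c x < r
  rest<r x x∈ with x∈vs , c≢r ← ∈-filter⁻ (¬? ∘ r?) {xs = vs} x∈ = ≤∧≢⇒< (s≤s⁻¹ (c<r x x∈vs)) c≢r
  split : length vs ≡ count (λ x → c x =ᵇ r) vs + length rest
  split = ≡-trans (↭-length (↭-filter-¬ r? vs))
    (≡-trans (length-++ (filter r? vs)) (cong (_+ length rest) (count-filter r? vs)))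
  rest-big : r * q < length rest
  rest-big = +-cancelˡ-< q _ _ (begin-strict
    q + r * q                                    <⟨ big ⟩
    length vs                                    ≡⟨ split ⟩
    count (λ x → c x =ᵇ r) vs + length rest      ≤⟨ +-monoˡ-≤ _ (≮⇒≥ ¬q<) ⟩
    q + length rest                              ∎)
    where open ≤-Reasoning
  IH : ∃[ i ] q < count (λ x → c x =ᵇ i) rest
  IH = pigeonhole c q r rest rest<r rest-big
  shrink : ∀ {i} → count (λ x → c x =ᵇ i) rest ≤ count (λ x → c x =ᵇ i) vs
  shrink {i} = begin
    count p rest                           ≤⟨ m≤n+m _ _ ⟩
    count p (filter r? vs) + count p rest  ≡⟨ sym (count-++ p (filter r? vs) rest) ⟩
    count p (filter r? vs ++ rest)         ≡⟨ sym (count-↭ p (↭-filter-¬ r? vs)) ⟩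
    count p vs                             ∎
    where
    open ≤-Reasoning
    p : _ → Bool
    p x = c x =ᵇ i

count-≡⇒↭ : ∀ xs ys → (∀ z → count (_=ᵇ z) xs ≡ count (_=ᵇ z) ys) → xs ↭ ys
count-≡⇒↭ []       []       eq = ↭-refl
count-≡⇒↭ []       (y ∷ ys) eq with () ← ≡-trans (eq y) (⟦T⟧+ (=ᵇ-refl y))
count-≡⇒↭ (x ∷ xs) ys       eq
  with z , z∈ , z=x ← count>0⁻ (_=ᵇ x) ys
         (subst (0 <_) (≡-trans (sym (⟦T⟧+ (=ᵇ-refl x))) (eq x)) z<s)
  with refl ← =ᵇ⇒≡ {z} {x} z=x
  with ys′ , σ ← ∈⇒↭ z∈ =
  ↭-trans (prep x (count-≡⇒↭ xs ys′ λ w →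
    +-cancelˡ-≡ ⟦ x =ᵇ w ⟧ _ _ (≡-trans (eq w) (count-↭ (_=ᵇ w) σ)))) (↭-sym σ)

transpose : ℕ → ℕ → ℕ → ℕ
transpose p q x = if x =ᵇ p then q else if x =ᵇ q then p else x

transpose-fst : ∀ p q → transpose p q p ≡ q
transpose-fst p q rewrite T⇒≡true (=ᵇ-refl p) = refl

transpose-involutive : ∀ p q x → transpose p q (transpose p q x) ≡ x
transpose-involutive p q x with x =ᵇ p in xp
... | true with q =ᵇ p in qp
...   | true  = ≡-trans (=ᵇ⇒≡ {q} {p} (≡true⇒T qp)) (sym (=ᵇ⇒≡ {x} {p} (≡true⇒T xp)))
...   | false rewrite T⇒≡true (=ᵇ-refl q) = sym (=ᵇ⇒≡ {x} {p} (≡true⇒T xp))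
transpose-involutive p q x | false with x =ᵇ q in xq
... | true rewrite T⇒≡true (=ᵇ-refl p) = sym (=ᵇ⇒≡ {x} {q} (≡true⇒T xq))
... | false rewrite xp | xq = refl

-- Exchanging two colours that occur equally often preserves every multiplicity. The tight case of
-- `colourEdges-bound` uses this to give a new vertex the residue that comes next.
transpose-↭ : ∀ p q xs → count (_=ᵇ p) xs ≡ count (_=ᵇ q) xs → map (transpose p q) xs ↭ xs
transpose-↭ p q xs eq = count-≡⇒↭ _ _ λ z → begin
  count (_=ᵇ z) (map τ xs)   ≡⟨ count-map (_=ᵇ z) τ xs ⟩
  count (λ x → τ x =ᵇ z) xs  ≡⟨ count-cong _ _ xs (λ x _ → =ᵇ-cong-⇔ {τ x} {z} {x} {τ z} (move x z) (move′ x z)) ⟩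
  count (_=ᵇ τ z) xs         ≡⟨ same z ⟩
  count (_=ᵇ z) xs           ∎
  where
  open ≡-Reasoning
  τ : ℕ → ℕ
  τ = transpose p q
  move : ∀ x z → τ x ≡ z → x ≡ τ z
  move x z e = ≡-trans (sym (transpose-involutive p q x)) (cong τ e)
  move′ : ∀ x z → x ≡ τ z → τ x ≡ z
  move′ x z e = ≡-trans (cong τ e) (transpose-involutive p q z)
  same : ∀ z → count (_=ᵇ τ z) xs ≡ count (_=ᵇ z) xs
  same z with z =ᵇ p in zp
  ... | true rewrite =ᵇ⇒≡ {z} {p} (≡true⇒T zp) = sym eq
  ... | false with z =ᵇ q in zq
  ...   | true rewrite =ᵇ⇒≡ {z} {q} (≡true⇒T zq) = eq
  ...   | false = refl

module _ (r : ℕ) .{{_ : NonZero r}} where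

  -- In Tᵣ(m + 1) the vertex m misses exactly the m / r earlier vertices of its residue class.
  turánEdges : ℕ → ℕ
  turánEdges zero    = 0
  turánEdges (suc m) = (m ∸ m / r) + turánEdges m

  residues : ℕ → List ℕ
  residues m = map (_% r) (downFrom m)

  /-unique : ∀ {a} q → a < r → (a + q * r) / r ≡ q
  /-unique {a} q a<r = begin
    (a + q * r) / r      ≡⟨ +-distrib-/-∣ʳ a (n∣m*n q) ⟩
    a / r + q * r / r    ≡⟨ cong₂ _+_ (m<n⇒m/n≡0 a<r) (m*n/n≡m q r) ⟩
    q                    ∎
    where open ≡-Reasoning

  %-unique : ∀ {a} q → a < r → (a + q * r) % r ≡ a
  %-unique {a} q a<r = ≡-trans ([m+kn]%n≡m%n a q r) (m<n⇒m%n≡m a<r)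

  private
    indicator-< : ∀ ρ b → ⟦ b =ᵇ ρ ⟧ + ⟦ does (ρ <? b) ⟧ ≡ ⟦ does (ρ <? suc b) ⟧
    indicator-< ρ b with <-cmp ρ b
    ... | tri< ρ<b ρ≢b _ rewrite dec-false (b ≟ ρ) (ρ≢b ∘ sym) | dec-true (ρ <? b) ρ<b
      | dec-true (ρ <? suc b) (m<n⇒m<1+n ρ<b) = refl
    ... | tri≈ ¬ρ<b refl _ rewrite dec-true (b ≟ b) refl | dec-false (b <? b) ¬ρ<b
      | dec-true (b <? suc b) ≤-refl = refl
    ... | tri> ¬ρ<b ρ≢b b<ρ rewrite dec-false (b ≟ ρ) (ρ≢b ∘ sym) | dec-false (ρ <? b) ¬ρ<b
      | dec-false (ρ <? suc b) (λ ρ≤b → <-irrefl refl (<-≤-trans b<ρ (s≤s⁻¹ ρ≤b))) = refl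

    -- For m = a + q * r the residue `ρ` occurs `q` times below m, and once more if ρ < a. Passing
    -- to m + 1 adds an occurrence of `a`; if suc a = r, the remainder wraps to 0 and the quotient
    -- takes over.
    step : ∀ ρ → ρ < r → ∀ a q → a < r →
           ⟦ a =ᵇ ρ ⟧ + (q + ⟦ does (ρ <? a) ⟧) ≡
           (suc a + q * r) / r + ⟦ does (ρ <? (suc a + q * r) % r) ⟧
    step ρ ρ<r a q a<r with m≤n⇒m<n∨m≡n a<r
    ... | inj₁ sa<r rewrite /-unique {suc a} q sa<r | %-unique {suc a} q sa<r | sym (indicator-< ρ a) =
      exchange ⟦ a =ᵇ ρ ⟧ q _
      where
      exchange : ∀ x y z → x + (y + z) ≡ y + (x + z)
      exchange = solve-∀
    ... | inj₂ sa≡r = begin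
      ⟦ a =ᵇ ρ ⟧ + (q + ⟦ does (ρ <? a) ⟧)    ≡⟨ exchange ⟦ a =ᵇ ρ ⟧ q _ ⟩
      q + (⟦ a =ᵇ ρ ⟧ + ⟦ does (ρ <? a) ⟧)    ≡⟨ cong (q +_) (indicator-< ρ a) ⟩
      q + ⟦ does (ρ <? suc a) ⟧               ≡⟨ cong (λ b → q + ⟦ b ⟧) (dec-true (ρ <? suc a) (subst (ρ <_) (sym sa≡r) ρ<r)) ⟩
      q + 1                                   ≡⟨ +-comm q 1 ⟩
      suc q                                   ≡⟨ sym (+-identityʳ _) ⟩
      suc q + 0                               ≡⟨ sym (cong₂ _+_ (/-unique (suc q) 0<r) (cong (λ z → ⟦ does (ρ <? z) ⟧) (%-unique (suc q) 0<r))) ⟩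
      (suc q * r) / r + ⟦ does (ρ <? (suc q * r) % r) ⟧ ≡⟨ cong (λ z → z / r + ⟦ does (ρ <? z % r) ⟧) (cong (_+ q * r) (sym sa≡r)) ⟩
      (suc a + q * r) / r + ⟦ does (ρ <? (suc a + q * r) % r) ⟧ ∎
      where
      open ≡-Reasoning
      0<r : 0 < r
      0<r = ≤-<-trans z≤n ρ<r
      exchange : ∀ x y z → x + (y + z) ≡ y + (x + z)
      exchange = solve-∀

  count-residues : ∀ ρ → ρ < r → ∀ m → count (_=ᵇ ρ) (residues m) ≡ m / r + ⟦ does (ρ <? m % r) ⟧
  count-residues ρ ρ<r zero rewrite /-unique 0 (≤-<-trans z≤n ρ<r) | %-unique 0 (≤-<-trans z≤n ρ<r) = refl
  count-residues ρ ρ<r (suc m) rewrite count-residues ρ ρ<r m =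
    ≡-trans (step ρ ρ<r (m % r) (m / r) (m%n<n m r))
      (cong (λ z → z / r + ⟦ does (ρ <? z % r) ⟧) (cong suc (sym (m≡m%n+[m/n]*n m r))))

  count-residue : ∀ m → count (_=ᵇ m % r) (residues m) ≡ m / r
  count-residue m = ≡-trans (count-residues (m % r) (m%n<n m r) m)
    (≡-trans (cong (λ b → m / r + ⟦ b ⟧) (dec-false (m % r <? m % r) (<-irrefl refl))) (+-identityʳ _))

  colourEdges : (A → ℕ) → List A → ℕ
  colourEdges c = edges (λ x y → c x ≠ᵇ c y)

  count-≠ᵇ : ∀ (c : A → ℕ) i vs → count (λ y → c y =ᵇ i) vs + count (λ y → i ≠ᵇ c y) vs ≡ length vs
  count-≠ᵇ c i vs = ≡-trans
    (cong (count (λ y → c y =ᵇ i) vs +_) (count-cong _ _ vs λ y _ → ≠ᵇ-sym i (c y)))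
    (count-not (λ y → c y =ᵇ i) vs)

  edges-residues : ∀ m → edges _≠ᵇ_ (residues m) ≡ turánEdges m
  edges-residues zero    = refl
  edges-residues (suc m) = cong₂ _+_ (begin
      count (m % r ≠ᵇ_) (residues m)                        ≡⟨ sym (m+n∸m≡n (m / r) _) ⟩
      (m / r + count (m % r ≠ᵇ_) (residues m)) ∸ m / r      ≡⟨ cong (_∸ m / r) total ⟩
      m ∸ m / r                                             ∎) (edges-residues m)
    where
    open ≡-Reasoning
    total : m / r + count (m % r ≠ᵇ_) (residues m) ≡ m
    total = begin
      m / r + count (m % r ≠ᵇ_) (residues m)   ≡⟨ cong (_+ count (m % r ≠ᵇ_) (residues m)) (sym (count-residue m)) ⟩
      _                                        ≡⟨ count-≠ᵇ id (m % r) (residues m) ⟩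
      length (residues m)                      ≡⟨ length-map _ (downFrom m) ⟩
      length (downFrom m)                      ≡⟨ length-downFrom m ⟩
      m                                        ∎

  -- Among `suc m` vertices some colour occurs more than `m / r` times. A vertex `x` of that colour
  -- misses at least `m / r` of the others and so contributes at most `m ∸ m / r`, the increment of
  -- `turánEdges`. In the tight case the class sizes are those of the residues, but the colours
  -- agree with the residues only after a renaming `π`.
  colourEdges-bound : ∀ (c : A → ℕ) m vs → length vs ≡ m → (∀ x → x ∈ vs → c x < r) →
    colourEdges c vs ≤ turánEdges m ×
    (colourEdges c vs ≡ turánEdges m →
     ∃[ π ] (∀ {i j} → π i ≡ π j → i ≡ j) × map (π ∘ c) vs ↭ residues m)
  colourEdges-bound c zero    []   len c<r = z≤n , λ _ → id , id , ↭-refl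
  colourEdges-bound c (suc m) vs len c<r
    with i , many ← pigeonhole c (m / r) r vs c<r
           (subst (r * (m / r) <_) (sym len) (s≤s (subst (_≤ m) (*-comm (m / r) r) (m/n*n≤m m r))))
    with x , x∈ , cx=i ← count>0⁻ (λ x → c x =ᵇ i) vs (≤-<-trans z≤n many)
    with refl ← =ᵇ⇒≡ {c x} {i} cx=i
    with us , σ ← ∈⇒↭ x∈ = bound , tight
    where
    len-us : length us ≡ m
    len-us = suc-injective (≡-trans (sym (↭-length σ)) len)
    IH : _
    IH = colourEdges-bound c m us len-us (λ y y∈ → c<r y (∈-resp-↭ (↭-sym σ) (there y∈)))
    edges-vs : colourEdges c vs ≡ count (λ y → c x ≠ᵇ c y) us + colourEdges c us
    edges-vs = edges-↭ _ (λ x y → ≠ᵇ-sym (c x) (c y)) σ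
    same≥ : m / r ≤ count (λ y → c y =ᵇ c x) us
    same≥ = s≤s⁻¹ (subst (m / r <_) (≡-trans (count-↭ (λ y → c y =ᵇ c x) σ)
      (⟦T⟧+ (=ᵇ-refl (c x)))) many)
    other≡ : count (λ y → c x ≠ᵇ c y) us ≡ m ∸ count (λ y → c y =ᵇ c x) us
    other≡ = begin
      count (λ y → c x ≠ᵇ c y) us          ≡⟨ sym (m+n∸m≡n (count (λ y → c y =ᵇ c x) us) _) ⟩
      (count (λ y → c y =ᵇ c x) us + count (λ y → c x ≠ᵇ c y) us) ∸ count (λ y → c y =ᵇ c x) us
        ≡⟨ cong (_∸ count (λ y → c y =ᵇ c x) us) (≡-trans (count-≠ᵇ c (c x) us) len-us) ⟩
      m ∸ count (λ y → c y =ᵇ c x) us      ∎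
      where open ≡-Reasoning
    other≤ : count (λ y → c x ≠ᵇ c y) us ≤ m ∸ m / r
    other≤ = subst (_≤ m ∸ m / r) (sym other≡) (∸-monoʳ-≤ m same≥)
    bound : colourEdges c vs ≤ turánEdges (suc m)
    bound = subst (_≤ turánEdges (suc m)) (sym edges-vs) (+-mono-≤ other≤ (proj₁ IH))
    tight : colourEdges c vs ≡ turánEdges (suc m) →
            ∃[ π ] (∀ {i j} → π i ≡ π j → i ≡ j) × map (π ∘ c) vs ↭ residues (suc m)
    tight eq with π , inj , ρ ← proj₂ IH (≤-+-tightʳ other≤ (proj₁ IH) (≡-trans (sym edges-vs) eq))
      = τ ∘ π , inj ∘ τ-inj , perm
      where
      -- By tightness the class of `x` has exactly `m / r` members in `us`, as many as the residue
      -- `m % r`. Swapping the two names sends the colour of `x` to `m % r` and leaves the multiset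
      -- on `us` unchanged.
      τ : ℕ → ℕ
      τ = transpose (π (c x)) (m % r)
      τ-inj : ∀ {i j} → τ i ≡ τ j → i ≡ j
      τ-inj {i} {j} e = ≡-trans (sym (transpose-involutive _ (m % r) i))
        (≡-trans (cong τ e) (transpose-involutive _ (m % r) j))
      same≡ : count (λ y → c y =ᵇ c x) us ≡ m / r
      same≡ = ∸-cancelˡ-≡ (subst (count (λ y → c y =ᵇ c x) us ≤_) len-us (count≤length _ us)) (m/n≤m m r)
        (≡-trans (sym other≡) (≤-+-tightˡ other≤ (proj₁ IH) (≡-trans (sym edges-vs) eq)))
      balanced : count (_=ᵇ π (c x)) (residues m) ≡ count (_=ᵇ m % r) (residues m)
      balanced = begin
        count (_=ᵇ π (c x)) (residues m)          ≡⟨ sym (count-↭ _ ρ) ⟩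
        count (_=ᵇ π (c x)) (map (π ∘ c) us)      ≡⟨ count-map _ (π ∘ c) us ⟩
        count (λ y → π (c y) =ᵇ π (c x)) us
          ≡⟨ count-cong _ _ us (λ y _ → =ᵇ-cong-⇔ {π (c y)} {π (c x)} {c y} {c x} inj (cong π)) ⟩
        count (λ y → c y =ᵇ c x) us               ≡⟨ same≡ ⟩
        m / r                                     ≡⟨ sym (count-residue m) ⟩
        count (_=ᵇ m % r) (residues m)            ∎
        where open ≡-Reasoning
      perm : map (τ ∘ π ∘ c) vs ↭ residues (suc m)
      perm = ↭-trans (map⁺ (τ ∘ π ∘ c) σ)
        (subst (_↭ residues (suc m)) (cong₂ _∷_ (sym (transpose-fst (π (c x)) (m % r)))
          (sym (map-∘ us)))
          (prep (m % r) (↭-trans (map⁺ τ ρ) (transpose-↭ (π (c x)) (m % r) (residues m) balanced))))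

-- Edges, isomorphisms and vertex deletion

unique-↭ : ∀ {xs ys : List A} → Unique xs → Unique ys →
           (∀ {x} → x ∈ xs → x ∈ ys) → (∀ {x} → x ∈ ys → x ∈ xs) → xs ↭ ys
unique-↭ uxs uys f g = ∼bag⇒↭ (unique∧set⇒bag uxs uys (mk⇔ f g))

spanning-↭ : ∀ {xs : List (Fin n)} → Unique xs → Spanning xs → xs ↭ allFin n
spanning-↭ u s = unique-↭ u (Unique.allFin⁺ _) (λ {x} _ → ∈-allFin x) (λ {x} _ → s x)

private
  count-product : ∀ (p : Fin n → Fin n → Bool) xs ys →
    count (λ (i , j) → p i j) (cartesianProduct xs ys) ≡ cross p xs ys
  count-product p []       ys = refl
  count-product p (x ∷ xs) ys = ≡-trans (count-++ (λ (i , j) → p i j) (map (x ,_) ys) _)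
    (cong₂ _+_ (count-map (λ (i , j) → p i j) (x ,_) ys) (count-product p xs ys))

  module _ (G : Graph n) where

    p : Fin n → Fin n → Bool
    p i j = does ((i Fin.<? j) ×-dec adj? G i j)

    p-< : ∀ {i j} → i Fin.< j → p i j ≡ adj G i j
    p-< {i} {j} i<j rewrite dec-true (i Fin.<? j) i<j = refl

    p-≮ : ∀ {i j} → ¬ i Fin.< j → ¬ T (p i j)
    p-≮ {i} {j} i≮j rewrite dec-false (i Fin.<? j) i≮j = λ ()

    cross-p-∷ʳ : ∀ y xs ys → All (y Fin.<_) xs → cross p xs (y ∷ ys) ≡ cross p xs ys
    cross-p-∷ʳ y []       ys _          = refl
    cross-p-∷ʳ y (x ∷ xs) ys (y<x ∷ y<) rewrite ⟦¬T⟧ (p-≮ {x} {y} (Fin.<-asym y<x)) =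
      cong (count (p x) ys +_) (cross-p-∷ʳ y xs ys y<)

    cross-p : ∀ xs → AllPairs Fin._<_ xs → cross p xs xs ≡ edges (adj G) xs
    cross-p []       _          = refl
    cross-p (x ∷ xs) (x< ∷ sorted) = cong₂ _+_
      (≡-trans (cong (_+ count (p x) xs) (⟦¬T⟧ (p-≮ {x} {x} (Fin.<-irrefl refl))))
               (count-cong (p x) (adj G x) xs (λ y y∈ → p-< (All.lookup x< y∈))))
      (≡-trans (cross-p-∷ʳ x xs xs x<) (cross-p xs sorted))

-- `e` keeps the ordered pairs with i < j; along the sorted list `allFin n` these are the pairs of
-- an element with a later one.
e≡edges : ∀ (G : Graph n) → e G ≡ edges (adj G) (allFin n)
e≡edges {n} G = begin
  e G                                               ≡⟨ count-filter (λ (i , j) → (i Fin.<? j) ×-dec adj? G i j) (cartesianProduct (allFin n) (allFin n)) ⟩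
  count (λ (i , j) → p G i j) (cartesianProduct (allFin n) (allFin n)) ≡⟨ count-product (p G) (allFin n) (allFin n) ⟩
  cross (p G) (allFin n) (allFin n)                  ≡⟨ cross-p G (allFin n) (AllPairs.tabulate⁺-< id) ⟩
  edges (adj G) (allFin n)                           ∎
  where open ≡-Reasoning

degree≡count : ∀ (G : Graph n) v → degree G v ≡ count (adj G v) (allFin n)
degree≡count G v = count-filter (adj? G v) (allFin _)

edges-spanning : ∀ (G : Graph n) {xs} → xs ↭ allFin n → e G ≡ edges (adj G) xs
edges-spanning G σ = ≡-trans (e≡edges G) (sym (edges-↭ (adj G) (symmetric G) σ))

e-≅ : ∀ (G : Graph m) (H : Graph n) → G ≅ H → e G ≡ e H
e-≅ {m} {n} G H (f , f-adj) = begin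
  e G                                                ≡⟨ e≡edges G ⟩
  edges (adj G) (allFin m)                           ≡⟨ edges-cong _ _ (allFin m) (λ x y _ _ → f-adj x y) ⟩
  edges (λ x y → adj H (to x) (to y)) (allFin m)     ≡⟨ sym (edges-map (adj H) to (allFin m)) ⟩
  edges (adj H) (map to (allFin m))                  ≡⟨ sym (edges-spanning H (spanning-↭ unique spanning)) ⟩
  e H                                                ∎
  where
  open ≡-Reasoning
  to : Fin m → Fin n
  to = Inverse.to f
  unique : Unique (map to (allFin m))
  unique = Unique.map⁺ (λ {x} {y} eq → ≡-trans (sym (Inverse.strictlyInverseʳ f x))
    (≡-trans (cong (Inverse.from f) eq) (Inverse.strictlyInverseʳ f y))) (Unique.allFin⁺ m)
  spanning : Spanning (map to (allFin m))
  spanning v = subst (_∈ map to (allFin m)) (Inverse.strictlyInverseˡ f v) (∈-map⁺ to (∈-allFin _))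

map-toℕ-allFin : ∀ n → map toℕ (allFin n) ≡ upTo n
map-toℕ-allFin n = go id n
  where
  go : ∀ (f : ℕ → ℕ) n → map (f ∘ toℕ) (allFin n) ≡ applyUpTo f n
  go f zero    = refl
  go f (suc n) = cong (f 0 ∷_) (≡-trans
    (≡-trans (map-tabulate suc (f ∘ toℕ)) (sym (map-tabulate id (f ∘ suc ∘ toℕ))))
    (go (f ∘ suc) n))

module _ (r : ℕ) .{{_ : NonZero r}} where

  colours-turán : ∀ m → map (λ i → toℕ i % r) (allFin m) ↭ residues r m
  colours-turán m = subst (_↭ residues r m)
    (≡-trans (cong (map (_% r)) (sym (map-toℕ-allFin m))) (sym (map-∘ (allFin m))))
    (map⁺ (_% r) (subst (_↭ downFrom m) (reverse-downFrom m) (↭-reverse (downFrom m))))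

  e-turán : ∀ m → e (turán r m) ≡ turánEdges r m
  e-turán m = begin
    e (turán r m)                                              ≡⟨ e≡edges (turán r m) ⟩
    edges (adj (turán r m)) (allFin m)                         ≡⟨ sym (edges-map _≠ᵇ_ (λ i → toℕ i % r) (allFin m)) ⟩
    edges _≠ᵇ_ (map (λ i → toℕ i % r) (allFin m))              ≡⟨ edges-↭ _≠ᵇ_ ≠ᵇ-sym (colours-turán m) ⟩
    edges _≠ᵇ_ (residues r m)                                  ≡⟨ edges-residues r m ⟩
    turánEdges r m                                             ∎
    where open ≡-Reasoning

  -- Two bounds are chained: from `a` to its majorizing colouring, and from there to a balanced one.
  -- Equality forces equality in both, so `a` is complete multipartite with balanced classes; after
  -- renaming by `π` the colours form the list `residues`, from which isomorphisms can be built.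
  turán-theorem : ∀ (a : A → A → Bool) → (∀ x y → a x y ≡ a y x) → (∀ x → a x x ≡ false) →
    ∀ vs → ¬ Clique a (suc r) vs →
    edges a vs ≤ turánEdges r (length vs) ×
    (edges a vs ≡ turánEdges r (length vs) →
     ∃[ c ] map c vs ↭ residues r (length vs) × (∀ x y → x ∈ vs → y ∈ vs → a x y ≡ c x ≠ᵇ c y))
  turán-theorem a a-sym a-irrefl vs ¬K
    with c , c<r , a≤c , structure ← majorizing-colouring a a-sym a-irrefl r vs ¬K
    with c≤t , balance ← colourEdges-bound r c (length vs) vs refl c<r
    = ≤-trans a≤c c≤t , tight
    where
    tight : edges a vs ≡ turánEdges r (length vs) → _
    tight eq with a≡c ← ≤-antisym a≤c (≤-trans c≤t (≤-reflexive (sym eq)))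
      with π , inj , σ ← balance (≡-trans (sym a≡c) eq)
      = π ∘ c , σ , λ x y x∈ y∈ → ≡-trans (structure a≡c x y x∈ y∈)
          (cong not (=ᵇ-cong-⇔ {c x} {c y} {π (c x)} {π (c y)} (cong π) inj))

AllPairs-lookup : ∀ {R : A → A → Set} → (∀ {x y} → R x y → R y x) → ∀ {xs} → AllPairs R xs →
                  ∀ i j → i ≢ j → R (lookup xs i) (lookup xs j)
AllPairs-lookup R-sym (r ∷ rs) zero    zero    i≢j = contradiction refl i≢j
AllPairs-lookup R-sym (r ∷ rs) zero    (suc j) i≢j = All.lookup r (∈-lookup j)
AllPairs-lookup R-sym (r ∷ rs) (suc i) zero    i≢j = R-sym (All.lookup r (∈-lookup i))
AllPairs-lookup R-sym (r ∷ rs) (suc i) (suc j) i≢j = AllPairs-lookup R-sym rs i j (i≢j ∘ cong suc)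

Adj-sym : ∀ (G : Graph n) {x y} → Adj G x y → Adj G y x
Adj-sym G {x} {y} = subst T (symmetric G x y)

Adj-irrefl : ∀ (G : Graph n) {x} → ¬ Adj G x x
Adj-irrefl G {x} = ≡false⇒¬T (loopless G x)

clique⇒⊑ : ∀ (G : Graph n) {s vs} → Clique (adj G) s vs → complete s ⊑ G
clique⇒⊑ G (ks , refl , _ , pairs) = lookup ks , injective , λ i j t → adjacent i j (λ i≡j → ≠ᵇ⇒≢ t (cong toℕ i≡j))
  where
  adjacent : ∀ i j → i ≢ j → Adj G (lookup ks i) (lookup ks j)
  adjacent = AllPairs-lookup (Adj-sym G) pairs
  injective : ∀ {i j} → lookup ks i ≡ lookup ks j → i ≡ j
  injective {i} {j} eq with i Fin.≟ j
  ... | yes i≡j = i≡j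
  ... | no i≢j  = contradiction (subst (λ x → Adj G x (lookup ks j)) eq (adjacent i j i≢j)) (Adj-irrefl G)

-- A permutation between the two lists of colours is a bijection of positions that preserves
-- colours, and adjacency depends on colours alone.
iso-from-colours : ∀ (G : Graph m) (H : Graph n) (c : Fin m → ℕ) (d : Fin n → ℕ) →
  (∀ i j → adj G i j ≡ c i ≠ᵇ c j) → (∀ i j → adj H i j ≡ d i ≠ᵇ d j) →
  map c (allFin m) ↭ map d (allFin n) → G ≅ H
iso-from-colours {m} {n} G H c d G-c H-d σ =
  f , λ i j → ≡-trans (G-c i j) (≡-trans (cong₂ _≠ᵇ_ (f-colour i) (f-colour j)) (sym (H-d _ _)))
  where
  τ : PermutationSetoid._↭_ (setoid ℕ) (tabulate c) (tabulate d)
  τ = ↭⇒↭ₛ (subst (_↭ tabulate d) (map-tabulate id c) (subst (map c (allFin m) ↭_) (map-tabulate id d) σ))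
  g : Fin (length (tabulate c)) ↔ Fin (length (tabulate d))
  g = Homogeneous.onIndices τ
  f : Fin m ↔ Fin n
  f = ↔-trans (Permutation.cast-id (sym (length-tabulate c)))
        (↔-trans g (Permutation.cast-id (length-tabulate d)))
  f-colour : ∀ i → c i ≡ d (Inverse.to f i)
  f-colour i = begin
    c i                                          ≡⟨ sym (lookup-tabulate c i) ⟩
    lookup (tabulate c) i′                       ≡⟨ onIndices-lookup (setoid ℕ) τ i′ ⟩
    lookup (tabulate d) (Inverse.to g i′)        ≡⟨ cong (lookup (tabulate d)) back ⟩
    lookup (tabulate d) (Fin.cast (sym (length-tabulate d)) (Inverse.to f i)) ≡⟨ lookup-tabulate d (Inverse.to f i) ⟩
    d (Inverse.to f i)                           ∎
    where
    open ≡-Reasoning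
    i′ : Fin (length (tabulate c))
    i′ = Fin.cast (sym (length-tabulate c)) i
    back : Inverse.to g i′ ≡ Fin.cast (sym (length-tabulate d)) (Inverse.to f i)
    back = sym (Fin.cast-involutive {n} {length (tabulate d)} (sym (length-tabulate d)) (length-tabulate d) (Inverse.to g i′))

iso-multipartite : ∀ (G : Graph m) (c : Fin m → ℕ) (d : Fin n → ℕ) → (∀ i j → adj G i j ≡ c i ≠ᵇ c j) →
  map c (allFin m) ↭ map d (allFin n) → G ≅ multipartite d
iso-multipartite G c d G-c = iso-from-colours G (multipartite d) c d G-c (λ _ _ → refl)

module _ (G : Graph n) (v : Fin n) where

  others : List (Fin n)
  others = filter (λ u → ¬? (u Fin.≟ v)) (allFin n)

  ∈others : ∀ {u} → u ≢ v → u ∈ others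
  ∈others u≢v = ∈-filter⁺ (λ u → ¬? (u Fin.≟ v)) (∈-allFin _) u≢v

  ∈others⁻ : ∀ {u} → u ∈ others → u ≢ v
  ∈others⁻ u∈ = proj₂ (∈-filter⁻ (λ u → ¬? (u Fin.≟ v)) {xs = allFin n} u∈)

  others-↭ : v ∷ others ↭ allFin n
  others-↭ = spanning-↭ (All.tabulate (λ {u} u∈ v≡u → ∈others⁻ u∈ (sym v≡u)) ∷
                          Unique.filter⁺ (λ u → ¬? (u Fin.≟ v)) (Unique.allFin⁺ n)) spanning
    where
    spanning : Spanning (v ∷ others)
    spanning u with u Fin.≟ v
    ... | yes refl = here refl
    ... | no u≢v   = there (∈others u≢v)

  length-others : length others ≡ n ∸ 1
  length-others = cong (_∸ 1) (≡-trans (↭-length others-↭) (length-tabulate {n = n} (id {A = Fin n})))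

  degree-others : degree G v ≡ count (adj G v) others
  degree-others = ≡-trans (degree≡count G v) (≡-trans (count-↭ (adj G v) (↭-sym others-↭))
    (cong (λ b → ⟦ b ⟧ + count (adj G v) others) (loopless G v)))

  map-lookup-others : map (lookup others) (allFin (length others)) ≡ others
  map-lookup-others = ≡-trans (map-tabulate id (lookup others)) (tabulate-lookup others)

  e-delete : e (G -ᵛ v) ≡ edges (adj G) others
  e-delete = ≡-trans (e≡edges (G -ᵛ v))
    (≡-trans (sym (edges-map (adj G) (lookup others) (allFin (length others))))
             (cong (edges (adj G)) map-lookup-others))

  e-split : e G ≡ degree G v + e (G -ᵛ v)
  e-split = ≡-trans (edges-spanning G others-↭) (cong₂ _+_ (sym degree-others) (sym e-delete))

-- Crossing two steps of a Hamiltonian path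

-- The consecutive pairs form a list so that they can be counted: the crossing argument is a
-- counting argument over steps.
steps : List A → List (A × A)
steps []           = []
steps (x ∷ [])     = []
steps (x ∷ y ∷ zs) = (x , y) ∷ steps (y ∷ zs)

Along : List A → A → A → Set
Along xs u v = (u , v) ∈ steps xs ⊎ (v , u) ∈ steps xs

steps-++ : ∀ (xs : List A) u v ys → steps ((xs ++ [ u ]) ++ (v ∷ ys)) ≡ steps (xs ++ [ u ]) ++ (u , v) ∷ steps (v ∷ ys)
steps-++ []           u v ys = refl
steps-++ (x ∷ [])     u v ys = refl
steps-++ (x ∷ z ∷ xs) u v ys = cong ((x , z) ∷_) (steps-++ (z ∷ xs) u v ys)

steps-split : ∀ (xs : List A) y zs → steps (xs ++ y ∷ zs) ≡ steps (xs ++ [ y ]) ++ steps (y ∷ zs)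
steps-split []           y zs = refl
steps-split (x ∷ [])     y zs = refl
steps-split (x ∷ z ∷ xs) y zs = cong ((x , z) ∷_) (steps-split (z ∷ xs) y zs)

map-proj₂-steps : ∀ x (xs : List A) → map proj₂ (steps (x ∷ xs)) ≡ xs
map-proj₂-steps x []       = refl
map-proj₂-steps x (y ∷ xs) = cong (y ∷_) (map-proj₂-steps y xs)

map-proj₁-steps : ∀ (xs : List A) y → map proj₁ (steps (xs ++ [ y ])) ≡ xs
map-proj₁-steps []           y = refl
map-proj₁-steps (x ∷ [])     y = refl
map-proj₁-steps (x ∷ z ∷ xs) y = cong (x ∷_) (map-proj₁-steps (z ∷ xs) y)

steps⇒∈ : ∀ {u v : A} xs → (u , v) ∈ steps xs → u ∈ xs × v ∈ xs
steps⇒∈ (x ∷ y ∷ xs) (here refl) = here refl , there (here refl)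
steps⇒∈ (x ∷ y ∷ xs) (there s)   with u∈ , v∈ ← steps⇒∈ (y ∷ xs) s = there u∈ , there v∈

steps⇒≡ : ∀ {u v : A} xs → (u , v) ∈ steps xs → ∃[ as ] ∃[ bs ] xs ≡ as ++ u ∷ v ∷ bs
steps⇒≡ (x ∷ y ∷ xs) (here refl) = [] , xs , refl
steps⇒≡ (x ∷ y ∷ xs) (there s) with as , bs , eq ← steps⇒≡ (y ∷ xs) s = x ∷ as , bs , cong (x ∷_) eq

≡⇒steps : ∀ (as : List A) u v bs → (u , v) ∈ steps (as ++ u ∷ v ∷ bs)
≡⇒steps []           u v bs = here refl
≡⇒steps (x ∷ [])     u v bs = there (here refl)
≡⇒steps (x ∷ y ∷ as) u v bs = there (≡⇒steps (y ∷ as) u v bs)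

steps-reverse : ∀ {u v : A} xs → (u , v) ∈ steps xs → (v , u) ∈ steps (reverse xs)
steps-reverse xs s with as , bs , refl ← steps⇒≡ xs s =
  subst (λ l → (_ , _) ∈ steps l) (sym eq) (≡⇒steps (reverse bs) _ _ (reverse as))
  where
  eq : reverse (as ++ _ ∷ _ ∷ bs) ≡ reverse bs ++ _ ∷ _ ∷ reverse as
  eq = begin
    reverse (as ++ _ ∷ _ ∷ bs)                 ≡⟨ reverse-++ as _ ⟩
    reverse (_ ∷ _ ∷ bs) ++ reverse as         ≡⟨ cong (_++ reverse as) (reverse-++ (_ ∷ _ ∷ []) bs) ⟩
    (reverse bs ++ _ ∷ _ ∷ []) ++ reverse as   ≡⟨ ++-assoc (reverse bs) _ _ ⟩
    reverse bs ++ _ ∷ _ ∷ reverse as           ∎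
    where open ≡-Reasoning

steps-++ˡ : ∀ {p : A × A} xs ys → p ∈ steps ys → p ∈ steps (xs ++ ys)
steps-++ˡ {p = p} xs (y ∷ ys) s = subst (p ∈_) (sym (steps-split xs y ys)) (∈-++⁺ʳ (steps (xs ++ [ y ])) s)

steps-++ʳ : ∀ {p : A × A} xs ys → p ∈ steps xs → p ∈ steps (xs ++ ys)
steps-++ʳ (x ∷ y ∷ xs) ys (here refl) = here refl
steps-++ʳ (x ∷ y ∷ xs) ys (there s)   = there (steps-++ʳ (y ∷ xs) ys s)

Consecutive⇒steps : ∀ {u v : Fin n} {xs} → Consecutive xs u v → (u , v) ∈ steps xs
Consecutive⇒steps (Infix.here (refl ∷ refl ∷ []))    = here refl
Consecutive⇒steps {xs = x ∷ y ∷ xs} (Infix.there c)  = there (Consecutive⇒steps c)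
Consecutive⇒steps {xs = x ∷ []} (Infix.there (Infix.here ()))

steps⇒Consecutive : ∀ {u v : Fin n} xs → (u , v) ∈ steps xs → Consecutive xs u v
steps⇒Consecutive (x ∷ y ∷ xs) (here refl) = Infix.here (refl ∷ refl ∷ [])
steps⇒Consecutive (x ∷ y ∷ xs) (there s)   = Infix.there (steps⇒Consecutive (y ∷ xs) s)

steps⇒Linked : ∀ {R : A → A → Set} xs → (∀ u v → (u , v) ∈ steps xs → R u v) → Linked R xs
steps⇒Linked []           f = []
steps⇒Linked (x ∷ [])     f = [-]
steps⇒Linked (x ∷ y ∷ xs) f = f x y (here refl) ∷ steps⇒Linked (y ∷ xs) (λ u v s → f u v (there s))

Linked⇒steps : ∀ {R : A → A → Set} {xs u v} → Linked R xs → (u , v) ∈ steps xs → R u v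
Linked⇒steps (r ∷ rs) (here refl) = r
Linked⇒steps (r ∷ rs) (there s)   = Linked⇒steps rs s

rotate-steps : ∀ {p : Fin n × Fin n} as bs → p ∈ steps (close (as ++ bs)) → p ∈ steps (close (bs ++ as))
rotate-steps {p = p} [] bs s = subst (λ l → p ∈ steps (close l)) (sym (++-identityʳ bs)) s
rotate-steps {p = p} (x ∷ as) [] s = subst (λ l → p ∈ steps (close l)) (++-identityʳ (x ∷ as)) s
rotate-steps {p = p} (x ∷ as) (y ∷ bs) s
  with ∈-++⁻ (steps ((x ∷ as) ++ [ y ])) (subst (p ∈_) (≡-trans
         (cong steps (++-assoc (x ∷ as) (y ∷ bs) [ x ])) (steps-split (x ∷ as) y (bs ++ [ x ]))) s)
... | inj₁ s′ = subst (λ l → p ∈ steps l) (sym (++-assoc (y ∷ bs) (x ∷ as) [ y ]))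
                  (steps-++ˡ (y ∷ bs) ((x ∷ as) ++ [ y ]) s′)
... | inj₂ s′ = subst (p ∈_) (sym (≡-trans (cong steps (++-assoc (y ∷ bs) (x ∷ as) [ y ]))
                  (steps-split (y ∷ bs) x (as ++ [ y ]))))
                  (∈-++⁺ˡ s′)

-- Opening a cycle at the step p → q gives a path from q to p.
open-cycle : ∀ {p q : Fin n} zs → (p , q) ∈ steps (close zs) →
  ∃[ ms ] (∃[ as ] ∃[ bs ] zs ≡ as ++ bs × ms ++ [ p ] ≡ bs ++ as) × take 1 (ms ++ [ p ]) ≡ [ q ]
open-cycle {p = p} {q} (x ∷ xs) s with as , bs , eq ← steps⇒≡ (close (x ∷ xs)) s with initLast bs
... | [] with eq₁ , refl ← ∷ʳ-injective (x ∷ xs) (as ++ [ p ]) (≡-trans eq (sym (++-assoc as [ p ] [ q ]))) =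
  as , ([] , x ∷ xs , refl , ≡-trans (sym eq₁) (sym (++-identityʳ _))) , cong (take 1) (sym eq₁)
... | bs′ ∷ʳ′ z with eq₁ , refl ← ∷ʳ-injective (x ∷ xs) (as ++ p ∷ q ∷ bs′) (≡-trans eq (sym (++-assoc as (p ∷ q ∷ bs′) [ z ]))) =
  q ∷ bs′ ++ as , (as ++ [ p ] , q ∷ bs′ , ≡-trans eq₁ (sym (++-assoc as [ p ] (q ∷ bs′)))
                  , cong (q ∷_) (++-assoc bs′ as [ p ])) , refl

joins : Fin n × Fin n → Fin n × Fin n → Bool
joins (s , t) (c , d) = (does (c Fin.≟ s) ∧ does (d Fin.≟ t)) ∨ (does (c Fin.≟ t) ∧ does (d Fin.≟ s))

does⁻ : ∀ {P : Set} (P? : Dec P) → T (does P?) → P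
does⁻ (yes p) _ = p

does⁺ : ∀ {P : Set} (P? : Dec P) → P → T (does P?)
does⁺ (yes _) _ = tt
does⁺ (no ¬p) p = ¬p p

joins⁻ : ∀ {s t c d : Fin n} → T (joins (s , t) (c , d)) → (c ≡ s × d ≡ t) ⊎ (c ≡ t × d ≡ s)
joins⁻ {s = s} {t} {c} {d} j with Equivalence.to (T-∨ {does (c Fin.≟ s) ∧ does (d Fin.≟ t)}) j
... | inj₁ j₁ with x , y ← Equivalence.to (T-∧ {does (c Fin.≟ s)}) j₁ =
  inj₁ (does⁻ (c Fin.≟ s) x , does⁻ (d Fin.≟ t) y)
... | inj₂ j₂ with x , y ← Equivalence.to (T-∧ {does (c Fin.≟ t)}) j₂ =
  inj₂ (does⁻ (c Fin.≟ t) x , does⁻ (d Fin.≟ s) y)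

joins-same : ∀ (s t : Fin n) → T (joins (s , t) (s , t))
joins-same s t = Equivalence.from (T-∨ {does (s Fin.≟ s) ∧ does (t Fin.≟ t)})
  (inj₁ (Equivalence.from (T-∧ {does (s Fin.≟ s)}) (does⁺ (s Fin.≟ s) refl , does⁺ (t Fin.≟ t) refl)))

joins-flip : ∀ (s t : Fin n) → T (joins (s , t) (t , s))
joins-flip s t = Equivalence.from (T-∨ {does (t Fin.≟ s) ∧ does (s Fin.≟ t)})
  (inj₂ (Equivalence.from (T-∧ {does (t Fin.≟ t)}) (does⁺ (t Fin.≟ t) refl , does⁺ (s Fin.≟ s) refl)))

joins-sym : ∀ (s t c d : Fin n) → joins (s , t) (c , d) ≡ joins (s , t) (d , c)
joins-sym s t c d with c Fin.≟ s | d Fin.≟ t | c Fin.≟ t | d Fin.≟ s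
... | yes _ | yes _ | yes _ | yes _ = refl
... | yes _ | yes _ | yes _ | no _  = refl
... | yes _ | yes _ | no _  | yes _ = refl
... | yes _ | yes _ | no _  | no _  = refl
... | yes _ | no _  | yes _ | yes _ = refl
... | yes _ | no _  | yes _ | no _  = refl
... | yes _ | no _  | no _  | yes _ = refl
... | yes _ | no _  | no _  | no _  = refl
... | no _  | yes _ | yes _ | yes _ = refl
... | no _  | yes _ | yes _ | no _  = refl
... | no _  | yes _ | no _  | yes _ = refl
... | no _  | yes _ | no _  | no _  = refl
... | no _  | no _  | yes _ | yes _ = refl
... | no _  | no _  | yes _ | no _  = refl
... | no _  | no _  | no _  | yes _ = refl
... | no _  | no _  | no _  | no _  = refl

-- Once a step has left `x`, that vertex does not recur, so the same pair cannot appear again in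
-- either direction.
count-joins : ∀ (f : Fin n × Fin n) xs → Unique xs → count (joins f) (steps xs) ≤ 1
count-joins f [] u = z≤n
count-joins f (x ∷ []) u = z≤n
count-joins f@(s , t) (x ∷ y ∷ zs) (x∉ ∷ u) with T? (joins f (x , y))
... | no ¬j rewrite ⟦¬T⟧ ¬j = count-joins f (y ∷ zs) u
... | yes j rewrite ⟦T⟧ j = s≤s (≤-reflexive (count-false (joins f) (steps (y ∷ zs)) none))
  where
  fresh : ∀ {z} → z ∈ y ∷ zs → x ≢ z
  fresh = All.lookup x∉
  none : ∀ p → p ∈ steps (y ∷ zs) → ¬ T (joins f p)
  none (c , d) cd∈ j′ with c∈ , d∈ ← steps⇒∈ (y ∷ zs) cd∈
    with joins⁻ {s = s} {t} {x} {y} j | joins⁻ {s = s} {t} {c} {d} j′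
  ... | inj₁ (refl , _) | inj₁ (refl , _) = fresh c∈ refl
  ... | inj₁ (refl , _) | inj₂ (_ , refl) = fresh d∈ refl
  ... | inj₂ (refl , _) | inj₁ (_ , refl) = fresh d∈ refl
  ... | inj₂ (refl , _) | inj₂ (refl , _) = fresh c∈ refl

joinsAny : List (Fin n × Fin n) → Fin n × Fin n → Bool
joinsAny []      p = false
joinsAny (f ∷ F) p = joins f p ∨ joinsAny F p

count-∨ : ∀ (p q : A → Bool) xs → count (λ x → p x ∨ q x) xs ≤ count p xs + count q xs
count-∨ p q []       = z≤n
count-∨ p q (x ∷ xs) with p x
... | true  = s≤s (≤-trans (count-∨ p q xs) (+-monoʳ-≤ (count p xs) (m≤n+m _ ⟦ q x ⟧)))
... | false = ≤-trans (+-monoʳ-≤ ⟦ q x ⟧ (count-∨ p q xs)) (≤-reflexive (exchange ⟦ q x ⟧ (count p xs) _))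
  where
  exchange : ∀ a b c → a + (b + c) ≡ b + (a + c)
  exchange = solve-∀

count-joinsAny : ∀ (F : List (Fin n × Fin n)) xs → Unique xs → count (joinsAny F) (steps xs) ≤ length F
count-joinsAny []      xs u = ≤-reflexive (count-false _ (steps xs) (λ _ _ ()))
count-joinsAny (f ∷ F) xs u = ≤-trans (count-∨ (joins f) (joinsAny F) (steps xs))
  (+-mono-≤ (count-joins f xs u) (count-joinsAny F xs u))

∈⇒joinsAny : ∀ {c d : Fin n} F p → (c , d) ∈ F → T (joins (c , d) p) → T (joinsAny F p)
∈⇒joinsAny (f ∷ F) p (here refl) t = Equivalence.from (T-∨ {joins f p}) (inj₁ t)
∈⇒joinsAny (f ∷ F) p (there m)   t = Equivalence.from (T-∨ {joins f p}) (inj₂ (∈⇒joinsAny F p m t))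

-- Inclusion-exclusion: `p` and `q` hold together at least count p + count q - length times, and `s`
-- spoils at most `count s` of these places.
count-both : ∀ (p q s : A → Bool) xs →
  count p xs + count q xs ≤ length xs + (count s xs + count (λ x → p x ∧ q x ∧ not (s x)) xs)
count-both p q s []       = z≤n
count-both p q s (x ∷ xs) = begin
  (⟦ p x ⟧ + count p xs) + (⟦ q x ⟧ + count q xs)  ≡⟨ interchange ⟦ p x ⟧ _ _ _ ⟩
  (⟦ p x ⟧ + ⟦ q x ⟧) + (count p xs + count q xs)  ≤⟨ +-mono-≤ (pointwise (p x) (q x) (s x)) (count-both p q s xs) ⟩
  (1 + (⟦ s x ⟧ + ⟦ p x ∧ q x ∧ not (s x) ⟧)) + (length xs + (count s xs + count pqs xs))
    ≡⟨ rearrange ⟦ s x ⟧ ⟦ p x ∧ q x ∧ not (s x) ⟧ (length xs) _ _ ⟩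
  (1 + length xs) + ((⟦ s x ⟧ + count s xs) + (⟦ p x ∧ q x ∧ not (s x) ⟧ + count pqs xs)) ∎
  where
  open ≤-Reasoning
  pqs : _ → Bool
  pqs x = p x ∧ q x ∧ not (s x)
  interchange : ∀ a b c d → (a + b) + (c + d) ≡ (a + c) + (b + d)
  interchange = solve-∀
  rearrange : ∀ a b l c d → (1 + (a + b)) + (l + (c + d)) ≡ (1 + l) + ((a + c) + (b + d))
  rearrange = solve-∀
  pointwise : ∀ a b c → ⟦ a ⟧ + ⟦ b ⟧ ≤ 1 + (⟦ c ⟧ + ⟦ a ∧ b ∧ not c ⟧)
  pointwise true  true  true  = s≤s (s≤s z≤n)
  pointwise true  true  false = s≤s (s≤s z≤n)
  pointwise true  false c     = s≤s z≤n
  pointwise false true  c     = s≤s z≤n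
  pointwise false false c     = z≤n

_∈?_ : ∀ (p : Fin n × Fin n) ps → Dec (p ∈ ps)
p ∈? ps = any? (Product.≡-dec Fin._≟_ Fin._≟_ p) ps

unique-resp-↭ : ∀ {xs ys : List A} → xs ↭ ys → Unique xs → Unique ys
unique-resp-↭ σ = Unique-resp-↭ (setoid _) (↭⇒↭ₛ σ)

∷≡∷ʳ : ∀ (x : A) xs → ∃[ ys ] ∃[ y ] x ∷ xs ≡ ys ++ [ y ]
∷≡∷ʳ x []       = [] , x , refl
∷≡∷ʳ x (y ∷ xs) with ys , z , eq ← ∷≡∷ʳ y xs = x ∷ ys , z , cong (x ∷_) eq

HamiltonianThrough : Graph n → List (Fin n × Fin n) → Set
HamiltonianThrough G F =
  ∃[ cyc ] IsHamiltonianCycle G cyc × (∀ c d → (c , d) ∈ F → Along (close cyc) c d)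

-- Ore's crossing argument with prescribed steps `F`. On a Hamiltonian path from `q` to `p`, the two
-- degrees count the steps (a , b) with `b` adjacent to `q` and those with `a` adjacent to `p`.
-- There are n - 1 steps, at most `length F` of them prescribed, so a degree sum of `length F + n`
-- leaves a step that is of both kinds and not prescribed.
module _ (G : Graph n) (F : List (Fin n × Fin n)) (ys : List (Fin n))
  (long : 3 ≤ length ys) (unique : Unique ys) (spanning : Spanning ys)
  (linked : ∀ u v → (u , v) ∈ steps ys → Adj G u v)
  (through : ∀ c d → (c , d) ∈ F → Along ys c d)
  {q p : Fin n} {xs ms : List (Fin n)} (ys≡q∷ : ys ≡ q ∷ xs) (ys≡∷p : ys ≡ ms ++ [ p ])
  (big : length F + n ≤ degree G q + degree G p) where

  private
    free : Fin n × Fin n → Bool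
    free (a , b) = adj G q b ∧ adj G p a ∧ not (joinsAny F (a , b))

    perm : ys ↭ allFin n
    perm = spanning-↭ unique spanning

    degree-q : degree G q ≡ count (λ (a , b) → adj G q b) (steps ys)
    degree-q = begin
      degree G q                                       ≡⟨ ≡-trans (degree≡count G q) (sym (count-↭ (adj G q) perm)) ⟩
      count (adj G q) ys                               ≡⟨ cong (count (adj G q)) ys≡q∷ ⟩
      ⟦ adj G q q ⟧ + count (adj G q) xs               ≡⟨ cong (λ b → ⟦ b ⟧ + count (adj G q) xs) (loopless G q) ⟩
      count (adj G q) xs                               ≡⟨ cong (count (adj G q)) (sym (map-proj₂-steps q xs)) ⟩
      count (adj G q) (map proj₂ (steps (q ∷ xs)))     ≡⟨ count-map (adj G q) proj₂ (steps (q ∷ xs)) ⟩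
      count (λ (a , b) → adj G q b) (steps (q ∷ xs))   ≡⟨ cong (count (λ (a , b) → adj G q b) ∘ steps) (sym ys≡q∷) ⟩
      count (λ (a , b) → adj G q b) (steps ys)         ∎
      where open ≡-Reasoning

    degree-p : degree G p ≡ count (λ (a , b) → adj G p a) (steps ys)
    degree-p = begin
      degree G p                                       ≡⟨ ≡-trans (degree≡count G p) (sym (count-↭ (adj G p) perm)) ⟩
      count (adj G p) ys                               ≡⟨ ≡-trans (cong (count (adj G p)) ys≡∷p) (count-++ (adj G p) ms [ p ]) ⟩
      count (adj G p) ms + (⟦ adj G p p ⟧ + 0)         ≡⟨ cong (λ b → count (adj G p) ms + (⟦ b ⟧ + 0)) (loopless G p) ⟩
      count (adj G p) ms + 0                           ≡⟨ +-identityʳ _ ⟩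
      count (adj G p) ms                               ≡⟨ cong (count (adj G p)) (sym (map-proj₁-steps ms p)) ⟩
      count (adj G p) (map proj₁ (steps (ms ++ [ p ]))) ≡⟨ count-map (adj G p) proj₁ (steps (ms ++ [ p ])) ⟩
      count (λ (a , b) → adj G p a) (steps (ms ++ [ p ])) ≡⟨ cong (count (λ (a , b) → adj G p a) ∘ steps) (sym ys≡∷p) ⟩
      count (λ (a , b) → adj G p a) (steps ys)         ∎
      where open ≡-Reasoning

    length-steps : suc (length (steps ys)) ≡ n
    length-steps = begin
      suc (length (steps ys))                  ≡⟨ cong (suc ∘ length ∘ steps) ys≡q∷ ⟩
      suc (length (steps (q ∷ xs)))            ≡⟨ cong suc (sym (length-map proj₂ (steps (q ∷ xs)))) ⟩
      suc (length (map proj₂ (steps (q ∷ xs)))) ≡⟨ cong (suc ∘ length) (map-proj₂-steps q xs) ⟩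
      length (q ∷ xs)                          ≡⟨ cong length (sym ys≡q∷) ⟩
      length ys                                ≡⟨ ↭-length perm ⟩
      length (allFin n)                        ≡⟨ length-tabulate {n = n} (id {A = Fin n}) ⟩
      n                                        ∎
      where open ≡-Reasoning

    some-free : 0 < count free (steps ys)
    some-free = +-cancelˡ-≤ (length F + length (steps ys)) _ _ (begin
      (length F + length (steps ys)) + 1    ≡⟨ shuffle (length F) (length (steps ys)) ⟩
      length F + suc (length (steps ys))    ≡⟨ cong (length F +_) length-steps ⟩
      length F + n                          ≤⟨ big ⟩
      degree G q + degree G p               ≡⟨ cong₂ _+_ degree-q degree-p ⟩
      _                                     ≤⟨ count-both (λ (a , b) → adj G q b) (λ (a , b) → adj G p a) (joinsAny F) (steps ys) ⟩
      length (steps ys) + (count (joinsAny F) (steps ys) + count free (steps ys))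
        ≤⟨ +-monoʳ-≤ (length (steps ys)) (+-monoˡ-≤ (count free (steps ys)) (count-joinsAny F ys unique)) ⟩
      length (steps ys) + (length F + count free (steps ys)) ≡⟨ shuffle′ (length (steps ys)) (length F) _ ⟩
      length F + length (steps ys) + count free (steps ys) ∎)
      where
      open ≤-Reasoning
      shuffle : ∀ f l → (f + l) + 1 ≡ f + suc l
      shuffle = solve-∀
      shuffle′ : ∀ l f c → l + (f + c) ≡ f + l + c
      shuffle′ = solve-∀

    module Crossing {a b : Fin n} {as bs : List (Fin n)} (ys≡ : ys ≡ as ++ a ∷ b ∷ bs)
      (q~b : Adj G q b) (p~a : Adj G p a) (unjoined : ¬ T (joinsAny F (a , b))) where

      X Y cyc : List (Fin n)
      X   = as ++ [ a ]
      Y   = b ∷ bs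
      -- The piece up to `a` is run backwards, giving a ... q b ... p a. Only the step (a , b) is
      -- lost; the new steps are (q , b) and (p , a).
      cyc = (a ∷ reverse as) ++ Y

      ys≡X++Y : ys ≡ X ++ Y
      ys≡X++Y = ≡-trans ys≡ (sym (++-assoc as [ a ] Y))

      reverse-X : reverse X ≡ a ∷ reverse as
      reverse-X = reverse-++ as [ a ]

      X-head : ∃[ X′ ] X ≡ q ∷ X′
      X-head = go as (≡-trans (sym ys≡) ys≡q∷)
        where
        go : ∀ as → as ++ a ∷ Y ≡ q ∷ xs → ∃[ X′ ] as ++ [ a ] ≡ q ∷ X′
        go []       refl = [] , refl
        go (c ∷ as) refl = as ++ [ a ] , refl

      Y-last : ∃[ Y′ ] Y ≡ Y′ ++ [ p ]
      Y-last with Y′ , z , eq ← ∷≡∷ʳ b bs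
        with refl ← ∷ʳ-injectiveʳ (X ++ Y′) ms
          (≡-trans (++-assoc X Y′ [ z ]) (≡-trans (cong (X ++_) (sym eq)) (≡-trans (sym ys≡X++Y) ys≡∷p)))
        = Y′ , eq

      X′ Y′ : List (Fin n)
      X′ = proj₁ X-head
      Y′ = proj₁ Y-last

      steps-cyc : steps (close cyc) ≡ steps (a ∷ reverse as) ++ (q , b) ∷ steps Y ++ [ p , a ]
      steps-cyc = begin
        steps (((a ∷ reverse as) ++ Y) ++ [ a ])       ≡⟨ cong steps (++-assoc (a ∷ reverse as) Y [ a ]) ⟩
        steps ((a ∷ reverse as) ++ b ∷ (bs ++ [ a ]))  ≡⟨ cong (λ l → steps (l ++ b ∷ (bs ++ [ a ]))) X-end ⟩
        steps ((reverse X′ ++ [ q ]) ++ b ∷ (bs ++ [ a ])) ≡⟨ steps-++ (reverse X′) q b (bs ++ [ a ]) ⟩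
        steps (reverse X′ ++ [ q ]) ++ (q , b) ∷ steps (Y ++ [ a ])
          ≡⟨ cong₂ (λ l l′ → steps l ++ (q , b) ∷ l′) (sym X-end) Y-end ⟩
        steps (a ∷ reverse as) ++ (q , b) ∷ steps Y ++ [ p , a ] ∎
        where
        open ≡-Reasoning
        X-end : a ∷ reverse as ≡ reverse X′ ++ [ q ]
        X-end = ≡-trans (sym reverse-X) (≡-trans (cong reverse (proj₂ X-head)) (unfold-reverse q X′))
        Y-end : steps (Y ++ [ a ]) ≡ steps Y ++ [ p , a ]
        Y-end = ≡-trans (cong (λ l → steps (l ++ [ a ])) (proj₂ Y-last))
          (≡-trans (steps-++ Y′ p a []) (cong (λ l → steps l ++ [ p , a ]) (sym (proj₂ Y-last))))

      steps-ys : steps ys ≡ steps X ++ (a , b) ∷ steps Y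
      steps-ys = ≡-trans (cong steps ys≡X++Y) (steps-++ as a b bs)

      reversed : ∀ {s t} → (s , t) ∈ steps (a ∷ reverse as) → (t , s) ∈ steps X
      reversed {s} {t} m = subst (λ l → (t , s) ∈ steps l)
        (≡-trans (cong reverse (sym reverse-X)) (reverse-involutive X)) (steps-reverse (a ∷ reverse as) m)

      linked-cyc : ∀ u v → (u , v) ∈ steps (close cyc) → Adj G u v
      linked-cyc u v m with ∈-++⁻ (steps (a ∷ reverse as)) (subst ((u , v) ∈_) steps-cyc m)
      ... | inj₁ m₁ = Adj-sym G (linked v u (subst ((v , u) ∈_) (sym steps-ys) (∈-++⁺ˡ (reversed m₁))))
      ... | inj₂ (here refl) = q~b
      ... | inj₂ (there m₂) with ∈-++⁻ (steps Y) m₂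
      ...   | inj₁ m₃ = linked u v (subst ((u , v) ∈_) (sym steps-ys) (∈-++⁺ʳ (steps X) (there m₃)))
      ...   | inj₂ (here refl) = p~a

      keep : ∀ {s t} → (s , t) ∈ steps ys → (s , t) ≢ (a , b) → Along (close cyc) s t
      keep {s} {t} m ≢ab with ∈-++⁻ (steps X) (subst ((s , t) ∈_) steps-ys m)
      ... | inj₁ m₁ = inj₂ (subst ((t , s) ∈_) (sym steps-cyc) (∈-++⁺ˡ
                        (subst (λ l → (t , s) ∈ steps l) reverse-X (steps-reverse X m₁))))
      ... | inj₂ (here eq) = contradiction eq ≢ab
      ... | inj₂ (there m₂) = inj₁ (subst ((s , t) ∈_) (sym steps-cyc)
                        (∈-++⁺ʳ (steps (a ∷ reverse as)) (there (∈-++⁺ˡ m₂))))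

      through-cyc : ∀ c d → (c , d) ∈ F → Along (close cyc) c d
      through-cyc c d f with through c d f
      ... | inj₁ m = keep m λ { refl → unjoined (∈⇒joinsAny F (a , b) f (joins-same a b)) }
      ... | inj₂ m = Sum.swap (keep m λ { refl → unjoined (∈⇒joinsAny F (a , b) f (joins-flip b a)) })

      cyc-↭ : ys ↭ cyc
      cyc-↭ = subst (_↭ cyc) (sym ys≡X++Y)
        (++⁺ʳ Y (subst (X ↭_) reverse-X (↭-sym (↭-reverse X))))

      hamiltonian : IsHamiltonianCycle G cyc
      hamiltonian = record
        { length≥3 = subst (3 ≤_) (↭-length cyc-↭) long
        ; distinct = unique-resp-↭ cyc-↭ unique
        ; linked   = steps⇒Linked (close cyc) linked-cyc
        ; spanning = λ v → ∈-resp-↭ cyc-↭ (spanning v)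
        }

  close-path : HamiltonianThrough G F
  close-path with (a , b) , ab∈ , free-ab ← count>0⁻ free (steps ys) some-free
    with q~b , rest ← Equivalence.to (T-∧ {adj G q b}) free-ab
    with p~a , unjoined ← Equivalence.to (T-∧ {adj G p a}) rest
    with as , bs , eq ← steps⇒≡ ys ab∈
    = cyc , hamiltonian , through-cyc
    where
    open Crossing {a} {b} {as} {bs} eq q~b p~a
      (λ t → ≡false⇒¬T (cong not (T⇒≡true t)) unjoined)

addEdge : (G : Graph n) (u w : Fin n) → u ≢ w → Graph n
addEdge G u w u≢w = record
  { adj       = λ i j → adj G i j ∨ joins (u , w) (i , j)
  ; symmetric = λ i j → cong₂ _∨_ (symmetric G i j) (joins-sym u w i j)
  ; loopless  = λ i → cong₂ _∨_ (loopless G i) (¬T⇒≡false λ t → not-loop (joins⁻ {s = u} {w} {i} {i} t))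
  }
  where
  not-loop : ∀ {i} → ¬ ((i ≡ u × i ≡ w) ⊎ (i ≡ w × i ≡ u))
  not-loop (inj₁ (refl , refl)) = u≢w refl
  not-loop (inj₂ (refl , refl)) = u≢w refl

module _ (G : Graph n) (F : List (Fin n × Fin n)) (F⊆G : ∀ c d → (c , d) ∈ F → Adj G c d)
  {u w : Fin n} (u≢w : u ≢ w) (u≁w : ¬ Adj G u w) (big : length F + n ≤ degree G u + degree G w) where

  private
    H : Graph n
    H = addEdge G u w u≢w

    module _ (cyc : List (Fin n)) (ham : IsHamiltonianCycle H cyc)
             (through : ∀ c d → (c , d) ∈ F → Along (close cyc) c d) where
      open IsHamiltonianCycle ham

      H-step : ∀ {s t} → (s , t) ∈ steps (close cyc) → Adj H s t
      H-step = Linked⇒steps linked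

      module Open {p q : Fin n} (pq : (p , q) ∈ steps (close cyc)) (pq-uw : T (joins (u , w) (p , q)))
                  (p≁q : ¬ Adj G p q) (deg : length F + n ≤ degree G q + degree G p) where
        opened = open-cycle cyc pq
        ms ys as bs : List (Fin n)
        ms = proj₁ opened
        ys = ms ++ [ p ]
        as = proj₁ (proj₁ (proj₂ opened))
        bs = proj₁ (proj₂ (proj₁ (proj₂ opened)))
        cyc≡ : cyc ≡ as ++ bs
        cyc≡ = proj₁ (proj₂ (proj₂ (proj₁ (proj₂ opened))))
        ys≡ : ys ≡ bs ++ as
        ys≡ = proj₂ (proj₂ (proj₂ (proj₁ (proj₂ opened))))
        first : take 1 ys ≡ [ q ]
        first = proj₂ (proj₂ opened)

        σ : cyc ↭ ys
        σ = subst (_↭ ys) (sym cyc≡) (subst (as ++ bs ↭_) (sym ys≡) (++-comm as bs))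
        ys-unique : Unique ys
        ys-unique = unique-resp-↭ σ distinct
        ys-long : 3 ≤ length ys
        ys-long = subst (3 ≤_) (↭-length σ) length≥3

        ys-cons : ∃[ xs ] ys ≡ q ∷ xs
        ys-cons = go ys first
          where
          go : ∀ ys → take 1 ys ≡ [ q ] → ∃[ xs ] ys ≡ q ∷ xs
          go (_ ∷ xs) refl = xs , refl

        from-cyc : ∀ {s} → s ∈ steps (close cyc) → s ∈ steps (close ys)
        from-cyc {s} m = subst (λ l → s ∈ steps (close l)) (sym ys≡)
          (rotate-steps as bs (subst (λ l → s ∈ steps (close l)) cyc≡ m))
        to-cyc : ∀ {s} → s ∈ steps ys → s ∈ steps (close cyc)
        to-cyc {s} m = subst (λ l → s ∈ steps (close l)) (sym cyc≡)
          (rotate-steps bs as (subst (λ l → s ∈ steps (close l)) ys≡ (steps-++ʳ ys (take 1 ys) m)))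

        steps-close-ys : steps (close ys) ≡ steps ys ++ [ p , q ]
        steps-close-ys = ≡-trans (cong (λ l → steps (ys ++ l)) first) (steps-++ ms p q [])

        along-ys : ∀ {c d} → Adj G c d → (c , d) ∈ steps (close cyc) → (c , d) ∈ steps ys
        along-ys {c} {d} c~d m with ∈-++⁻ (steps ys) (subst ((c , d) ∈_) steps-close-ys (from-cyc m))
        ... | inj₁ m′          = m′
        ... | inj₂ (here refl) = contradiction c~d p≁q

        through-ys : ∀ c d → (c , d) ∈ F → Along ys c d
        through-ys c d f with through c d f
        ... | inj₁ m = inj₁ (along-ys (F⊆G c d f) m)
        ... | inj₂ m = inj₂ (along-ys (Adj-sym G (F⊆G c d f)) m)

        -- `u` and `w` are the two ends of the opened path, and a path on at least three vertices
        -- has no step between its ends. Hence every step of it is an edge of `G` and not the added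
        -- one.
        not-ends : ∀ xs → ys ≡ q ∷ xs → Unique (q ∷ xs) → 3 ≤ length (q ∷ xs) →
                   ∀ {s t} → (s , t) ∈ steps (q ∷ xs) → T (joins (u , w) (s , t)) → ⊥
        not-ends (x ∷ x′ ∷ xs) eq (q∉ ∷ x∉ ∷ _) long {s} {t} m j
          with joins⁻ {s = u} {w} {p} {q} pq-uw | joins⁻ {s = u} {w} {s} {t} j | m
        ... | inj₁ (refl , refl) | inj₁ (refl , refl) | here refl = All.lookup q∉ (here refl) refl
        ... | inj₁ (refl , refl) | inj₁ (refl , refl) | there m′ =
          All.lookup q∉ (proj₂ (steps⇒∈ (x ∷ x′ ∷ xs) m′)) refl
        ... | inj₁ (refl , refl) | inj₂ (refl , refl) | here refl = All.lookup x∉ (end ms eq) refl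
          where
          end : ∀ ms → ms ++ [ p ] ≡ q ∷ p ∷ x′ ∷ xs → p ∈ x′ ∷ xs
          end (_ ∷ _ ∷ ms) eq = subst (p ∈_) (∷-injectiveʳ (∷-injectiveʳ eq)) (∈-++⁺ʳ ms (here refl))
          end (_ ∷ []) ()
        ... | inj₁ (refl , refl) | inj₂ (refl , refl) | there m′ =
          All.lookup q∉ (proj₁ (steps⇒∈ (x ∷ x′ ∷ xs) m′)) refl
        ... | inj₂ (refl , refl) | inj₂ (refl , refl) | here refl = All.lookup q∉ (here refl) refl
        ... | inj₂ (refl , refl) | inj₂ (refl , refl) | there m′ =
          All.lookup q∉ (proj₂ (steps⇒∈ (x ∷ x′ ∷ xs) m′)) refl
        ... | inj₂ (refl , refl) | inj₁ (refl , refl) | here refl = All.lookup x∉ (end ms eq) refl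
          where
          end : ∀ ms → ms ++ [ p ] ≡ q ∷ p ∷ x′ ∷ xs → p ∈ x′ ∷ xs
          end (_ ∷ _ ∷ ms) eq = subst (p ∈_) (∷-injectiveʳ (∷-injectiveʳ eq)) (∈-++⁺ʳ ms (here refl))
          end (_ ∷ []) ()
        ... | inj₂ (refl , refl) | inj₁ (refl , refl) | there m′ =
          All.lookup q∉ (proj₁ (steps⇒∈ (x ∷ x′ ∷ xs) m′)) refl
        not-ends []       eq _ (s≤s ())
        not-ends (_ ∷ []) eq _ (s≤s (s≤s ()))

        linked-ys : ∀ s t → (s , t) ∈ steps ys → Adj G s t
        linked-ys s t m with Equivalence.to (T-∨ {adj G s t}) (H-step (to-cyc m))
        ... | inj₁ s~t = s~t
        ... | inj₂ j   = ⊥-elim (not-ends (proj₁ ys-cons) (proj₂ ys-cons)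
          (subst Unique (proj₂ ys-cons) ys-unique) (subst (λ l → 3 ≤ length l) (proj₂ ys-cons) ys-long)
          (subst (λ l → (s , t) ∈ steps l) (proj₂ ys-cons) m) j)

        ham-through : HamiltonianThrough G F
        ham-through = close-path G F ys ys-long ys-unique (λ v → ∈-resp-↭ σ (spanning v)) linked-ys through-ys
          (proj₂ ys-cons) refl deg

  -- A cycle through `u` `w` opens there into a Hamiltonian path of `G`; it still contains `F`,
  -- since `F` consists of edges of `G` and the opened step is not one. `close-path` closes it
  -- again. A cycle that avoids the added edge already lies in `G`.
  remove-edge : HamiltonianThrough H F → HamiltonianThrough G F
  remove-edge (cyc , ham , through) with (u , w) ∈? steps (close cyc) | (w , u) ∈? steps (close cyc)
  ... | yes uw | _      = Open.ham-through cyc ham through uw (joins-same u w) u≁w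
                            (subst (length F + n ≤_) (+-comm (degree G u) _) big)
  ... | no _   | yes wu = Open.ham-through cyc ham through wu (joins-flip u w) (u≁w ∘ Adj-sym G) big
  ... | no ¬uw | no ¬wu = cyc , record
    { length≥3 = length≥3 ; distinct = distinct ; spanning = spanning
    ; linked = steps⇒Linked (close cyc) G-step } , through
    where
    open IsHamiltonianCycle ham
    G-step : ∀ s t → (s , t) ∈ steps (close cyc) → Adj G s t
    G-step s t m with Equivalence.to (T-∨ {adj G s t}) (Linked⇒steps linked m)
    ... | inj₁ s~t = s~t
    ... | inj₂ j with joins⁻ {s = u} {w} {s} {t} j
    ...   | inj₁ (refl , refl) = contradiction m ¬uw
    ...   | inj₂ (refl , refl) = contradiction m ¬wu

-- Closure and Kronk's theorem

infix 4 _⊆ᴳ_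

_⊆ᴳ_ : Graph n → Graph n → Set
G ⊆ᴳ H = ∀ u w → Adj G u w → Adj H u w

Closed : ℕ → Graph n → Set
Closed {n} K G = ∀ u w → u ≢ w → ¬ Adj G u w → degree G u + degree G w < K + n

degree-mono : ∀ (G H : Graph n) → G ⊆ᴳ H → ∀ v → degree G v ≤ degree H v
degree-mono G H G⊆H v = begin
  degree G v                ≡⟨ degree≡count G v ⟩
  count (adj G v) (allFin _) ≤⟨ count-mono _ _ (allFin _) (λ w _ → G⊆H v w) ⟩
  count (adj H v) (allFin _) ≡⟨ sym (degree≡count H v) ⟩
  degree H v                ∎
  where open ≤-Reasoning

T-not⁺ : ∀ {b} → ¬ T b → T (not b)
T-not⁺ {true}  ¬t = ⊥-elim (¬t tt)
T-not⁺ {false} _  = tt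

T-not⁻ : ∀ {b} → T (not b) → ¬ T b
T-not⁻ {false} _ ()

-- The Bondy–Chvátal closure, with at most K edges prescribed.
Closure : ℕ → Graph n → Set
Closure K G = ∃[ H ] G ⊆ᴳ H × Closed K H ×
  (∀ F → length F ≤ K → (∀ c d → (c , d) ∈ F → Adj G c d) → HamiltonianThrough H F → HamiltonianThrough G F)

closure : ∀ K (G : Graph n) → Closure K G
closure {n} K G = go (suc (nonEdges G)) G ≤-refl
  where
  pairs : List (Fin n × Fin n)
  pairs = cartesianProduct (allFin n) (allFin n)

  nonEdges : Graph n → ℕ
  nonEdges G = count (λ (i , j) → not (adj G i j)) pairs

  -- `N` is fuel: every added edge lowers `nonEdges`.
  go : ∀ N G → nonEdges G < N → Closure K G
  go (suc N) G (s≤s bound)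
    with Fin.any? (λ u → Fin.any? (λ w →
      ¬? (u Fin.≟ w) ×-dec ¬? (adj? G u w) ×-dec (K + n ≤? degree G u + degree G w)))
  ... | no closed = G , (λ _ _ → id) , (λ u w u≢w u≁w → ≰⇒> λ big → closed (u , w , u≢w , u≁w , big))
                  , (λ _ _ _ → id)
  ... | yes (u , w , u≢w , u≁w , big) = extend (go N G′ (<-≤-trans decrease bound))
    where
    G′ : Graph n
    G′ = addEdge G u w u≢w
    grow : G ⊆ᴳ G′
    grow s t s~t = Equivalence.from (T-∨ {adj G s t}) (inj₁ s~t)
    decrease : nonEdges G′ < nonEdges G
    decrease = count-mono-< _ _ pairs
      (λ (s , t) _ s≁t → T-not⁺ (T-not⁻ s≁t ∘ grow s t))
      {u , w} (∈-cartesianProduct⁺ (∈-allFin u) (∈-allFin w))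
      (λ t → T-not⁻ t (Equivalence.from (T-∨ {adj G u w}) (inj₂ (joins-same u w))))
      (T-not⁺ u≁w)
    extend : Closure K G′ → Closure K G
    extend (H , G′⊆H , closed , pull) = H , (λ s t → G′⊆H s t ∘ grow s t) , closed , λ F short F⊆G ham →
      remove-edge G F F⊆G u≢w u≁w (≤-trans (+-monoˡ-≤ n short) big)
        (pull F short (λ c d f → grow c d (F⊆G c d f)) ham)

length-steps-path : ∀ (xs : List A) → length (steps xs) ≡ length xs ∸ 1
length-steps-path []           = refl
length-steps-path (x ∷ [])     = refl
length-steps-path (x ∷ y ∷ xs) = cong suc (length-steps-path (y ∷ xs))

contained : ∀ {G : Graph n} path → HamiltonianThrough G (steps path) →
            ∃[ cyc ] IsHamiltonianCycle G cyc × path ContainedInCycle cyc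
contained path (cyc , ham , through) = cyc , ham , record
  { vertices = λ v _ → IsHamiltonianCycle.spanning ham v
  ; edges    = λ u v c → convert (through u v (Consecutive⇒steps c))
  }
  where
  convert : ∀ {u v} → Along (close cyc) u v → Consecutive (close cyc) u v ⊎ Consecutive (close cyc) v u
  convert (inj₁ s) = inj₁ (steps⇒Consecutive (close cyc) s)
  convert (inj₂ s) = inj₂ (steps⇒Consecutive (close cyc) s)

fill : List (Fin n) → List (Fin n)
fill {n} xs = filter (λ v → ¬? (v ∈ᶠ? xs)) (allFin n)
  where
  _∈ᶠ?_ : ∀ (v : Fin n) vs → Dec (v ∈ vs)
  v ∈ᶠ? vs = any? (v Fin.≟_) vs

fill-↭ : ∀ (xs : List (Fin n)) → Unique xs → xs ++ fill xs ↭ allFin n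
fill-↭ {n} xs u = spanning-↭
  (Unique.++⁺ u (Unique.filter⁺ _ (Unique.allFin⁺ n)) (λ (∈xs , ∈fill) → proj₂ (∈-filter⁻ _ {xs = allFin n} ∈fill) ∈xs))
  spans
  where
  spans : Spanning (xs ++ fill xs)
  spans v with any? (v Fin.≟_) xs
  ... | yes v∈ = ∈-++⁺ˡ v∈
  ... | no v∉  = ∈-++⁺ʳ xs (∈-filter⁺ _ (∈-allFin v) v∉)

-- The vertices off `xs` are appended in arbitrary order. The result keeps all steps of `xs`, and it
-- is a Hamiltonian cycle as soon as the graph contains the steps of its closure; those join
-- distinct vertices because there are at least three.
through-list : ∀ (H : Graph n) xs F → 3 ≤ n → Unique xs →
  (∀ c d → (c , d) ∈ F → Along xs c d) →
  (∀ u v → (u , v) ∈ steps (close (xs ++ fill xs)) → u ≢ v → Adj H u v) →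
  HamiltonianThrough H F
through-list {n} H xs F 3≤n u along link = cyc , record
  { length≥3 = long
  ; distinct = u-cyc
  ; linked   = steps⇒Linked (close cyc) (λ s t m → link s t m (distinct-steps cyc long u-cyc s t m))
  ; spanning = λ v → ∈-resp-↭ (↭-sym σ) (∈-allFin v)
  } , λ c d f → extend (along c d f)
  where
  cyc : List (Fin n)
  cyc = xs ++ fill xs
  σ : cyc ↭ allFin n
  σ = fill-↭ xs u
  u-cyc : Unique cyc
  u-cyc = unique-resp-↭ (↭-sym σ) (Unique.allFin⁺ n)
  long : 3 ≤ length cyc
  long = subst (3 ≤_) (sym (≡-trans (↭-length σ) (length-tabulate {n = n} (id {A = Fin n})))) 3≤n
  extend : ∀ {c d} → Along xs c d → Along (close cyc) c d
  extend (inj₁ m) = inj₁ (steps-++ʳ cyc (take 1 cyc) (steps-++ʳ xs (fill xs) m))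
  extend (inj₂ m) = inj₂ (steps-++ʳ cyc (take 1 cyc) (steps-++ʳ xs (fill xs) m))
  path-steps : ∀ (ys : List (Fin n)) → Unique ys → ∀ s t → (s , t) ∈ steps ys → s ≢ t
  path-steps (y ∷ z ∷ ys) (y∉ ∷ _) s t (here refl) = All.lookup y∉ (here refl)
  path-steps (y ∷ z ∷ ys) (_ ∷ us) s t (there m)   = path-steps (z ∷ ys) us s t m
  distinct-steps : ∀ (ys : List (Fin n)) → 3 ≤ length ys → Unique ys →
                   ∀ s t → (s , t) ∈ steps (close ys) → s ≢ t
  distinct-steps (y ∷ z ∷ ys) _ uy@(y∉ ∷ us) s t m
    with init , last , eq ← ∷≡∷ʳ z ys
    with ∈-++⁻ (steps (y ∷ z ∷ ys)) (subst ((s , t) ∈_)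
      (≡-trans (cong (λ l → steps ((y ∷ l) ++ [ y ])) eq) (≡-trans (steps-++ (y ∷ init) last y [])
        (cong (λ l → steps (y ∷ l) ++ [ last , y ]) (sym eq)))) m)
  ... | inj₁ m′ = path-steps (y ∷ z ∷ ys) uy s t m′
  ... | inj₂ (here refl) = λ last≡y → All.lookup y∉ (subst (last ∈_) (sym eq) (∈-++⁺ʳ init (here refl))) (sym last≡y)
  distinct-steps (y ∷ []) (s≤s ())

low : Graph n → ℕ → ℕ
low {n} G h = count (λ v → does (degree G v ≤? h)) (allFin n)

-- `some` matters for h ≤ k, where `many` says nothing. `extra` sharpens `many` by one vertex at the
-- parity extreme 2h + 1 = k + n; it provides the sixth low vertex in the tie at n = 11.
record Obstruction (k : ℕ) (G : Graph n) : Set where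
  field
    h     : ℕ
    h<    : h + h < k + n
    some  : 1 ≤ low G h
    many  : h ≤ k + low G h
    extra : suc (h + h) ≡ k + n → suc h ≤ k + low G h

-- Let `w` have maximum degree among the vertices with a non-neighbour, `u` maximum degree among the
-- non-neighbours of `w`, and h the degree of `u` in `H`. All n - 1 - deg w non-neighbours of `w`
-- have degree at most h, in `G` too, and closedness h + deg w < k + n makes their number at least h
-- - k. Since `u` itself misses `w`, also h ≤ deg w, so 2h < k + n.
closed⇒obstruction : ∀ k (G H : Graph n) → G ⊆ᴳ H → Closed k H →
  ∀ {u₀ w₀} → u₀ ≢ w₀ → ¬ Adj H u₀ w₀ → Obstruction k G
closed⇒obstruction {n} k G H G⊆H closed {u₀} {w₀} u₀≢w₀ u₀≁w₀ = record
  { h = h ; h< = h<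
  ; some = ≤-trans (s≤s z≤n)
      (count-mono-< (λ _ → false) lowᵇ (allFin n) (λ _ _ ()) (∈-allFin u) (λ ()) (low-of ≤-refl))
  ; many = many ; extra = extra }
  where
  Missing : Fin n → Fin n → Set
  Missing x y = y ≢ x × ¬ Adj H x y
  missing? : ∀ x → Decidable (Missing x)
  missing? x y = ¬? (y Fin.≟ x) ×-dec ¬? (adj? H x y)
  missing-sym : ∀ {x y} → Missing x y → Missing y x
  missing-sym (y≢x , x≁y) = y≢x ∘ sym , x≁y ∘ Adj-sym H

  max-vertex : ∀ {P : Fin n → Set} (P? : Decidable P) z → P z →
    ∃[ v ] P v × (∀ x → P x → degree H x ≤ degree H v)
  max-vertex P? z pz with filter P? (allFin n) in eq
  ... | [] with () ← subst (z ∈_) eq (∈-filter⁺ P? (∈-allFin z) pz)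
  ... | x ∷ xs with v , v∈ , max ← argmax (degree H) x xs =
    v , proj₂ (∈-filter⁻ P? {xs = allFin n} (subst (v ∈_) (sym eq) v∈)) ,
    λ y py → max y (subst (y ∈_) eq (∈-filter⁺ P? (∈-allFin y) py))

  wmax = max-vertex (λ x → Fin.any? (missing? x)) w₀ (u₀ , u₀≢w₀ , u₀≁w₀ ∘ Adj-sym H)
  w : Fin n
  w = proj₁ wmax
  umax = max-vertex (missing? w) (proj₁ (proj₁ (proj₂ wmax))) (proj₂ (proj₁ (proj₂ wmax)))
  u : Fin n
  u = proj₁ umax
  w-u : Missing w u
  w-u = proj₁ (proj₂ umax)
  h : ℕ
  h = degree H u
  h≤ : h ≤ degree H w
  h≤ = proj₂ (proj₂ wmax) u (w , missing-sym w-u)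
  sum< : h + degree H w < k + n
  sum< = closed u w (proj₁ w-u) (proj₂ (missing-sym w-u))
  h< : h + h < k + n
  h< = ≤-<-trans (+-monoʳ-≤ h h≤) sum<
  lowᵇ : Fin n → Bool
  lowᵇ v = does (degree G v ≤? h)
  low-of : ∀ {v} → degree H v ≤ h → T (lowᵇ v)
  low-of {v} d = does⁺ (degree G v ≤? h) (≤-trans (degree-mono G H G⊆H v) d)

  non : List (Fin n) → ℕ
  non = count (not ∘ adj H w)

  others≤low : non (others H w) ≤ low G h
  others≤low = begin
    non (others H w)            ≤⟨ count-mono _ lowᵇ (others H w)
      (λ x x∈ x≁ → low-of (proj₂ (proj₂ umax) x (∈others⁻ H w x∈ , T-not⁻ x≁))) ⟩
    count lowᵇ (others H w)     ≤⟨ m≤n+m _ ⟦ lowᵇ w ⟧ ⟩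
    count lowᵇ (w ∷ others H w) ≡⟨ count-↭ lowᵇ (others-↭ H w) ⟩
    low G h                     ∎
    where open ≤-Reasoning

  n≡ : n ≡ suc (degree H w + non (others H w))
  n≡ = begin
    n                                                    ≡⟨ sym (length-tabulate {n = n} (id {A = Fin n})) ⟩
    length (allFin n)                                    ≡⟨ sym (↭-length (others-↭ H w)) ⟩
    suc (length (others H w))                            ≡⟨ cong suc (sym (count-not (adj H w) (others H w))) ⟩
    suc (count (adj H w) (others H w) + non (others H w)) ≡⟨ cong (λ d → suc (d + non (others H w))) (sym (degree-others H w)) ⟩
    suc (degree H w + non (others H w))                  ∎
    where open ≡-Reasoning

  h≤k+non : h ≤ k + non (others H w)
  h≤k+non = +-cancelʳ-≤ (degree H w) _ _ (s≤s⁻¹ (begin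
    suc (h + degree H w)                           ≤⟨ sum< ⟩
    k + n                                          ≡⟨ cong (k +_) n≡ ⟩
    k + suc (degree H w + non (others H w))        ≡⟨ shuffle k (degree H w) _ ⟩
    suc (k + non (others H w) + degree H w)        ∎))
    where
    open ≤-Reasoning
    shuffle : ∀ k d m → k + suc (d + m) ≡ suc (k + m + d)
    shuffle = solve-∀

  many : h ≤ k + low G h
  many = ≤-trans h≤k+non (+-monoʳ-≤ k others≤low)

  -- If 2h + 1 = k + n, closedness gives deg w ≤ h, so `w` is low in addition to its non-neighbours.
  extra : suc (h + h) ≡ k + n → suc h ≤ k + low G h
  extra tie = begin
    suc h                                       ≤⟨ s≤s h≤k+non ⟩
    suc (k + non (others H w))                  ≡⟨ sym (+-suc k _) ⟩
    k + suc (non (others H w))                  ≡⟨ cong (k +_) (sym (⟦T⟧+ {m = non (others H w)} (T-not⁺ (Adj-irrefl H)))) ⟩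
    k + non (w ∷ others H w)                    ≤⟨ +-monoʳ-≤ k (count-mono _ lowᵇ (w ∷ others H w) all-low) ⟩
    k + count lowᵇ (w ∷ others H w)             ≡⟨ cong (k +_) (count-↭ lowᵇ (others-↭ H w)) ⟩
    k + low G h                                 ∎
    where
    open ≤-Reasoning
    w-low : degree H w ≤ h
    w-low = +-cancelˡ-≤ h _ _ (s≤s⁻¹ (≤-trans sum< (≤-reflexive (sym tie))))
    all-low : ∀ x → x ∈ w ∷ others H w → T (not (adj H w x)) → T (lowᵇ x)
    all-low x (here refl) _ = low-of w-low
    all-low x (there x∈)  t = low-of (proj₂ (proj₂ umax) x (∈others⁻ H w x∈ , T-not⁻ t))

-- Kronk's theorem: the failure of k-path Hamiltonicity is visible in the degrees.
kronk : ∀ k (G : Graph n) → 3 ≤ n → ¬ Obstruction k G → PathHamiltonian k G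
kronk {n} k G 3≤n ¬obs ℓ path ℓ≤k isPath
  with H , G⊆H , closed , pull ← closure k G
  with Fin.any? (λ u → Fin.any? (λ w → ¬? (u Fin.≟ w) ×-dec ¬? (adj? H u w)))
... | yes (u , w , u≢w , u≁w) = contradiction (closed⇒obstruction k G H G⊆H closed u≢w u≁w) ¬obs
-- A complete closure contains any cyclic order that starts with the path; the cycle is then pulled
-- back to `G`.
... | no complete = contained path (pull (steps path) short
    (λ c d → Linked⇒steps (IsPath.linked isPath))
    (through-list H path (steps path) 3≤n (IsPath.distinct isPath) (λ c d → inj₁)
      (λ u v _ u≢v → all-adjacent u v u≢v)))
  where
  short : length (steps path) ≤ k
  short = ≤-trans (≤-reflexive (≡-trans (length-steps-path path) (cong (_∸ 1) (IsPath.length≡ isPath)))) ℓ≤k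
  all-adjacent : ∀ u v → u ≢ v → Adj H u v
  all-adjacent u v u≢v with adj? H u v
  ... | yes u~v = u~v
  ... | no u≁v  = contradiction (u , v , u≢v , u≁v) complete

-- Deleting vertices of small degree

-- Removing `xs` one vertex at a time loses at most `h` edges each, as degrees only fall along the
-- way.
edges-prefix : ∀ (a : A → A → Bool) h xs ys → (∀ x → x ∈ xs → count (a x) (xs ++ ys) ≤ h) →
               edges a (xs ++ ys) ≤ length xs * h + edges a ys
edges-prefix a h []       ys bound = ≤-refl
edges-prefix a h (x ∷ xs) ys bound = begin
  count (a x) (xs ++ ys) + edges a (xs ++ ys)
    ≤⟨ +-mono-≤ (≤-trans (m≤n+m _ ⟦ a x x ⟧) (bound x (here refl)))
         (edges-prefix a h xs ys λ z z∈ → ≤-trans (m≤n+m _ ⟦ a z x ⟧) (bound z (there z∈))) ⟩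
  h + (length xs * h + edges a ys)   ≡⟨ sym (+-assoc h _ _) ⟩
  h + length xs * h + edges a ys     ∎
  where open ≤-Reasoning

no-clique : ∀ (G : Graph n) {s} → ¬ (complete s ⊑ G) → ∀ {vs} → ¬ Clique (adj G) s vs
no-clique G ¬K = ¬K ∘ clique⇒⊑ G

lowVertices : Graph n → ℕ → List (Fin n)
lowVertices G h = filter (λ v → degree G v ≤? h) (allFin _)

length-lowVertices : ∀ (G : Graph n) h → length (lowVertices G h) ≡ low G h
length-lowVertices G h = count-filter (λ v → degree G v ≤? h) (allFin _)

low-split : ∀ (G : Graph n) j h → j ≤ low G h →
  ∃[ xs ] ∃[ ys ] length xs ≡ j × length ys ≡ n ∸ j × xs ++ ys ↭ allFin n × (∀ x → x ∈ xs → degree G x ≤ h)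
low-split {n} G j h j≤ = xs , ys , len-xs , len-ys , σ , λ x x∈ →
  proj₂ (∈-filter⁻ low? {xs = allFin n} (subst (x ∈_) (take++drop≡id j W) (∈-++⁺ˡ x∈)))
  where
  low? : Decidable (λ v → degree G v ≤ h)
  low? v = degree G v ≤? h
  W xs ys : List (Fin n)
  W  = lowVertices G h
  xs = take j W
  ys = drop j W ++ filter (¬? ∘ low?) (allFin n)
  len-xs : length xs ≡ j
  len-xs = ≡-trans (length-take j W) (m≤n⇒m⊓n≡m (subst (j ≤_) (sym (length-lowVertices G h)) j≤))
  σ : xs ++ ys ↭ allFin n
  σ = subst (_↭ allFin n)
    (≡-trans (cong (_++ filter (¬? ∘ low?) (allFin n)) (sym (take++drop≡id j W))) (++-assoc xs (drop j W) _))
    (↭-sym (↭-filter-¬ low? (allFin n)))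
  len-ys : length ys ≡ n ∸ j
  len-ys = begin
    length ys                            ≡⟨ sym (m+n∸m≡n (length xs) (length ys)) ⟩
    (length xs + length ys) ∸ length xs  ≡⟨ cong₂ _∸_ (≡-trans (sym (length-++ xs)) (↭-length σ)) len-xs ⟩
    length (allFin n) ∸ j                ≡⟨ cong (_∸ j) (length-tabulate {n = n} (id {A = Fin n})) ⟩
    n ∸ j                                ∎
    where open ≡-Reasoning

low-bound : ∀ r .{{_ : NonZero r}} (G : Graph n) → ¬ (complete (suc r) ⊑ G) → ∀ j h → j ≤ low G h →
            e G ≤ j * h + turánEdges r (n ∸ j)
low-bound r G ¬K j h j≤ with xs , ys , len-xs , len-ys , σ , small ← low-split G j h j≤ = begin
  e G                                ≡⟨ edges-spanning G σ ⟩
  edges (adj G) (xs ++ ys)           ≤⟨ edges-prefix (adj G) h xs ys (λ x x∈ →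
    ≤-trans (≤-reflexive (≡-trans (count-↭ (adj G x) σ) (sym (degree≡count G x)))) (small x x∈)) ⟩
  length xs * h + edges (adj G) ys   ≤⟨ +-monoʳ-≤ (length xs * h)
    (proj₁ (turán-theorem r (adj G) (symmetric G) (loopless G) ys (no-clique G ¬K))) ⟩
  length xs * h + turánEdges r (length ys)   ≡⟨ cong₂ (λ p q → p * h + turánEdges r q) len-xs len-ys ⟩
  j * h + turánEdges r (_ ∸ j)               ∎
  where open ≤-Reasoning

module _ (r : ℕ) .{{_ : NonZero r}} (G : Graph n) (v : Fin n) where

  -- The equality case of Turán's theorem for `G -ᵛ v`, stated with colours on the vertices of `G`
  -- and not on the positions of the induced subgraph. Both the isomorphism with `turán` and the
  -- degree estimates are read off from it.
  Balanced : Set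
  Balanced = ∃[ c ] map c (others G v) ↭ residues r (n ∸ 1) ×
                    (∀ x y → x ∈ others G v → y ∈ others G v → adj G x y ≡ c x ≠ᵇ c y)

  deletion-bound : ¬ (complete (suc r) ⊑ G) → e (G -ᵛ v) ≤ turánEdges r (n ∸ 1)
  deletion-bound ¬K = subst₂ _≤_ (sym (e-delete G v)) (cong (turánEdges r) (length-others G v))
    (proj₁ (turán-theorem r (adj G) (symmetric G) (loopless G) (others G v) (no-clique G ¬K)))

  deletion-balanced : ¬ (complete (suc r) ⊑ G) → e (G -ᵛ v) ≡ turánEdges r (n ∸ 1) → Balanced
  deletion-balanced ¬K eq =
    let c , σ , struct = proj₂ (turán-theorem r (adj G) (symmetric G) (loopless G) (others G v) (no-clique G ¬K))
          (≡-trans (sym (e-delete G v)) (≡-trans eq (cong (turánEdges r) (sym (length-others G v)))))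
    in c , subst (λ m → map c (others G v) ↭ residues r m) (length-others G v) σ , struct

  balanced⇒≅ : Balanced → G -ᵛ v ≅ turán r (n ∸ 1)
  balanced⇒≅ (c , σ , struct) = iso-multipartite (G -ᵛ v) (c ∘ lookup (others G v)) (λ i → toℕ i % r)
    (λ i j → struct _ _ (∈-lookup i) (∈-lookup j))
    (↭-trans (subst (_↭ residues r (n ∸ 1))
      (≡-trans (cong (map c) (sym (map-lookup-others G v))) (sym (map-∘ (allFin (length (others G v)))))) σ)
      (↭-sym (colours-turán r (n ∸ 1))))

  -- Apart from `v`, the vertex `u` misses only its own class, itself included, and a residue class
  -- below n - 1 has at most (n - 1) / r + 1 members.
  balanced-degree : Balanced → ∀ {u} → u ≢ v → n ∸ 1 ≤ degree G u + suc ((n ∸ 1) / r)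
  balanced-degree (c , σ , struct) {u} u≢v = begin
    n ∸ 1                                                    ≡⟨ sym (length-others G v) ⟩
    length vs                                                ≡⟨ sym (count-≠ᵇ r c (c u) vs) ⟩
    count (λ y → c y =ᵇ c u) vs + count (λ y → c u ≠ᵇ c y) vs ≤⟨ +-mono-≤ same other ⟩
    suc ((n ∸ 1) / r) + degree G u                           ≡⟨ +-comm _ (degree G u) ⟩
    degree G u + suc ((n ∸ 1) / r)                           ∎
    where
    open ≤-Reasoning
    vs : List (Fin n)
    vs = others G v
    u∈ : u ∈ vs
    u∈ = ∈others G v u≢v
    cu<r : c u < r
    cu<r with i , _ , eq ← ∈-map⁻ (_% r) (∈-resp-↭ σ (∈-map⁺ c u∈)) = subst (_< r) (sym eq) (m%n<n i r)
    same : count (λ y → c y =ᵇ c u) vs ≤ suc ((n ∸ 1) / r)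
    same = begin
      count (λ y → c y =ᵇ c u) vs              ≡⟨ sym (count-map (_=ᵇ c u) c vs) ⟩
      count (_=ᵇ c u) (map c vs)               ≡⟨ count-↭ (_=ᵇ c u) σ ⟩
      count (_=ᵇ c u) (residues r (n ∸ 1))     ≡⟨ count-residues r (c u) cu<r (n ∸ 1) ⟩
      (n ∸ 1) / r + ⟦ _ ⟧                      ≤⟨ +-monoʳ-≤ ((n ∸ 1) / r) (⟦⟧≤1 (does (c u <? (n ∸ 1) % r))) ⟩
      (n ∸ 1) / r + 1                          ≡⟨ +-comm ((n ∸ 1) / r) 1 ⟩
      suc ((n ∸ 1) / r)                        ∎
    other : count (λ y → c u ≠ᵇ c y) vs ≤ degree G u
    other = begin
      count (λ y → c u ≠ᵇ c y) vs   ≡⟨ count-cong _ _ vs (λ y y∈ → sym (struct u y u∈ y∈)) ⟩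
      count (adj G u) vs            ≤⟨ m≤n+m _ ⟦ adj G u v ⟧ ⟩
      count (adj G u) (v ∷ vs)      ≡⟨ count-↭ (adj G u) (others-↭ G v) ⟩
      count (adj G u) (allFin n)    ≡⟨ sym (degree≡count G u) ⟩
      degree G u                    ∎

-- Paths in a neighbourhood and decidability of traceability

lookup-injective : ∀ {xs : List A} → Unique xs → ∀ {i j} → lookup xs i ≡ lookup xs j → i ≡ j
lookup-injective u {i} {j} eq with i Fin.≟ j
... | yes i≡j = i≡j
... | no i≢j  = contradiction eq (AllPairs-lookup (_∘ sym) u i j i≢j)

unlookup : ∀ (ns : List A) {xs} → All (_∈ ns) xs → ∃[ is ] map (lookup ns) is ≡ xs
unlookup ns []         = [] , refl
unlookup ns (x∈ ∷ xs∈) with is , eq ← unlookup ns xs∈ =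
  Any.index x∈ ∷ is , cong₂ _∷_ (sym (lookup-index x∈)) eq

-- The path is given in vertices of `G`; `unlookup` translates it into positions of
-- `neighbours G v`, which are the vertices of the induced graph.
traceable-neighbourhood : ∀ (G : Graph n) v xs → Unique xs → Linked (Adj G) xs → 1 ≤ length xs →
  (∀ x → x ∈ xs → Adj G v x) → (∀ x → Adj G v x → x ∈ xs) → Traceable (neighbourhood G v)
traceable-neighbourhood {n} G v xs@(x₀ ∷ xs′) u linked _ sound complete
  with is , eq ← unlookup (neighbours G v) {xs}
         (All.tabulate λ {x} x∈ → ∈-filter⁺ (adj? G v) (∈-allFin x) (sound x x∈))
  = length xs′ , is , record
    { length≡  = ≡-trans (sym (length-map (lookup (neighbours G v)) is)) (cong length eq)
    ; distinct = Unique.map⁻ (subst Unique (sym eq) u)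
    ; linked   = Linked.map⁻ (subst (Linked (Adj G)) (sym eq) linked)
    } , spanning
  where
  spanning : Spanning is
  spanning i with j , j∈ , same ← ∈-map⁻ (lookup (neighbours G v))
      (subst (lookup (neighbours G v) i ∈_) (sym eq)
        (complete _ (proj₂ (∈-filter⁻ (adj? G v) {xs = allFin n} (∈-lookup i)))))
    = subst (_∈ is) (sym (lookup-injective (Unique.filter⁺ (adj? G v) (Unique.allFin⁺ n)) same)) j∈

dec-∃-list : ∀ ℓ {P : List (Fin n) → Set} → (∀ xs → Dec (P xs)) → Dec (∃[ xs ] length xs ≡ ℓ × P xs)
dec-∃-list zero P? with P? []
... | yes p = yes ([] , refl , p)
... | no ¬p = no λ { ([] , _ , p) → ¬p p }
dec-∃-list (suc ℓ) {P} P? with Fin.any? (λ x → dec-∃-list ℓ {λ xs → P (x ∷ xs)} (λ xs → P? (x ∷ xs)))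
... | yes (x , xs , len , p) = yes (x ∷ xs , cong suc len , p)
... | no ¬p = no λ { (x ∷ xs , len , p) → ¬p (x , xs , suc-injective len , p) }

-- A spanning path lists exactly n vertices, so a finite search decides. The equality case splits on
-- this property.
traceable? : ∀ (G : Graph n) → Dec (Traceable G)
traceable? {n} G = Dec.map′ to from (dec-∃-list n {P} P?)
  where
  P : List (Fin n) → Set
  P xs = 1 ≤ length xs × Unique xs × Linked (Adj G) xs × (∀ v → v ∈ xs)
  P? : ∀ xs → Dec (P xs)
  P? xs = (1 ≤? length xs) ×-dec AllPairs.allPairs? (λ x y → ¬? (x Fin.≟ y)) xs ×-dec
          linked? (adj? G) xs ×-dec Fin.all? (λ v → any? (v Fin.≟_) xs)
  to : ∃[ xs ] length xs ≡ n × P xs → Traceable G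
  to (x ∷ xs , _ , _ , u , l , s) = length xs , x ∷ xs , record { length≡ = refl ; distinct = u ; linked = l } , s
  to ([] , _ , () , _)
  from : Traceable G → ∃[ xs ] length xs ≡ n × P xs
  from (ℓ , xs , isPath , s) = xs , ≡-trans (↭-length (spanning-↭ distinct s)) (length-tabulate {n = n} (id {A = Fin n}))
    , subst (1 ≤_) (sym length≡) (s≤s z≤n) , distinct , linked , s
    where open IsPath isPath

-- A vertex of degree k + 1 over a Turán graph

step-after : ∀ (as : List A) {v b w} zs → v ∉ as → v ∉ b ∷ zs → (v , w) ∈ steps (as ++ v ∷ b ∷ zs) → w ≡ b
step-after []           zs v∉as v∉zs (here refl) = refl
step-after []           zs v∉as v∉zs (there m)   = contradiction (proj₁ (steps⇒∈ (_ ∷ zs) m)) v∉zs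
step-after (x ∷ [])     zs v∉as v∉zs (here refl) = contradiction (here refl) v∉as
step-after (x ∷ [])     zs v∉as v∉zs (there m)   = step-after [] zs (λ ()) v∉zs m
step-after (x ∷ y ∷ as) zs v∉as v∉zs (here refl) = contradiction (here refl) v∉as
step-after (x ∷ y ∷ as) zs v∉as v∉zs (there m)   = step-after (y ∷ as) zs (v∉as ∘ there) v∉zs m

step-before : ∀ (as : List A) {a v u} zs → v ∉ as ++ [ a ] → v ∉ zs → (u , v) ∈ steps (as ++ a ∷ v ∷ zs) → u ≡ a
step-before []       zs v∉as v∉zs (here refl) = refl
step-before []       zs v∉as v∉zs (there m)   = contradiction (tail-∈ zs m) v∉zs
  where
  tail-∈ : ∀ {x y z : A} zs → (x , y) ∈ steps (z ∷ zs) → y ∈ zs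
  tail-∈ (w ∷ zs) (here refl) = here refl
  tail-∈ (w ∷ zs) (there m)   = proj₂ (steps⇒∈ (w ∷ zs) m)
step-before (x ∷ [])     zs v∉as v∉zs (here refl) = contradiction (there (here refl)) v∉as
step-before (x ∷ [])     zs v∉as v∉zs (there m)   = step-before [] zs (v∉as ∘ there) v∉zs m
step-before (x ∷ y ∷ as) zs v∉as v∉zs (here refl) = contradiction (there (here refl)) v∉as
step-before (x ∷ y ∷ as) zs v∉as v∉zs (there m)   = step-before (y ∷ as) zs (v∉as ∘ there) v∉zs m

unique-++ˡ : ∀ (xs : List A) {ys} → Unique (xs ++ ys) → ∀ {x} → x ∈ xs → x ∉ ys
unique-++ˡ (x ∷ xs) (x∉ ∷ u) (here refl) x∈ys = All.lookup x∉ (∈-++⁺ʳ xs x∈ys) refl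
unique-++ˡ (x ∷ xs) (x∉ ∷ u) (there x∈) = unique-++ˡ xs u x∈

unique-++ʳ : ∀ (xs : List A) {ys} → Unique (xs ++ ys) → Unique ys
unique-++ʳ []       u       = u
unique-++ʳ (x ∷ xs) (_ ∷ u) = unique-++ʳ xs u

-- The closure is taken at n + k + 2 because up to k + 2 edges are prescribed: at most k steps of
-- the path and the two edges by which the cycle passes `v`. `rich` is what makes all vertices other
-- than `v` pairwise adjacent in it.
module Apex {k n : ℕ} (G : Graph n) (v : Fin n) (3≤n : 3 ≤ n)
  (deg-v : degree G v ≡ k + 1)
  (rich : ∀ u w → u ≢ v → w ≢ v → (k + 2) + n ≤ degree G u + degree G w) where

  private
    H : Graph n
    H = proj₁ (closure (k + 2) G)
    G⊆H : G ⊆ᴳ H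
    G⊆H = proj₁ (proj₂ (closure (k + 2) G))
    pull : ∀ F → length F ≤ k + 2 → (∀ c d → (c , d) ∈ F → Adj G c d) → HamiltonianThrough H F → HamiltonianThrough G F
    pull = proj₂ (proj₂ (proj₂ (closure (k + 2) G)))

    H-full : ∀ u w → u ≢ v → w ≢ v → u ≢ w → Adj H u w
    H-full u w u≢v w≢v u≢w with adj? H u w
    ... | yes u~w = u~w
    ... | no u≁w  = contradiction (proj₁ (proj₂ (proj₂ (closure (k + 2) G))) u w u≢w u≁w)
      (≤⇒≯ (≤-trans (rich u w u≢v w≢v) (+-mono-≤ (degree-mono G H G⊆H u) (degree-mono G H G⊆H w))))

  module _ (P : List (Fin n)) (short : length (steps P) ≤ k) (linked : Linked (Adj G) P) where

    -- After closing, every vertex other than v is adjacent to all the others,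
    -- so only the two steps at v matter.
    through-apex : ∀ as a b bs → Unique (as ++ a ∷ v ∷ b ∷ bs) → Adj G a v → Adj G v b →
      (∀ c d → (c , d) ∈ steps P → (c , d) ∈ steps (as ++ a ∷ v ∷ b ∷ bs)) →
      HamiltonianThrough G (steps P)
    through-apex as a b bs u a~v v~b P⊆L
      = proj₁ result , proj₁ (proj₂ result) , λ c d f → proj₂ (proj₂ result) c d (there (there f))
      where
      L rest : List (Fin n)
      L    = as ++ a ∷ v ∷ b ∷ bs
      F : List (Fin n × Fin n)
      F    = (a , v) ∷ (v , b) ∷ steps P
      F-short : length F ≤ k + 2
      F-short = subst (length F ≤_) (+-comm 2 k) (s≤s (s≤s short))
      F⊆G : ∀ c d → (c , d) ∈ F → Adj G c d
      F⊆G c d (here refl)         = a~v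
      F⊆G c d (there (here refl)) = v~b
      F⊆G c d (there (there f))   = Linked⇒steps linked f
      F⊆L : ∀ c d → (c , d) ∈ F → Along L c d
      F⊆L c d (here refl)         = inj₁ (≡⇒steps as a v (b ∷ bs))
      F⊆L c d (there (here refl)) = inj₁ (subst (λ l → (v , b) ∈ steps l) (++-assoc as [ a ] (v ∷ b ∷ bs))
                                      (≡⇒steps (as ++ [ a ]) v b bs))
      F⊆L c d (there (there f))   = inj₁ (P⊆L c d f)

      rest = bs ++ fill L
      cyc≡ : L ++ fill L ≡ as ++ a ∷ v ∷ b ∷ rest
      cyc≡ = ++-assoc as (a ∷ v ∷ b ∷ bs) (fill L)
      u-cyc : Unique ((as ++ [ a ]) ++ v ∷ b ∷ rest)
      u-cyc = subst Unique (≡-trans cyc≡ (sym (++-assoc as [ a ] _)))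
        (unique-resp-↭ (↭-sym (fill-↭ L u)) (Unique.allFin⁺ n))
      v∉before : v ∉ as ++ [ a ]
      v∉before v∈ = unique-++ˡ (as ++ [ a ]) u-cyc v∈ (here refl)
      v∉after : v ∉ b ∷ rest
      v∉after v∈ with v∉ ∷ _ ← unique-++ʳ (as ++ [ a ]) u-cyc = All.lookup v∉ v∈ refl
      closing : ∃[ h ] take 1 (as ++ a ∷ v ∷ b ∷ rest) ≡ [ h ] × h ≢ v
      closing = go as v∉before
        where
        go : ∀ as → v ∉ as ++ [ a ] → ∃[ h ] take 1 (as ++ a ∷ v ∷ b ∷ rest) ≡ [ h ] × h ≢ v
        go []       v∉ = a , refl , λ a≡v → v∉ (here (sym a≡v))
        go (x ∷ as) v∉ = x , refl , λ x≡v → v∉ (here (sym x≡v))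
      hd : Fin n
      hd = proj₁ closing
      v∉end : v ∉ b ∷ (rest ++ [ hd ])
      v∉end v∈ with ∈-++⁻ (b ∷ rest) v∈
      ... | inj₁ v∈′         = v∉after v∈′
      ... | inj₂ (here v≡hd)  = proj₂ (proj₂ closing) (sym v≡hd)
      close≡ : close (L ++ fill L) ≡ as ++ a ∷ v ∷ b ∷ (rest ++ [ hd ])
      close≡ = ≡-trans (cong close cyc≡) (≡-trans (cong ((as ++ a ∷ v ∷ b ∷ rest) ++_) (proj₁ (proj₂ closing)))
        (++-assoc as (a ∷ v ∷ b ∷ rest) [ hd ]))

      link : ∀ s t → (s , t) ∈ steps (close (L ++ fill L)) → s ≢ t → Adj H s t
      link s t m s≢t with s Fin.≟ v | t Fin.≟ v
      ... | no s≢v | no t≢v = H-full s t s≢v t≢v s≢t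
      ... | yes refl | _ = subst (Adj H v) (sym (step-after (as ++ [ a ]) (rest ++ [ hd ]) v∉before v∉end
        (subst (λ l → (s , t) ∈ steps l) (≡-trans close≡ (sym (++-assoc as [ a ] _))) m))) (G⊆H v b v~b)
      ... | no _ | yes refl = subst (λ z → Adj H z v) (sym (step-before as (b ∷ (rest ++ [ hd ])) v∉before v∉end
        (subst (λ l → (s , t) ∈ steps l) close≡ m))) (G⊆H a v a~v)

      result : HamiltonianThrough G F
      result = pull F F-short F⊆G (through-list H L F 3≤n u F⊆L link)

  -- `P` has at most k + 1 vertices and `v` has k + 1 neighbours. If all neighbours were on `P`,
  -- then `P` would be a path covering exactly the neighbourhood; so the list `U` of neighbours off
  -- `P` is nonempty. If `v` is inside `P` there is nothing to add; if it is an end, a vertex of `U`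
  -- is attached to it; if `P` is `v` alone, two are. If `v` is off `P`, either two free neighbours
  -- carry it behind `P`, or just one is free and an end of `P` is the other neighbour.
  apex-hamiltonian : ¬ Traceable (neighbourhood G v) → PathHamiltonian k G
  apex-hamiltonian ¬trace ℓ P ℓ≤k isPath = contained P through-path
    where
    open IsPath isPath
    a : Fin n → Bool
    a = adj G v
    short : length (steps P) ≤ k
    short = ≤-trans (≤-reflexive (≡-trans (length-steps-path P) (cong (_∸ 1) length≡))) ℓ≤k
    length-P : length P ≤ suc k
    length-P = ≤-trans (≤-reflexive length≡) (s≤s ℓ≤k)

    nbrs : ∀ xs → Unique xs → count a xs + count a (fill xs) ≡ suc k
    nbrs xs u = begin
      count a xs + count a (fill xs)   ≡⟨ sym (count-++ a xs (fill xs)) ⟩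
      count a (xs ++ fill xs)          ≡⟨ count-↭ a (fill-↭ xs u) ⟩
      count a (allFin n)               ≡⟨ sym (degree≡count G v) ⟩
      degree G v                       ≡⟨ deg-v ⟩
      k + 1                            ≡⟨ +-comm k 1 ⟩
      suc k                            ∎
      where open ≡-Reasoning

    ∈fill⁻ : ∀ {x} → x ∈ fill P → x ∉ P
    ∈fill⁻ = proj₂ ∘ ∈-filter⁻ (λ y → ¬? (any? (y Fin.≟_) P)) {xs = allFin n}

    u-fill : Unique (fill P)
    u-fill = Unique.filter⁺ (λ y → ¬? (any? (y Fin.≟_) P)) (Unique.allFin⁺ n)

    U : List (Fin n)
    U = filter (adj? G v) (fill P)

    U-length : length U ≡ count a (fill P)
    U-length = count-filter (adj? G v) (fill P)

    U⁻ : ∀ {x} → x ∈ U → x ∉ P × Adj G v x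
    U⁻ x∈ with x∈′ , v~x ← ∈-filter⁻ (adj? G v) {xs = fill P} x∈ = ∈fill⁻ x∈′ , v~x

    v≢ : ∀ {x} → Adj G v x → v ≢ x
    v≢ v~x refl = Adj-irrefl G v~x

    single : ∀ {x} → count a [ x ] ≡ suc k → Adj G v x → Traceable (neighbourhood G v)
    single {x} every v~x = traceable-neighbourhood G v [ x ] ([] ∷ []) [-] (s≤s z≤n) (λ { _ (here refl) → v~x }) covers
      where
      none : count a (fill [ x ]) ≡ 0
      none = +-cancelˡ-≡ (count a [ x ]) _ _ (≡-trans (nbrs [ x ] ([] ∷ []))
        (sym (≡-trans (+-identityʳ _) every)))
      covers : ∀ y → Adj G v y → y ∈ [ x ]
      covers y v~y with y Fin.≟ x
      ... | yes refl = here refl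
      ... | no y≢x = contradiction v~y (count-false⁻ a (fill [ x ]) none y
        (∈-filter⁺ (λ z → ¬? (any? (z Fin.≟_) [ x ])) (∈-allFin y) (λ { (here y≡x) → y≢x y≡x })))

    -- For k = 0 the neighbourhood is a single vertex, hence traceable.
    k≢0 : ∀ {x} → Adj G v x → k ≢ 0
    k≢0 {x} v~x refl = ¬trace (single (cong (λ z → z + 0) (⟦T⟧ v~x)) v~x)

    all-on-path : U ≡ [] → Traceable (neighbourhood G v)
    all-on-path U≡[] = traceable-neighbourhood G v P distinct linked (subst (1 ≤_) (sym length≡) (s≤s z≤n)) sound covers
      where
      none : count a (fill P) ≡ 0
      none = ≡-trans (sym U-length) (cong length U≡[])
      every : count a P ≡ suc k
      every = ≡-trans (sym (+-identityʳ _)) (≡-trans (cong (count a P +_) (sym none)) (nbrs P distinct))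
      sound : ∀ x → x ∈ P → Adj G v x
      sound = count-true⁻ a P (≤-antisym (count≤length a P) (subst (length P ≤_) (sym every) length-P))
      covers : ∀ x → Adj G v x → x ∈ P
      covers x v~x with any? (x Fin.≟_) P
      ... | yes x∈ = x∈
      ... | no x∉  = contradiction v~x (count-false⁻ a (fill P) none x
        (∈-filter⁺ (λ z → ¬? (any? (z Fin.≟_) P)) (∈-allFin x) x∉))

    through : ∀ as x y bs → Unique (as ++ x ∷ v ∷ y ∷ bs) → Adj G x v → Adj G v y →
      (∀ c d → (c , d) ∈ steps P → (c , d) ∈ steps (as ++ x ∷ v ∷ y ∷ bs)) → HamiltonianThrough G (steps P)
    through = through-apex P short linked

    module OnPath (as bs : List (Fin n)) (P≡ : P ≡ as ++ v ∷ bs) where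

      u-P : Unique (as ++ v ∷ bs)
      u-P = subst Unique P≡ distinct

      linked-P : Linked (Adj G) (as ++ v ∷ bs)
      linked-P = subst (Linked (Adj G)) P≡ linked

      in-P : ∀ {x} → x ∈ as ++ v ∷ bs → x ∈ P
      in-P {x} = subst (x ∈_) (sym P≡)

      keep : ∀ L → (∀ {p} → p ∈ steps (as ++ v ∷ bs) → p ∈ steps L) → ∀ c d → (c , d) ∈ steps P → (c , d) ∈ steps L
      keep L f c d m = f (subst (λ l → (c , d) ∈ steps l) P≡ m)

      fresh : ∀ {x} → x ∈ U → All (x ≢_) (as ++ v ∷ bs)
      fresh x∈U = All.tabulate λ { y∈ refl → proj₁ (U⁻ x∈U) (in-P y∈) }

      some-free : ∃[ x ] x ∈ U
      some-free with U in U≡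
      ... | x ∷ _ = x , here refl
      ... | []    = contradiction (all-on-path U≡) ¬trace

    on-path-split : ∀ {as} → InitLast as → ∀ bs → P ≡ as ++ v ∷ bs → ∃[ x ] x ∈ U → HamiltonianThrough G (steps P)
    on-path-split [] [] P≡ (x , x∈) = two-free U refl
      where
      open OnPath [] [] P≡
      U-length′ : length U ≡ suc k
      U-length′ = begin
        length U                                 ≡⟨ U-length ⟩
        count a (fill P)                         ≡⟨ cong (λ z → z + count a (fill P)) (sym zero-P) ⟩
        count a P + count a (fill P)             ≡⟨ nbrs P distinct ⟩
        suc k                                    ∎
        where
        open ≡-Reasoning
        zero-P : count a P ≡ 0
        zero-P = ≡-trans (cong (count a) P≡) (cong (λ b → ⟦ b ⟧ + 0) (loopless G v))
      two-free : ∀ W → U ≡ W → HamiltonianThrough G (steps P)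
      two-free [] eq = contradiction (subst (x ∈_) eq x∈) (λ ())
      two-free (y ∷ []) eq = contradiction (suc-injective (≡-trans (sym U-length′) (cong length eq)))
        (k≢0 (proj₂ (U⁻ x∈)))
      two-free (y ∷ z ∷ W) eq = through [] y z []
        (((λ y≡v → v≢ v~y (sym y≡v)) ∷ All.lookup y∉ (here refl) ∷ []) ∷ (v≢ v~z ∷ []) ∷ [] ∷ [])
        (Adj-sym G v~y) v~z (λ c d m → contradiction (subst (λ l → (c , d) ∈ steps l) P≡ m) (λ ()))
        where
        v~y : Adj G v y
        v~y = proj₂ (U⁻ (subst (y ∈_) (sym eq) (here refl)))
        v~z : Adj G v z
        v~z = proj₂ (U⁻ (subst (z ∈_) (sym eq) (there (here refl))))
        y∉ : All (y ≢_) (z ∷ W)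
        y∉ with p ∷ _ ← subst Unique eq (Unique.filter⁺ (adj? G v) u-fill) = p
    on-path-split [] (b ∷ bs′) P≡ (x , x∈) = through [] x b bs′ (fresh x∈ ∷ u-P) (Adj-sym G (proj₂ (U⁻ x∈)))
      (Linked⇒steps linked-P (here refl)) (keep _ there)
      where open OnPath [] (b ∷ bs′) P≡
    on-path-split (as′ ∷ʳ′ y) [] P≡ (x , x∈) = through as′ y x []
      (subst Unique assoc (unique-resp-↭ (↭-sym (↭-trans (++-comm _ [ x ]) ↭-refl)) (fresh x∈ ∷ u-P)))
      (Linked⇒steps linked-P (subst (λ l → (y , v) ∈ steps l) (sym (++-assoc as′ [ y ] [ v ])) (≡⇒steps as′ y v [])))
      (proj₂ (U⁻ x∈)) (keep _ (λ {p} m → subst (λ l → p ∈ steps l) assoc (steps-++ʳ _ [ x ] m)))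
      where
      open OnPath (as′ ++ [ y ]) [] P≡
      assoc : ((as′ ++ [ y ]) ++ [ v ]) ++ [ x ] ≡ as′ ++ y ∷ v ∷ x ∷ []
      assoc = ≡-trans (++-assoc (as′ ++ [ y ]) [ v ] [ x ]) (++-assoc as′ [ y ] (v ∷ x ∷ []))
    on-path-split (as′ ∷ʳ′ y) (b ∷ bs′) P≡ (x , x∈) = through as′ y b bs′ (subst Unique assoc u-P)
      (Linked⇒steps linked-P (subst (λ l → (y , v) ∈ steps l) (sym assoc) (≡⇒steps as′ y v (b ∷ bs′))))
      (Linked⇒steps linked-P (≡⇒steps (as′ ++ [ y ]) v b bs′))
      (keep _ (λ {p} → subst (λ l → p ∈ steps l) assoc))
      where
      open OnPath (as′ ++ [ y ]) (b ∷ bs′) P≡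
      assoc : (as′ ++ [ y ]) ++ v ∷ b ∷ bs′ ≡ as′ ++ y ∷ v ∷ b ∷ bs′
      assoc = ++-assoc as′ [ y ] (v ∷ b ∷ bs′)

    on-path : ∀ as bs → P ≡ as ++ v ∷ bs → HamiltonianThrough G (steps P)
    on-path as bs P≡ = on-path-split (initLast as) bs P≡ (OnPath.some-free as bs P≡)

    module OffPath (v∉P : v ∉ P) where

      v∉ : All (v ≢_) P
      v∉ = All.tabulate λ { y∈ refl → v∉P y∈ }

      two-free : ∀ x y W → U ≡ x ∷ y ∷ W → HamiltonianThrough G (steps P)
      -- The step from the last vertex of `P` to `x` need not be an edge of `G`; the closure
      -- supplies it.
      two-free x y W eq = through P x y [] unique (Adj-sym G v~x) v~y (λ c d m → steps-++ʳ P _ m)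
        where
        x∈ : x ∈ U
        x∈ = subst (x ∈_) (sym eq) (here refl)
        y∈ : y ∈ U
        y∈ = subst (y ∈_) (sym eq) (there (here refl))
        v~x : Adj G v x
        v~x = proj₂ (U⁻ x∈)
        v~y : Adj G v y
        v~y = proj₂ (U⁻ y∈)
        x≢y : x ≢ y
        x≢y with p ∷ _ ← subst Unique eq (Unique.filter⁺ (adj? G v) u-fill) = All.lookup p (here refl)
        unique : Unique (P ++ x ∷ v ∷ y ∷ [])
        unique = Unique.++⁺ distinct
          (((λ x≡v → v≢ v~x (sym x≡v)) ∷ x≢y ∷ []) ∷ (v≢ v~y ∷ []) ∷ [] ∷ [])
          λ { (∈P , here refl) → proj₁ (U⁻ x∈) ∈P
            ; (∈P , there (here refl)) → v∉P ∈P
            ; (∈P , there (there (here refl))) → proj₁ (U⁻ y∈) ∈P }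

      module _ (x : Fin n) (x∈ : x ∈ U) where

        v~x : Adj G v x
        v~x = proj₂ (U⁻ x∈)

        x∉ : All (x ≢_) P
        x∉ = All.tabulate λ { y∈ refl → proj₁ (U⁻ x∈) y∈ }

        at-head : ∀ p ps → P ≡ p ∷ ps → Adj G v p → HamiltonianThrough G (steps P)
        at-head p ps refl v~p = through [] x p ps
          (((λ x≡v → v≢ v~x (sym x≡v)) ∷ x∉) ∷ v∉ ∷ distinct) (Adj-sym G v~x) v~p (λ c d m → there (there m))

        at-last : ∀ ps z → P ≡ ps ++ [ z ] → Adj G v z → HamiltonianThrough G (steps P)
        at-last ps z P≡ v~z = through ps z x [] (subst Unique assoc unique) (Adj-sym G v~z) v~x
          (λ c d m → subst (λ l → (c , d) ∈ steps l) assoc (steps-++ʳ P (v ∷ x ∷ []) m))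
          where
          assoc : P ++ v ∷ x ∷ [] ≡ ps ++ z ∷ v ∷ x ∷ []
          assoc = ≡-trans (cong (_++ v ∷ x ∷ []) P≡) (++-assoc ps [ z ] (v ∷ x ∷ []))
          unique : Unique (P ++ v ∷ x ∷ [])
          unique = Unique.++⁺ distinct ((v≢ v~x ∷ []) ∷ [] ∷ [])
            λ { (∈P , here refl) → v∉P ∈P ; (∈P , there (here refl)) → proj₁ (U⁻ x∈) ∈P }

      one-free : ∀ x → U ≡ [ x ] → HamiltonianThrough G (steps P)
      one-free x eq = ends P refl
        where
        x∈ : x ∈ U
        x∈ = subst (x ∈_) (sym eq) (here refl)
        on : count a P ≡ k
        on = suc-injective (≡-trans (sym (≡-trans (cong (count a P +_) (≡-trans (sym U-length) (cong length eq)))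
          (+-comm (count a P) 1))) (nbrs P distinct))
        ends : ∀ Q → P ≡ Q → HamiltonianThrough G (steps P)
        ends [] P≡ with () ← ≡-trans (sym length≡) (cong length P≡)
        ends (p ∷ ps) P≡ with adj? G v p
        ... | yes v~p = at-head x x∈ p ps P≡ v~p
        ends (p ∷ []) P≡ | no v≁p = contradiction
          (≡-trans (sym on) (≡-trans (cong (count a) P≡) (cong (_+ 0) (⟦¬T⟧ v≁p)))) (k≢0 (v~x x x∈))
        ends (p ∷ q ∷ ps) P≡ | no v≁p with ms , z , qs≡ ← ∷≡∷ʳ q ps with adj? G v z
        ... | yes v~z = at-last x x∈ (p ∷ ms) z (≡-trans P≡ (cong (p ∷_) qs≡)) v~z
        -- With a single free neighbour, k neighbours lie on `P`. If neither end were one, they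
        -- would all be among at most k - 1 inner vertices.
        ... | no v≁z = ⊥-elim (1+n≰n (begin
          suc k                                   ≡⟨ cong suc (sym on) ⟩
          suc (count a P)                         ≡⟨ cong (suc ∘ count a) P≡′ ⟩
          suc (⟦ a p ⟧ + count a (ms ++ [ z ]))   ≡⟨ cong (λ i → suc (i + count a (ms ++ [ z ]))) (⟦¬T⟧ v≁p) ⟩
          suc (count a (ms ++ [ z ]))             ≡⟨ cong suc (count-++ a ms [ z ]) ⟩
          suc (count a ms + (⟦ a z ⟧ + 0))        ≡⟨ cong (λ i → suc (count a ms + (i + 0))) (⟦¬T⟧ v≁z) ⟩
          suc (count a ms + 0)                    ≡⟨ cong suc (+-identityʳ _) ⟩
          suc (count a ms)                        ≤⟨ s≤s (count≤length a ms) ⟩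
          suc (length ms)                         ≡⟨ +-comm 1 (length ms) ⟩
          length ms + 1                           ≡⟨ sym (length-++ ms) ⟩
          length (ms ++ [ z ])                    ≤⟨ s≤s⁻¹ (subst (λ l → length l ≤ suc k) P≡′ length-P) ⟩
          k                                       ∎))
          where
          open ≤-Reasoning
          P≡′ : P ≡ p ∷ (ms ++ [ z ])
          P≡′ = ≡-trans P≡ (cong (p ∷_) qs≡)

      off-path : HamiltonianThrough G (steps P)
      off-path = cases U refl
        where
        cases : ∀ W → U ≡ W → HamiltonianThrough G (steps P)
        cases []          eq = contradiction (all-on-path eq) ¬trace
        cases (x ∷ [])    eq = one-free x eq
        cases (x ∷ y ∷ W) eq = two-free x y W eq

    through-path : HamiltonianThrough G (steps P)
    through-path with any? (v Fin.≟_) P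
    ... | no v∉ = OffPath.off-path v∉
    ... | yes v∈ with as , bs , eq ← ∈-∃++ v∈ = on-path as bs eq

-- The graph K₆₂₂₁

edges-none : ∀ (a : A → A → Bool) xs → (∀ x y → x ∈ xs → y ∈ xs → ¬ T (a x y)) → edges a xs ≡ 0
edges-none a []       none = refl
edges-none a (x ∷ xs) none = cong₂ _+_ (count-false (a x) xs (λ y y∈ → none x y (here refl) (there y∈)))
  (edges-none a xs (λ y z y∈ z∈ → none y z (there y∈) (there z∈)))

map-constant : ∀ (f : A → B) c xs → (∀ x → x ∈ xs → f x ≡ c) → map f xs ≡ replicate (length xs) c
map-constant f c []       eq = refl
map-constant f c (x ∷ xs) eq = cong₂ _∷_ (eq x (here refl)) (map-constant f c xs (λ y y∈ → eq y (there y∈)))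

map-cong-∈ : ∀ (f g : A → B) xs → (∀ x → x ∈ xs → f x ≡ g x) → map f xs ≡ map g xs
map-cong-∈ f g []       eq = refl
map-cong-∈ f g (x ∷ xs) eq = cong₂ _∷_ (eq x (here refl)) (map-cong-∈ f g xs (λ y y∈ → eq y (there y∈)))

sublist-degree : ∀ (G : Graph n) zs {ws} → zs ++ ws ↭ allFin n → ∀ x → count (adj G x) ws ≤ degree G x
sublist-degree G zs {ws} σ x = begin
  count (adj G x) ws                       ≤⟨ m≤n+m _ (count (adj G x) zs) ⟩
  count (adj G x) zs + count (adj G x) ws  ≡⟨ sym (count-++ (adj G x) zs ws) ⟩
  count (adj G x) (zs ++ ws)               ≡⟨ count-↭ (adj G x) σ ⟩
  count (adj G x) (allFin _)               ≡⟨ sym (degree≡count G x) ⟩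
  degree G x                               ∎
  where open ≤-Reasoning

two-∈⇒↭ : ∀ {x y : A} {xs} → x ∈ xs → y ∈ xs → x ≢ y → ∃[ zs ] xs ↭ x ∷ y ∷ zs
two-∈⇒↭ x∈ y∈ x≢y with us , σ ← ∈⇒↭ x∈ with ∈-resp-↭ σ y∈
... | here y≡x = contradiction (sym y≡x) x≢y
... | there y∈us with zs , τ ← ∈⇒↭ y∈us = zs , ↭-trans σ (prep _ τ)

part-sizes : map (part (6 ∷ 2 ∷ 2 ∷ 1 ∷ [])) (allFin 11) ≡ replicate 6 0 ++ 1 ∷ 1 ∷ 2 ∷ 2 ∷ 3 ∷ []
part-sizes = refl

residues-3-5 : map suc (residues 3 5) ↭ 1 ∷ 1 ∷ 2 ∷ 2 ∷ 3 ∷ []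
residues-3-5 = ↭-trans (_↭_.swap 2 1 ↭-refl) (prep 1 (↭-trans (shift 1 (2 ∷ 3 ∷ 2 ∷ []) [])
  (prep 1 (prep 2 (_↭_.swap 3 2 ↭-refl)))))

-- By tightness for every choice of five, the six low vertices `xs` are pairwise non-adjacent and of
-- degree exactly 5, hence joined to all of `ys`. This uses 30 edges, and the remaining 8 = e(T₃(5))
-- lie in `ys`. A K₄ there would extend to a K₅, so `ys` induces K₂₂₁.
module _ (G : Graph 11) (¬K : ¬ (complete 5 ⊑ G)) (size : e G ≡ 38) (xs ys : List (Fin 11))
  (len-xs : length xs ≡ 6) (len-ys : length ys ≡ 5) (σ : xs ++ ys ↭ allFin 11)
  (deg≤5 : ∀ x → x ∈ xs → degree G x ≤ 5) where

  private
    a : Fin 11 → Fin 11 → Bool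
    a = adj G

    -- Removing five vertices of degree at most 5 leaves at most e (T₄ 6) = 13 edges,
    -- and 38 = 5 · 5 + 13, so nothing may be lost.
    module Pair {x y : Fin 11} (x∈ : x ∈ xs) (y∈ : y ∈ xs) (zs : List (Fin 11)) (perm : xs ↭ x ∷ y ∷ zs) where

      J R : List (Fin 11)
      J = take 3 zs
      R = drop 3 zs ++ ys
      JR : zs ++ ys ≡ J ++ R
      JR = ≡-trans (cong (_++ ys) (sym (take++drop≡id 3 zs))) (++-assoc J (drop 3 zs) ys)
      whole : x ∷ y ∷ (J ++ R) ↭ allFin 11
      whole = subst (λ l → x ∷ y ∷ l ↭ allFin 11) JR (↭-trans (++⁺ʳ ys (↭-sym perm)) σ)
      len-zs : length zs ≡ 4
      len-zs = suc-injective (suc-injective (≡-trans (sym (↭-length perm)) len-xs))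
      len-J : length J ≡ 3
      len-J = ≡-trans (length-take 3 zs) (cong (3 ⊓_) len-zs)
      len-R : length R ≡ 6
      len-R = ≡-trans (length-++ (drop 3 zs)) (cong₂ _+_ (≡-trans (length-drop 3 zs) (cong (_∸ 3) len-zs)) len-ys)
      J-low : ∀ z → z ∈ J → count (a z) (J ++ R) ≤ 5
      J-low z z∈ = ≤-trans (sublist-degree G (x ∷ y ∷ []) whole z)
        (deg≤5 z (∈-resp-↭ (↭-sym perm) (there (there (subst (z ∈_) (take++drop≡id 3 zs) (∈-++⁺ˡ z∈))))))
      JR-bound : edges a (J ++ R) ≤ 28
      JR-bound = begin
        edges a (J ++ R)              ≤⟨ edges-prefix a 5 J R J-low ⟩
        length J * 5 + edges a R      ≤⟨ +-mono-≤ (≤-reflexive (cong (_* 5) len-J)) R-bound ⟩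
        28                            ∎
        where
        open ≤-Reasoning
        R-bound : edges a R ≤ 13
        R-bound = subst (λ l → edges a R ≤ turánEdges 4 l) len-R
          (proj₁ (turán-theorem 4 a (symmetric G) (loopless G) R (no-clique G ¬K)))
      total : count (a x) (y ∷ (J ++ R)) + (count (a y) (J ++ R) + edges a (J ++ R)) ≡ 38
      total = ≡-trans (sym (edges-spanning G whole)) size
      degree-x : count (a x) (y ∷ (J ++ R)) ≤ degree G x
      degree-x = sublist-degree G [ x ] whole x
      degree-y : ⟦ a x y ⟧ + count (a y) (J ++ R) ≤ 5
      degree-y = begin
        ⟦ a x y ⟧ + count (a y) (J ++ R)                ≡⟨ cong (λ b → ⟦ b ⟧ + count (a y) (J ++ R)) (symmetric G x y) ⟩
        ⟦ a y x ⟧ + count (a y) (J ++ R)                ≡⟨ cong (λ b → ⟦ a y x ⟧ + (⟦ b ⟧ + count (a y) (J ++ R))) (sym (loopless G y)) ⟩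
        count (a y) (x ∷ y ∷ (J ++ R))                  ≤⟨ sublist-degree G [] whole y ⟩
        degree G y                                      ≤⟨ deg≤5 y y∈ ⟩
        5                                               ∎
        where open ≤-Reasoning
      nonadjacent : ¬ T (a x y)
      -- An edge between `x` and `y` would be counted in both degrees, leaving at most 5 + 4 + 28 =
      -- 37 edges.
      nonadjacent t = 1+n≰n (begin
        39                                ≡⟨ cong suc (sym total) ⟩
        1 + (count (a x) (y ∷ (J ++ R)) + (count (a y) (J ++ R) + edges a (J ++ R)))
          ≡⟨ shuffle (count (a x) (y ∷ (J ++ R))) (count (a y) (J ++ R)) (edges a (J ++ R)) ⟩
        count (a x) (y ∷ (J ++ R)) + ((1 + count (a y) (J ++ R)) + edges a (J ++ R))
          ≤⟨ +-mono-≤ (≤-trans degree-x (deg≤5 x x∈))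
               (+-mono-≤ (subst (λ i → i + count (a y) (J ++ R) ≤ 5) (⟦T⟧ t) degree-y) JR-bound) ⟩
        38                                ∎)
        where
        open ≤-Reasoning
        shuffle : ∀ p q s → 1 + (p + (q + s)) ≡ p + ((1 + q) + s)
        shuffle = solve-∀
      degree≥5 : 5 ≤ degree G x
      degree≥5 = +-cancelʳ-≤ 33 5 _ (begin
        38                                ≡⟨ sym total ⟩
        count (a x) (y ∷ (J ++ R)) + (count (a y) (J ++ R) + edges a (J ++ R))
          ≤⟨ +-mono-≤ degree-x (+-mono-≤ (≤-trans (m≤n+m _ ⟦ a x y ⟧) degree-y) JR-bound) ⟩
        degree G x + 33                   ∎)
        where open ≤-Reasoning

    nonadjacent : ∀ {x y} → x ∈ xs → y ∈ xs → x ≢ y → ¬ T (a x y)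
    nonadjacent x∈ y∈ x≢y with zs , perm ← two-∈⇒↭ x∈ y∈ x≢y = Pair.nonadjacent x∈ y∈ zs perm

    degree≥5 : ∀ {x y} → x ∈ xs → y ∈ xs → x ≢ y → 5 ≤ degree G x
    degree≥5 x∈ y∈ x≢y with zs , perm ← two-∈⇒↭ x∈ y∈ x≢y = Pair.degree≥5 x∈ y∈ zs perm

    unique : Unique (xs ++ ys)
    unique = unique-resp-↭ (↭-sym σ) (Unique.allFin⁺ 11)

    independent : ∀ x y → x ∈ xs → y ∈ xs → ¬ T (a x y)
    independent x y x∈ y∈ t with x Fin.≟ y
    ... | yes refl = Adj-irrefl G t
    ... | no x≢y   = nonadjacent x∈ y∈ x≢y t

    another : ∀ x → ∃[ y ] y ∈ xs × x ≢ y
    another x = go xs len-xs unique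
      where
      go : ∀ xs → length xs ≡ 6 → Unique (xs ++ ys) → ∃[ y ] y ∈ xs × x ≢ y
      go (p ∷ q ∷ _) _ ((p≢q ∷ _) ∷ _) with x Fin.≟ p
      ... | no x≢p   = p , here refl , x≢p
      ... | yes refl = q , there (here refl) , p≢q

    joined : ∀ x y → x ∈ xs → y ∈ ys → T (a x y)
    joined x y x∈ = count-true⁻ (a x) ys (≤-antisym (count≤length (a x) ys) full) y
      where
      full : length ys ≤ count (a x) ys
      full with y′ , y′∈ , x≢y′ ← another x = begin
        length ys                          ≡⟨ len-ys ⟩
        5                                  ≤⟨ degree≥5 x∈ y′∈ x≢y′ ⟩
        degree G x                         ≡⟨ ≡-trans (degree≡count G x) (sym (count-↭ (a x) σ)) ⟩
        count (a x) (xs ++ ys)             ≡⟨ count-++ (a x) xs ys ⟩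
        count (a x) xs + count (a x) ys    ≡⟨ cong (_+ count (a x) ys) (count-false (a x) xs (λ z → independent x z x∈)) ⟩
        count (a x) ys                     ∎
        where open ≤-Reasoning

    edges-ys : edges a ys ≡ 8
    edges-ys = +-cancelˡ-≡ 30 _ _ (begin
      30 + edges a ys                                ≡⟨ cong₂ (λ p q → p * q + edges a ys) (sym len-xs) (sym len-ys) ⟩
      length xs * length ys + edges a ys             ≡⟨ cong (_+ edges a ys) (sym (cross-full a xs ys joined)) ⟩
      cross a xs ys + edges a ys                     ≡⟨ cong (_+ (cross a xs ys + edges a ys)) (sym (edges-none a xs independent)) ⟩
      edges a xs + (cross a xs ys + edges a ys)      ≡⟨ sym (edges-++ a xs ys) ⟩
      edges a (xs ++ ys)                             ≡⟨ sym (edges-spanning G σ) ⟩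
      e G                                            ≡⟨ size ⟩
      38                                             ∎)
      where open ≡-Reasoning

    no-K₄ : ¬ Clique a 4 ys
    -- `another` merely names some vertex `w` of `xs`; it is joined to the whole clique.
    no-K₄ (ks , len , ks∈ , pairs) with w , w∈ , _ ← another (Fin.zero) =
      no-clique G ¬K {allFin 11} (w ∷ ks , cong suc len , ∈-allFin w ∷ All.map (λ {z} _ → ∈-allFin z) ks∈
        , All.map (λ {z} z∈ → joined w z w∈ z∈) ks∈ ∷ pairs)

    c-struct : ∃[ c ] map c ys ↭ residues 3 (length ys) × (∀ x y → x ∈ ys → y ∈ ys → a x y ≡ c x ≠ᵇ c y)
    c-struct = proj₂ (turán-theorem 3 a (symmetric G) (loopless G) ys no-K₄)
      (≡-trans edges-ys (cong (turánEdges 3) (sym len-ys)))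

    module Coloured (c : Fin 11 → ℕ) (σc : map c ys ↭ residues 3 (length ys))
      (struct : ∀ x y → x ∈ ys → y ∈ ys → a x y ≡ c x ≠ᵇ c y) where

      in-xs? : ∀ z → Dec (z ∈ xs)
      in-xs? z = any? (z Fin.≟_) xs

      C : Fin 11 → ℕ
      C z = if does (in-xs? z) then 0 else suc (c z)

      C-xs : ∀ z → z ∈ xs → C z ≡ 0
      C-xs z z∈ = cong (λ b → if b then 0 else suc (c z)) (dec-true (in-xs? z) z∈)

      C-ys : ∀ z → z ∉ xs → C z ≡ suc (c z)
      C-ys z z∉ = cong (λ b → if b then 0 else suc (c z)) (dec-false (in-xs? z) z∉)

      to-ys : ∀ {z} → z ∉ xs → z ∈ ys
      to-ys {z} z∉ with ∈-++⁻ xs (∈-resp-↭ (↭-sym σ) (∈-allFin z))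
      ... | inj₁ z∈ = contradiction z∈ z∉
      ... | inj₂ z∈ = z∈

      adj-C : ∀ i j → a i j ≡ C i ≠ᵇ C j
      adj-C i j = go (in-xs? i) (in-xs? j)
        where
        go : Dec (i ∈ xs) → Dec (j ∈ xs) → a i j ≡ C i ≠ᵇ C j
        go (yes i∈) (yes j∈) = ≡-trans (¬T⇒≡false (independent i j i∈ j∈)) (sym (cong₂ _≠ᵇ_ (C-xs i i∈) (C-xs j j∈)))
        go (yes i∈) (no j∉)  = ≡-trans (T⇒≡true (joined i j i∈ (to-ys j∉))) (sym (cong₂ _≠ᵇ_ (C-xs i i∈) (C-ys j j∉)))
        go (no i∉)  (yes j∈) = ≡-trans (≡-trans (symmetric G i j) (T⇒≡true (joined j i j∈ (to-ys i∉))))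
                                (sym (cong₂ _≠ᵇ_ (C-ys i i∉) (C-xs j j∈)))
        go (no i∉)  (no j∉)  = ≡-trans (struct i j (to-ys i∉) (to-ys j∉))
                                (sym (cong₂ _≠ᵇ_ (C-ys i i∉) (C-ys j j∉)))

      split : map C (xs ++ ys) ≡ replicate 6 0 ++ map suc (map c ys)
      split = ≡-trans (map-++ C xs ys) (cong₂ _++_
        (≡-trans (map-constant C 0 xs C-xs) (cong (λ l → replicate l 0) len-xs))
        (≡-trans (map-cong-∈ C (suc ∘ c) ys
          (λ z z∈ → C-ys z (λ z∈xs → unique-++ˡ xs unique z∈xs z∈))) (map-∘ ys)))

      colours-ys : map suc (map c ys) ↭ 1 ∷ 1 ∷ 2 ∷ 2 ∷ 3 ∷ []
      colours-ys = ↭-trans (map⁺ suc (subst (λ l → map c ys ↭ residues 3 l) len-ys σc)) residues-3-5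

      colours-C : map C (allFin 11) ↭ map (part (6 ∷ 2 ∷ 2 ∷ 1 ∷ [])) (allFin 11)
      colours-C = subst (map C (allFin 11) ↭_) (sym part-sizes)
        (↭-trans (map⁺ C (↭-sym σ)) (subst (_↭ (replicate 6 0 ++ 1 ∷ 1 ∷ 2 ∷ 2 ∷ 3 ∷ [])) (sym split)
          (++⁺ˡ (replicate 6 0) colours-ys)))

      iso : G ≅ K (6 ∷ 2 ∷ 2 ∷ 1 ∷ [])
      iso = iso-multipartite G C (part (6 ∷ 2 ∷ 2 ∷ 1 ∷ [])) adj-C colours-C

  exceptional-≅ : G ≅ K (6 ∷ 2 ∷ 2 ∷ 1 ∷ [])
  exceptional-≅ = Coloured.iso (proj₁ c-struct) (proj₁ (proj₂ c-struct)) (proj₂ (proj₂ c-struct))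

-- Arithmetic of the Turán numbers

open import Data.Integer.Base using (+_)

-- Linear arithmetic by certificate: a ≤ b is a combination of the hypotheses and s the slack.
certify : ∀ {a b} x y s → a ≤ b → x + b + s ≡ y + a → x ≤ y
certify {a} {b} x y s a≤b eq = +-cancelʳ-≤ a x y (begin
  x + a      ≤⟨ +-monoʳ-≤ x a≤b ⟩
  x + b      ≤⟨ m≤m+n _ s ⟩
  x + b + s  ≡⟨ eq ⟩
  y + a      ∎)
  where open ≤-Reasoning

-- Library lemmas restated with unfolded types, which is what the reflective solver can read.
infixr 6 _⊕_
infixr 7 _·_

_⊕_ : ∀ {a b c d} → a ≤ b → c ≤ d → a + c ≤ b + d
_⊕_ = +-mono-≤

_·_ : ∀ c {a b} → a ≤ b → c * a ≤ c * b
c · a≤b = *-monoʳ-≤ c a≤b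

by-contra : ∀ {x y} → ¬ (y < x) → x ≤ y
by-contra = ≮⇒≥

module _ (k n q : ℕ) where

  -- Here r = 8 + x, and the first hypothesis is the size condition multiplied by r - 4. The weights
  -- 1, r - 1 and 3 make n cancel; apart from nonnegative terms in k and q there remains 2r² - 17r +
  -- 25, which is positive for r ≥ 8.
  8≤r-key : ∀ x → k * (4 + x) + 4 * (k + 4) + 2 * (8 + x) * (4 + x) ≤ n * (4 + x) → q * (8 + x) ≤ n →
            k + 10 + 3 * q ≤ n
  8≤r-key x A B = by-contra λ C → 1+n≰n (certify 1 0 (k + 16 + 15 * x + 2 * x * x + 3 * q)
    (A ⊕ (7 + x) · C ⊕ 3 · B)
    (solve (k List.∷ n List.∷ q List.∷ x List.∷ List.[])))

  -- The bound k + 6 + 2q ≤ n, with q the quotient (n - 1) / r, is equivalent to 2(n - 2 - q) ≥ n +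
  -- k + 2, the degree sum required around the apex; it also leaves room to construct a member of
  -- `𝒥`. The `slack₁` bounds serve the deletion of fewer than 4 vertices, or fewer than 6 for r =
  -- 3.
  r≥4-slack₂ : 6 * k + 11 ≤ n → q * 4 ≤ n → k + 6 + 2 * q ≤ n
  r≥4-slack₂ P B = by-contra λ C → 1+n≰n (certify 1 0 (4 * k)
    (P ⊕ 2 · C ⊕ B) (solve (k List.∷ n List.∷ q List.∷ List.[])))

  r≥4-slack₁ : 6 * k + 11 ≤ n → q * 4 ≤ n → k + 8 + q ≤ n
  r≥4-slack₁ P B = by-contra λ C → 1+n≰n (certify 1 0 (14 * k + 4)
    (3 · P ⊕ 4 · C ⊕ B) (solve (k List.∷ n List.∷ q List.∷ List.[])))

  r≡3-slack₂ : 6 * k + 26 ≤ n → q * 3 ≤ n → k + 6 + 2 * q ≤ n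
  r≡3-slack₂ P B = by-contra λ C → 1+n≰n (certify 1 0 (3 * k + 10)
    (P ⊕ 3 · C ⊕ 2 · B) (solve (k List.∷ n List.∷ q List.∷ List.[])))

  r≡3-slack₁ : 6 * k + 26 ≤ n → q * 3 ≤ n → k + 14 + q ≤ n
  r≡3-slack₁ P B = by-contra λ C → 1+n≰n (certify 1 0 (9 * k + 12)
    (2 · P ⊕ 3 · C ⊕ B) (solve (k List.∷ n List.∷ q List.∷ List.[])))

toℚᵘ-/ : ∀ i d → ℚ.toℚᵘ (i ℚ./ suc d) ℚᵘ.≃ ℚᵘ.mkℚᵘ i d
toℚᵘ-/ i d = ℚ.toℚᵘ-fromℚᵘ (ℚᵘ.mkℚᵘ i d)

toℚᵘ-sum-≤ : ∀ (p q s t : ℚ.ℚ) {p′ q′ s′ t′ : ℚᵘ.ℚᵘ} → p ℚ.+ q ℚ.+ s ℚ.≤ t →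
  ℚ.toℚᵘ p ℚᵘ.≃ p′ → ℚ.toℚᵘ q ℚᵘ.≃ q′ → ℚ.toℚᵘ s ℚᵘ.≃ s′ → ℚ.toℚᵘ t ℚᵘ.≃ t′ → p′ ℚᵘ.+ q′ ℚᵘ.+ s′ ℚᵘ.≤ t′
toℚᵘ-sum-≤ p q s t {p′} {q′} {s′} {t′} le p≃ q≃ s≃ t≃ = begin
  p′ ℚᵘ.+ q′ ℚᵘ.+ s′                           ≃⟨ ℚᵘ.≃-sym (ℚᵘ.+-cong (ℚᵘ.+-cong p≃ q≃) s≃) ⟩
  ℚ.toℚᵘ p ℚᵘ.+ ℚ.toℚᵘ q ℚᵘ.+ ℚ.toℚᵘ s         ≃⟨ ℚᵘ.≃-sym (ℚᵘ.≃-trans (ℚ.toℚᵘ-homo-+ (p ℚ.+ q) s)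
                                                    (ℚᵘ.+-congˡ (ℚ.toℚᵘ s) (ℚ.toℚᵘ-homo-+ p q))) ⟩
  ℚ.toℚᵘ (p ℚ.+ q ℚ.+ s)                       ≤⟨ ℚ.toℚᵘ-mono-≤ le ⟩
  ℚ.toℚᵘ t                                     ≃⟨ t≃ ⟩
  t′                                           ∎
  where open ℚᵘ.≤-Reasoning

-- Unnormalised rationals keep the literal denominators 1 and `suc c`, so their order unfolds to a
-- cross-multiplied inequality of integers; normalised fractions with variable entries do not
-- compute.
clear-denominators : ∀ k a b n c → (+ k) ℚ./ 1 ℚ.+ (+ a) ℚ./ suc c ℚ.+ (+ b) ℚ./ 1 ℚ.≤ (+ n) ℚ./ 1 →
                     k * suc c + a + b * suc c ≤ n * suc c
clear-denominators k a b n c le = ℤ.drop‿+≤+ (subst₂ ℤ._≤_ lhs rhs (ℚᵘ.drop-*≤*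
  (toℚᵘ-sum-≤ _ _ _ _ le (toℚᵘ-/ (+ k) 0) (toℚᵘ-/ (+ a) c) (toℚᵘ-/ (+ b) 0) (toℚᵘ-/ (+ n) 0))))
  where
  lhs : ((+ k ℤ.* + suc c ℤ.+ + a ℤ.* + 1) ℤ.* + 1 ℤ.+ + b ℤ.* + (1 * suc c)) ℤ.* + 1 ≡
        + (k * suc c + a + b * suc c)
  lhs = begin
    ((+ k ℤ.* + suc c ℤ.+ + a ℤ.* + 1) ℤ.* + 1 ℤ.+ + b ℤ.* + (1 * suc c)) ℤ.* + 1
      ≡⟨ ℤ.*-identityʳ _ ⟩
    (+ k ℤ.* + suc c ℤ.+ + a ℤ.* + 1) ℤ.* + 1 ℤ.+ + b ℤ.* + (1 * suc c)
      ≡⟨ cong₂ ℤ._+_ (ℤ.*-identityʳ (+ k ℤ.* + suc c ℤ.+ + a ℤ.* + 1)) (sym (ℤ.pos-* b (1 * suc c))) ⟩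
    + k ℤ.* + suc c ℤ.+ + a ℤ.* + 1 ℤ.+ + (b * (1 * suc c))
      ≡⟨ cong₂ ℤ._+_ (cong₂ ℤ._+_ (sym (ℤ.pos-* k (suc c))) (ℤ.*-identityʳ (+ a)))
           (cong (λ z → + (b * z)) (*-identityˡ (suc c))) ⟩
    + (k * suc c + a + b * suc c) ∎
    where open ≡-Reasoning
  rhs : + n ℤ.* + (1 * suc c * 1) ≡ + (n * suc c)
  rhs = ≡-trans (sym (ℤ.pos-* n (1 * suc c * 1)))
    (cong (λ z → + (n * z)) (≡-trans (*-identityʳ (1 * suc c)) (*-identityˡ (suc c))))

8≤r-facts : ∀ {k n r} .{{_ : NonZero (r ∸ 4)}} → 8 ≤ r →
  (+ n) ℚ./ 1 ℚ.≥ (+ k) ℚ./ 1 ℚ.+ (+ (4 * (k + 4))) ℚ./ (r ∸ 4) ℚ.+ (+ (2 * r)) ℚ./ 1 →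
  ∀ q → q * r ≤ n → k + 10 + 3 * q ≤ n
8≤r-facts {k} {n} {r} r≥8 large q B with x , refl ← m≤n⇒∃[o]m+o≡n r≥8 =
  8≤r-key k n q x (clear-denominators k (4 * (k + 4)) (2 * (8 + x)) n (3 + x) large) B

module _ (r : ℕ) .{{_ : NonZero r}} where

  private
    t : ℕ → ℕ
    t = turánEdges r

    d : ℕ → ℕ
    d m = m ∸ m / r

    d+ : ∀ m → m ≤ d m + m / r
    d+ m = ≤-reflexive (sym (m∸n+n≡m (m/n≤m m r)))

  -- Each new vertex sees all earlier ones but a quotient. `Q` bounds the quotients over the whole
  -- range by monotonicity, so each vertex adds at least `D` edges.
  turánEdges-grows : ∀ j m Q D → (j + m) / r ≤ Q → D + Q ≤ m → j * D + turánEdges r m ≤ turánEdges r (j + m)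
  turánEdges-grows zero    m Q D _  _  = ≤-refl
  turánEdges-grows (suc j) m Q D q≤ le = begin
    D + j * D + t m       ≡⟨ +-assoc D (j * D) (t m) ⟩
    D + (j * D + t m)     ≤⟨ m+n≤o⇒m≤o∸n D (≤-trans (+-monoʳ-≤ D q≤′) (≤-trans le (m≤n+m m j)))
                             ⊕ turánEdges-grows j m Q D q≤′ le ⟩
    d (j + m) + t (j + m) ∎
    where
    open ≤-Reasoning
    q≤′ : (j + m) / r ≤ Q
    q≤′ = ≤-trans (/-monoˡ-≤ r (n≤1+n (j + m))) q≤

  -- All h - k = 2 + i guaranteed vertices are deleted. The 1 + i vertices between Tᵣ(m) and Tᵣ(n -
  -- 1) add at least k + 4 + i edges each, and (1 + i)(k + 4 + i) + (k + 1) exceeds (2 + i)(k + 2 +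
  -- i) by 1 + i.
  gain-small : ∀ k i m Q → (2 + i + m) / r ≤ Q → k + (2 * i + 6) + Q ≤ 2 + i + m →
    (2 + i) * (k + 2 + i) + turánEdges r m < turánEdges r (1 + i + m) + (k + 1)
  gain-small k i m Q q≤ le = certify _ _ i
    (turánEdges-grows (suc i) m Q (k + 4 + i) (≤-trans (/-monoˡ-≤ r (n≤1+n (suc i + m))) q≤)
      (certify _ _ 0 le (solve (k List.∷ i List.∷ m List.∷ Q List.∷ List.[]))))
    (arith k i (t m) (t (1 + i + m)))
    where
    arith : ∀ k i x y → (1 + ((2 + i) * (k + 2 + i) + x)) + y + i ≡ (y + (k + 1)) + ((1 + i) * (k + 4 + i) + x)
    arith = solve-∀

  -- Doubling 2h < n + k bounds the loss 4h, while three new vertices add 3m + 3 minus their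
  -- quotients. The first hypothesis is exactly what the comparison then requires.
  gain-4 : ∀ k h m → k + 7 + (m / r + (1 + m) / r + (2 + m) / r) ≤ 4 + m → h + h < k + (4 + m) →
    4 * h + turánEdges r m < turánEdges r (3 + m) + (k + 1)
  gain-4 k h m Q H = certify _ _ 0 (2 · H ⊕ Q ⊕ d+ m ⊕ d+ (1 + m) ⊕ d+ (2 + m))
    (arith k h m (t m) (d m) (d (1 + m)) (d (2 + m)) (m / r) ((1 + m) / r) ((2 + m) / r))
    where
    arith : ∀ k h m x a b c p q s →
      suc (4 * h + x) + (2 * (k + (4 + m)) + ((4 + m) + ((a + p) + ((b + q) + (c + s))))) + 0 ≡
      ((c + (b + (a + x))) + (k + 1)) +
      (2 * suc (h + h) + ((k + 7 + (p + q + s)) + (m + ((1 + m) + (2 + m)))))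
    arith = solve-∀

  -- As for four vertices, with 2h < n + k tripled and five new vertices that add 5m + 10 minus
  -- their quotients.
  gain-6 : ∀ k h m →
    2 * k + 17 + (m / r + (1 + m) / r + (2 + m) / r + (3 + m) / r + (4 + m) / r) ≤ 2 * (6 + m) →
    h + h < k + (6 + m) → 6 * h + turánEdges r m < turánEdges r (5 + m) + (k + 1)
  gain-6 k h m Q H =
    certify _ _ 0 (3 · H ⊕ Q ⊕ d+ m ⊕ d+ (1 + m) ⊕ d+ (2 + m) ⊕ d+ (3 + m) ⊕ d+ (4 + m))
    (arith k h m (t m) (d m) (d (1 + m)) (d (2 + m)) (d (3 + m)) (d (4 + m))
           (m / r) ((1 + m) / r) ((2 + m) / r) ((3 + m) / r) ((4 + m) / r))
    where
    arith : ∀ k h m x a b c e f p q s u v →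
      suc (6 * h + x) + (3 * (k + (6 + m)) + (2 * (6 + m) +
        ((a + p) + ((b + q) + ((c + s) + ((e + u) + (f + v))))))) + 0 ≡
      ((f + (e + (c + (b + (a + x))))) + (k + 1)) +
      (3 * suc (h + h) + ((2 * k + 17 + (p + q + s + u + v)) +
        (m + ((1 + m) + ((2 + m) + ((3 + m) + (4 + m)))))))
    arith = solve-∀

-- The three quotients depend on m modulo 4. The threshold is sharp: at m = 4k + 8 the inequality
-- fails by one.
quotients-4 : ∀ k m → 4 * k + 9 ≤ m → k + 7 + (m / 4 + (1 + m) / 4 + (2 + m) / 4) ≤ 4 + m
quotients-4 k m P = subst (λ z → k + 7 + (z / 4 + (1 + z) / 4 + (2 + z) / 4) ≤ 4 + z)
  (sym (m≡m%n+[m/n]*n m 4)) (go (m % 4) (m / 4) (m%n<n m 4) (subst (4 * k + 9 ≤_) (m≡m%n+[m/n]*n m 4) P))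
  where
  unique : ∀ ρ q {ρ<4 : True (ρ <? 4)} → (ρ + q * 4) / 4 ≡ q
  unique ρ q {ρ<4} = /-unique 4 q (toWitness ρ<4)
  quotients : ∀ {a b c a′ b′ c′ X} → a ≡ a′ → b ≡ b′ → c ≡ c′ →
              k + 7 + (a′ + b′ + c′) ≤ X → k + 7 + (a + b + c) ≤ X
  quotients refl refl refl = id
  go : ∀ ρ q → ρ < 4 → 4 * k + 9 ≤ ρ + q * 4 →
       k + 7 + ((ρ + q * 4) / 4 + (1 + (ρ + q * 4)) / 4 + (2 + (ρ + q * 4)) / 4) ≤ 4 + (ρ + q * 4)
  go 0 q _ P = quotients (unique 0 q) (unique 1 q) (unique 2 q) (by-contra λ C →
    1+n≰n (certify 1 0 0 (P ⊕ 4 · C) (solve (k List.∷ q List.∷ List.[]))))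
  go 1 q _ P = quotients (unique 1 q) (unique 2 q) (unique 3 q) (by-contra λ C →
    1+n≰n (certify 1 0 3 (P ⊕ 4 · C) (solve (k List.∷ q List.∷ List.[]))))
  go 2 q _ P = quotients (unique 2 q) (unique 3 q) (unique 0 (1 + q)) (by-contra λ C →
    1+n≰n (certify 1 0 2 (P ⊕ 4 · C) (solve (k List.∷ q List.∷ List.[]))))
  go 3 q _ P = quotients (unique 3 q) (unique 0 (1 + q)) (unique 1 (1 + q)) (by-contra λ C →
    1+n≰n (certify 1 0 1 (P ⊕ 4 · C) (solve (k List.∷ q List.∷ List.[]))))
  go (suc (suc (suc (suc ρ)))) q (s≤s (s≤s (s≤s (s≤s ())))) P

quotients-3 : ∀ k m → 6 * k + 20 ≤ m →
  2 * k + 17 + (m / 3 + (1 + m) / 3 + (2 + m) / 3 + (3 + m) / 3 + (4 + m) / 3) ≤ 2 * (6 + m)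
quotients-3 k m P = subst
  (λ z → 2 * k + 17 + (z / 3 + (1 + z) / 3 + (2 + z) / 3 + (3 + z) / 3 + (4 + z) / 3) ≤ 2 * (6 + z))
  (sym (m≡m%n+[m/n]*n m 3)) (go (m % 3) (m / 3) (m%n<n m 3) (subst (6 * k + 20 ≤_) (m≡m%n+[m/n]*n m 3) P))
  where
  unique : ∀ ρ q {ρ<3 : True (ρ <? 3)} → (ρ + q * 3) / 3 ≡ q
  unique ρ q {ρ<3} = /-unique 3 q (toWitness ρ<3)
  quotients : ∀ {a b c d e a′ b′ c′ d′ e′ X} → a ≡ a′ → b ≡ b′ → c ≡ c′ → d ≡ d′ → e ≡ e′ →
              2 * k + 17 + (a′ + b′ + c′ + d′ + e′) ≤ X → 2 * k + 17 + (a + b + c + d + e) ≤ X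
  quotients refl refl refl refl refl = id
  go : ∀ ρ q → ρ < 3 → 6 * k + 20 ≤ ρ + q * 3 →
       2 * k + 17 + ((ρ + q * 3) / 3 + (1 + (ρ + q * 3)) / 3 + (2 + (ρ + q * 3)) / 3
         + (3 + (ρ + q * 3)) / 3 + (4 + (ρ + q * 3)) / 3) ≤ 2 * (6 + (ρ + q * 3))
  go 0 q _ P = quotients (unique 0 q) (unique 1 q) (unique 2 q) (unique 0 (1 + q)) (unique 1 (1 + q))
    (by-contra λ C → 1+n≰n (certify 1 0 1 (P ⊕ 3 · C) (solve (k List.∷ q List.∷ List.[]))))
  go 1 q _ P = quotients (unique 1 q) (unique 2 q) (unique 0 (1 + q)) (unique 1 (1 + q)) (unique 2 (1 + q))
    (by-contra λ C → 1+n≰n (certify 1 0 3 (P ⊕ 3 · C) (solve (k List.∷ q List.∷ List.[]))))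
  go 2 q _ P = quotients (unique 2 q) (unique 0 (1 + q)) (unique 1 (1 + q)) (unique 2 (1 + q)) (unique 0 (2 + q))
    (by-contra λ C → 1+n≰n (certify 1 0 2 (P ⊕ 3 · C) (solve (k List.∷ q List.∷ List.[]))))
  go (suc (suc (suc ρ))) q (s≤s (s≤s (s≤s ()))) P

5≤r-quotients : ∀ k m q → 6 * k + 13 ≤ 4 + m → q * 5 ≤ 2 + m → k + 7 + (q + q + q) ≤ 4 + m
5≤r-quotients k m q P B = by-contra λ C → 1+n≰n (certify 1 0 (7 * k + 1)
  (2 · P ⊕ 5 · C ⊕ 3 · B) (solve (k List.∷ m List.∷ q List.∷ List.[])))

-- Size regimes and the number of vertices to delete

middle-bound : ∀ {k n r} → 4 ≤ r → n ≥ 6 * k + 2 * r + 3 → 6 * k + 11 ≤ n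
middle-bound {k} {n} {r} 4≤r P = certify _ _ 0 (2 · 4≤r ⊕ P) (arith k n r)
  where
  arith : ∀ k n r → 6 * k + 11 + (2 * r + n) + 0 ≡ n + (2 * 4 + (6 * k + 2 * r + 3))
  arith = solve-∀

-- The size condition without rationals. For r ≥ 8 only its consequence for quotients is retained;
-- `q` is later taken as n / r, (n - 1) / r and (n - 2) / r, and q = 0 yields n ≥ 10.
data Regime (k n : ℕ) : ℕ → Set where
  three  : 6 * k + 26 ≤ n → Regime k n 3
  middle : ∀ {r} → 4 ≤ r → r ≤ 7 → 6 * k + 2 * r + 3 ≤ n → Regime k n r
  large  : ∀ {r} → 8 ≤ r → (∀ q → q * r ≤ n → k + 10 + 3 * q ≤ n) → Regime k n r

regime : ∀ {k n r} → LargeEnough k n r → Regime k n r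
regime (r≡3 P)         = three P
regime (4≤r≤7 r≥4 r≤7 P) = middle r≥4 r≤7 P
regime {k} {n} {r} (8≤r r≥8 P) = large r≥8 (8≤r-facts {k} {n} {r} r≥8 P)

regime-slack₂ : ∀ {k n r} → Regime k n r → ∀ q → q * r ≤ n → k + 6 + 2 * q ≤ n
regime-slack₂ {k} {n} (three P)             q B = r≡3-slack₂ k n q P B
regime-slack₂ {k} {n} {r} (middle 4≤r _ P) q B =
  r≥4-slack₂ k n q (middle-bound {k} 4≤r P) (≤-trans (*-monoʳ-≤ q 4≤r) B)
regime-slack₂ {k} {n} {r} (large r≥8 P)     q B =
  certify (k + 6 + 2 * q) n (4 + q) (P q B) (solve (k List.∷ n List.∷ q List.∷ List.[]))

regime-slack₁ : ∀ {k n r} → Regime k n r → 4 ≤ r → ∀ q → q * r ≤ n → k + 8 + q ≤ n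
regime-slack₁ {k} {n} (three P)             (s≤s (s≤s (s≤s ()))) q B
regime-slack₁ {k} {n} {r} (middle 4≤r _ P) _ q B =
  r≥4-slack₁ k n q (middle-bound {k} 4≤r P) (≤-trans (*-monoʳ-≤ q 4≤r) B)
regime-slack₁ {k} {n} {r} (large r≥8 P)     _ q B =
  certify (k + 8 + q) n (2 + 2 * q) (P q B) (solve (k List.∷ n List.∷ q List.∷ List.[]))

-- Deleting j of at least h ∸ k vertices of degree at most h leaves G strictly below the bound.
record Gain (k n r h : ℕ) .{{_ : NonZero r}} : Set where
  field
    j     : ℕ
    k+j≤h : k + j ≤ h
    j≤n   : j ≤ n
    gain  : j * h + turánEdges r (n ∸ j) < turánEdges r (n ∸ 1) + (k + 1)

module _ {k n r : ℕ} .{{_ : NonZero r}} where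

  2+i≤n : ∀ i → k + (2 * i + 6) + n / r ≤ n → 2 + i ≤ n
  2+i≤n i le = certify _ _ (k + i + 4 + n / r) le (arith k i n (n / r))
    where
    arith : ∀ k i n q → (2 + i) + n + (k + i + 4 + q) ≡ n + (k + (2 * i + 6) + q)
    arith = solve-∀

  small : ∀ i → k + (2 * i + 6) + n / r ≤ n → Gain k n r (k + 2 + i)
  small i le with m , refl ← m≤n⇒∃[o]m+o≡n {2 + i} {n} (2+i≤n i le)
    = record
    { j = 2 + i
    ; k+j≤h = ≤-reflexive (sym (+-assoc k 2 i))
    ; j≤n = m≤m+n (2 + i) m
    ; gain = subst (λ z → (2 + i) * (k + 2 + i) + turánEdges r z < turánEdges r (1 + i + m) + (k + 1))
        (sym (m+n∸m≡n i m)) (gain-small r k i m ((2 + i + m) / r) ≤-refl le)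
    }

  big-4 : ∀ i m → n ≡ 4 + m → k + 7 + (m / r + (1 + m) / r + (2 + m) / r) ≤ 4 + m →
          (k + 2 + (2 + i)) + (k + 2 + (2 + i)) < k + n → Gain k n r (k + 2 + (2 + i))
  big-4 i m refl le h< = record
    { j = 4
    ; k+j≤h = subst (k + 4 ≤_) (sym (+-assoc k 2 (2 + i))) (+-monoʳ-≤ k (m≤m+n 4 i))
    ; j≤n = m≤m+n 4 m
    ; gain = gain-4 r k (k + 2 + (2 + i)) m le h<
    }

big-6 : ∀ {k n} i → 6 * k + 26 ≤ n → (k + 2 + (4 + i)) + (k + 2 + (4 + i)) < k + n → Gain k n 3 (k + 2 + (4 + i))
big-6 {k} {n} i P h< with m , refl ← m≤n⇒∃[o]m+o≡n {6} {n} (≤-trans (m≤n+m 6 (6 * k + 20)) (subst (_≤ n) (sym (+-assoc (6 * k) 20 6)) P))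
  = record
  { j = 6
  ; k+j≤h = subst (k + 6 ≤_) (sym (+-assoc k 2 (4 + i))) (+-monoʳ-≤ k (m≤m+n 6 i))
  ; j≤n = m≤m+n 6 m
  ; gain = gain-6 3 k (k + 2 + (4 + i)) m (quotients-3 k m (certify _ _ 0 P (solve (k List.∷ m List.∷ List.[])))) h<
  }

Exceptional : (k n r i : ℕ) → Set
Exceptional k n r i = k ≡ 0 × n ≡ 11 × r ≡ 4 × i ≡ 3

-- Here m = n - 4 ≥ 6k + 7, so the threshold 4k + 9 of `quotients-4` can be missed only for k = 0
-- and n = 11 or 12. The few possible `h` there are evaluated by computation.
gain-r≡4 : ∀ {k n} i → 6 * k + 11 ≤ n → (k + 2 + (2 + i)) + (k + 2 + (2 + i)) < k + n →
           Gain k n 4 (k + 2 + (2 + i)) ⊎ Exceptional k n 4 (2 + i)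
gain-r≡4 {k} {n} i P h< with m , refl ← m≤n⇒∃[o]m+o≡n {4} {n} (≤-trans (m≤n+m 4 (6 * k + 7)) (subst (_≤ n) (sym (+-assoc (6 * k) 7 4)) P))
  with 4 * k + 9 ≤? m
... | yes enough = inj₁ (big-4 i m refl (quotients-4 k m enough) h<)
... | no few = tiny k m P (≰⇒> few) i h<
  where
  tiny : ∀ k m → 6 * k + 11 ≤ 4 + m → m < 4 * k + 9 → ∀ i → (k + 2 + (2 + i)) + (k + 2 + (2 + i)) < k + (4 + m) →
         Gain k (4 + m) 4 (k + 2 + (2 + i)) ⊎ Exceptional k (4 + m) 4 (2 + i)
  tiny (suc k) m P U i _ = contradiction
    (certify 1 0 (2 * k) (P ⊕ U) (solve (k List.∷ m List.∷ List.[]))) 1+n≰n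
  tiny 0 7 P U 0 h< = inj₁ (record { j = 4 ; k+j≤h = ≤-refl ; j≤n = m≤m+n 4 7 ; gain = <ᵇ⇒< _ _ tt })
  -- The tie: h = 5 and n = 11, where 4 · 5 + e(T₄(7)) = 20 + 18 equals e(T₄(10)) + 1 = 38.
  tiny 0 7 P U 1 h< = inj₂ (refl , refl , refl , refl)
  tiny 0 7 P U (suc (suc i)) h< = contradiction (certify 1 0 (1 + 2 * i) h< (solve (i List.∷ List.[]))) 1+n≰n
  tiny 0 8 P U 0 h< = inj₁ (record { j = 4 ; k+j≤h = ≤-refl ; j≤n = m≤m+n 4 8 ; gain = <ᵇ⇒< _ _ tt })
  tiny 0 8 P U 1 h< = inj₁ (record { j = 4 ; k+j≤h = n≤1+n 4 ; j≤n = m≤m+n 4 8 ; gain = <ᵇ⇒< _ _ tt })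
  tiny 0 8 P U (suc (suc i)) h< = contradiction (certify 1 0 (2 * i) h< (solve (i List.∷ List.[]))) 1+n≰n
  tiny 0 (suc (suc (suc (suc (suc (suc (suc (suc (suc m))))))))) P U i h< =
    contradiction (certify 1 0 m U (solve (m List.∷ List.[]))) 1+n≰n
  tiny 0 0 (s≤s (s≤s (s≤s (s≤s ())))) U i h<
  tiny 0 1 (s≤s (s≤s (s≤s (s≤s (s≤s ()))))) U i h<
  tiny 0 2 (s≤s (s≤s (s≤s (s≤s (s≤s (s≤s ())))))) U i h<
  tiny 0 3 (s≤s (s≤s (s≤s (s≤s (s≤s (s≤s (s≤s ()))))))) U i h<
  tiny 0 4 (s≤s (s≤s (s≤s (s≤s (s≤s (s≤s (s≤s (s≤s ())))))))) U i h<
  tiny 0 5 (s≤s (s≤s (s≤s (s≤s (s≤s (s≤s (s≤s (s≤s (s≤s ()))))))))) U i h<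
  tiny 0 6 (s≤s (s≤s (s≤s (s≤s (s≤s (s≤s (s≤s (s≤s (s≤s (s≤s ())))))))))) U i h<

-- Three times the largest quotient is accurate enough from r = 5 on. For r = 4 it is too coarse,
-- for instance at k = 1 and n = 18, so `quotients-4` evaluates the quotients exactly.
three-quotients : ∀ {r} .{{_ : NonZero r}} m →
  m / r + (1 + m) / r + (2 + m) / r ≤ (2 + m) / r + (2 + m) / r + (2 + m) / r
three-quotients {r} m = +-monoˡ-≤ ((2 + m) / r) (/-monoˡ-≤ r (m≤n+m m 2) ⊕ /-monoˡ-≤ r (n≤1+n (1 + m)))

small-r≥4 : ∀ {k n r} .{{_ : NonZero r}} → Regime k n r → 4 ≤ r → ∀ i → i < 2 → Gain k n r (k + 2 + i)
small-r≥4 {k} {n} {r} L r≥4 i i<2 = small i (≤-trans (+-monoˡ-≤ (n / r) (+-monoʳ-≤ k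
  (+-monoˡ-≤ 6 (*-monoʳ-≤ 2 (s≤s⁻¹ i<2))))) (regime-slack₁ L r≥4 (n / r) (m/n*n≤m n r)))

module _ {k m r : ℕ} .{{_ : NonZero r}} where

  gain-middle : ∀ i → 5 ≤ r → 6 * k + 2 * r + 3 ≤ 4 + m →
    (k + 2 + (2 + i)) + (k + 2 + (2 + i)) < k + (4 + m) → Gain k (4 + m) r (k + 2 + (2 + i))
  gain-middle i r≥5 P = big-4 i m refl (≤-trans (+-monoʳ-≤ (k + 7) (three-quotients {r} m))
    (5≤r-quotients k m ((2 + m) / r) (certify (6 * k + 13) (4 + m) 0 (2 · r≥5 ⊕ P) (arith k m r))
      (≤-trans (*-monoʳ-≤ ((2 + m) / r) r≥5) (m/n*n≤m (2 + m) r))))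
    where
    arith : ∀ k m r → 6 * k + 13 + (2 * r + (4 + m)) + 0 ≡ (4 + m) + (2 * 5 + (6 * k + 2 * r + 3))
    arith = solve-∀

  gain-large : ∀ i → (∀ q → q * r ≤ 4 + m → k + 10 + 3 * q ≤ 4 + m) →
    (k + 2 + (2 + i)) + (k + 2 + (2 + i)) < k + (4 + m) → Gain k (4 + m) r (k + 2 + (2 + i))
  gain-large i P = big-4 i m refl (≤-trans (+-monoʳ-≤ (k + 7) (three-quotients {r} m))
    (certify (k + 7 + (q + q + q)) (4 + m) 3
      (P q (≤-trans (m/n*n≤m (2 + m) r) (m≤n+m (2 + m) 2))) (arith k m q)))
    where
    q : ℕ
    q = (2 + m) / r
    arith : ∀ k m q → k + 7 + (q + q + q) + (4 + m) + 3 ≡ (4 + m) + (k + 10 + 3 * q)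
    arith = solve-∀

gain-middle-or-exceptional : ∀ {k n r} .{{_ : NonZero r}} i → 4 ≤ r → 6 * k + 2 * r + 3 ≤ n →
  (k + 2 + (2 + i)) + (k + 2 + (2 + i)) < k + n → Gain k n r (k + 2 + (2 + i)) ⊎ Exceptional k n r (2 + i)
gain-middle-or-exceptional {k} {n} {r} i r≥4 P h< with r ≟ 4
... | yes refl = gain-r≡4 i (middle-bound {k} r≥4 P) h<
... | no r≢4 = inj₁ (go n (≤-trans (m≤n+m 4 (6 * k + 7)) (subst (_≤ n) (sym (+-assoc (6 * k) 7 4)) (middle-bound {k} r≥4 P))) P h<)
  where
  go : ∀ n → 4 ≤ n → 6 * k + 2 * r + 3 ≤ n → (k + 2 + (2 + i)) + (k + 2 + (2 + i)) < k + n → Gain k n r (k + 2 + (2 + i))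
  go (suc (suc (suc (suc m)))) _ = gain-middle i (≤∧≢⇒< r≥4 (r≢4 ∘ sym))
  go 0 ()
  go 1 (s≤s ())
  go 2 (s≤s (s≤s ()))
  go 3 (s≤s (s≤s (s≤s ())))

gain-large-≥10 : ∀ {k n r} .{{_ : NonZero r}} i → (∀ q → q * r ≤ n → k + 10 + 3 * q ≤ n) →
  (k + 2 + (2 + i)) + (k + 2 + (2 + i)) < k + n → Gain k n r (k + 2 + (2 + i))
gain-large-≥10 {k} {n} {r} i P = go n (≤-trans (m≤n+m 10 k) (subst (_≤ n) (+-identityʳ (k + 10)) (P 0 z≤n))) P
  where
  go : ∀ n → 10 ≤ n → (∀ q → q * r ≤ n → k + 10 + 3 * q ≤ n) → (k + 2 + (2 + i)) + (k + 2 + (2 + i)) < k + n →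
       Gain k n r (k + 2 + (2 + i))
  go (suc (suc (suc (suc m)))) _ = gain-large i
  go 0 ()
  go 1 (s≤s ())
  go 2 (s≤s (s≤s ()))
  go 3 (s≤s (s≤s (s≤s ())))

gain-three : ∀ {k n} i → i < 4 → 6 * k + 26 ≤ n → Gain k n 3 (k + 2 + i)
gain-three {k} {n} i i<4 P = small i (≤-trans (+-monoˡ-≤ (n / 3) (+-monoʳ-≤ k bound))
  (certify (k + 12 + n / 3) n 2 (r≡3-slack₁ k n (n / 3) P (m/n*n≤m n 3)) (arith k n (n / 3))))
  where
  bound : 2 * i + 6 ≤ 12
  bound = +-monoˡ-≤ 6 (*-monoʳ-≤ 2 (s≤s⁻¹ i<4))
  arith : ∀ k n q → k + 12 + q + n + 2 ≡ n + (k + 14 + q)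
  arith = solve-∀

gain : ∀ {k n r} .{{_ : NonZero r}} → Regime k n r → ∀ i → (k + 2 + i) + (k + 2 + i) < k + n →
       Gain k n r (k + 2 + i) ⊎ Exceptional k n r i
gain (three P) (suc (suc (suc (suc i)))) h< = inj₁ (big-6 i P h<)
gain (three P) 0 h< = inj₁ (gain-three 0 (s≤s z≤n) P)
gain (three P) 1 h< = inj₁ (gain-three 1 (s≤s (s≤s z≤n)) P)
gain (three P) 2 h< = inj₁ (gain-three 2 (s≤s (s≤s (s≤s z≤n))) P)
gain (three P) 3 h< = inj₁ (gain-three 3 (s≤s (s≤s (s≤s (s≤s z≤n)))) P)
gain R@(middle r≥4 _ P) 0 h< = inj₁ (small-r≥4 R r≥4 0 (s≤s z≤n))
gain R@(middle r≥4 _ P) 1 h< = inj₁ (small-r≥4 R r≥4 1 (s≤s (s≤s z≤n)))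
gain (middle r≥4 _ P) (suc (suc i)) h< = gain-middle-or-exceptional i r≥4 P h<
gain R@(large r≥8 P) 0 h< = inj₁ (small-r≥4 R (≤-trans (m≤m+n 4 4) r≥8) 0 (s≤s z≤n))
gain R@(large r≥8 P) 1 h< = inj₁ (small-r≥4 R (≤-trans (m≤m+n 4 4) r≥8) 1 (s≤s (s≤s z≤n)))
gain (large r≥8 P) (suc (suc i)) h< = inj₁ (gain-large-≥10 i P h<)

-- Non-emptiness of 𝒥

-- The apex takes the colour `s` = r - 1, which its neighbours φ 0, ..., φ k avoid, so the whole
-- graph stays r-colourable and contains no clique on r + 1 vertices. Consecutive neighbours have
-- different residues, so listing them in the order of `φ` is a spanning path of the neighbourhood.
module ApexConstruction (k m s : ℕ) (φ : ℕ → ℕ) (φ<m : ∀ j → j ≤ k → φ j < m)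
  (φ-injective : ∀ {i j} → φ i ≡ φ j → i ≡ j) (φ%<s : ∀ j → φ j % suc s < s)
  (next-residue : ∀ j → φ j % suc s ≢ φ (suc j) % suc s) where

  private
    r : ℕ
    r = suc s

    pick : Fin (suc k) → Fin m
    pick j = Fin.fromℕ< (φ<m (toℕ j) (Fin.toℕ≤pred[n] j))

    toℕ-pick : ∀ j → toℕ (pick j) ≡ φ (toℕ j)
    toℕ-pick j = Fin.toℕ-fromℕ< (φ<m (toℕ j) (Fin.toℕ≤pred[n] j))

    picks : List (Fin m)
    picks = tabulate pick

    picked? : ∀ i → Dec (i ∈ picks)
    picked? i = any? (i Fin.≟_) picks

    colour : Fin (suc m) → ℕ
    colour zero    = s
    colour (suc i) = toℕ i % r

    H-adj : Fin (suc m) → Fin (suc m) → Bool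
    H-adj zero    zero    = false
    H-adj zero    (suc j) = does (picked? j)
    H-adj (suc i) zero    = does (picked? i)
    H-adj (suc i) (suc j) = toℕ i % r ≠ᵇ toℕ j % r

  H : Graph (suc m)
  H = record
    { adj       = H-adj
    ; symmetric = λ { zero zero → refl ; zero (suc j) → refl ; (suc i) zero → refl
                    ; (suc i) (suc j) → ≠ᵇ-sym (toℕ i % r) (toℕ j % r) }
    ; loopless  = λ { zero → refl ; (suc i) → ≠ᵇ-irrefl (toℕ i % r) }
    }

  private
    picked-colour : ∀ {i} → i ∈ picks → toℕ i % r < s
    picked-colour i∈ with j , refl ← ∈-tabulate⁻ {f = pick} i∈ =
      subst (_< s) (sym (cong (_% r) (toℕ-pick j))) (φ%<s (toℕ j))

    proper : ∀ u w → Adj H u w → colour u ≢ colour w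
    proper zero    (suc j) t eq = <-irrefl (sym eq) (picked-colour (does⁻ (picked? j) t))
    proper (suc i) zero    t eq = <-irrefl eq (picked-colour (does⁻ (picked? i) t))
    proper (suc i) (suc j) t    = ≠ᵇ⇒≢ t

    colour<r : ∀ u → colour u < r
    colour<r zero    = ≤-refl
    colour<r (suc i) = m%n<n (toℕ i) r

    clique-free : ¬ (complete (suc r) ⊑ H)
    clique-free (f , _ , adjacent)
      with i , j , i<j , eq ← Fin.pigeonhole {r} {suc r} ≤-refl (λ i → Fin.fromℕ< (colour<r (f i)))
      = proper (f i) (f j) (adjacent i j (≢⇒≠ᵇ {toℕ i} {toℕ j} (<⇒≢ i<j)))
          (≡-trans (sym (Fin.toℕ-fromℕ< (colour<r (f i)))) (≡-trans (cong toℕ eq) (Fin.toℕ-fromℕ< (colour<r (f j)))))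

    nbrs : List (Fin (suc m))
    nbrs = map suc picks

    unique-nbrs : Unique nbrs
    unique-nbrs = Unique.map⁺ Fin.suc-injective (Unique.tabulate⁺ λ {i} {j} eq →
      Fin.toℕ-injective (φ-injective (≡-trans (sym (toℕ-pick i)) (≡-trans (cong toℕ eq) (toℕ-pick j)))))

    nbrs-sound : ∀ u → u ∈ nbrs → Adj H zero u
    nbrs-sound u u∈ with i , i∈ , refl ← ∈-map⁻ suc u∈ = does⁺ (picked? i) i∈

    nbrs-complete : ∀ u → Adj H zero u → u ∈ nbrs
    nbrs-complete (suc i) t = ∈-map⁺ suc (does⁻ (picked? i) t)

    linked-nbrs : Linked (Adj H) nbrs
    linked-nbrs = Linked.map⁺ (subst (Linked _) (map-tabulate id pick) (Linked.map⁺ (consecutive k (λ z → z) λ _ → refl)))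
      where
      -- The offset `c` records how far `f` has been shifted, so that neighbouring entries of
      -- `tabulate f` are known to have consecutive numbers.
      consecutive : ∀ l (f : Fin (suc l) → Fin (suc k)) {c} → (∀ i → toℕ (f i) ≡ c + toℕ i) →
                    Linked (λ i j → Adj H (suc (pick i)) (suc (pick j))) (tabulate f)
      consecutive zero    f eq = [-]
      consecutive (suc l) f {c} eq =
        ≢⇒≠ᵇ (λ same → next-residue (toℕ (f zero)) (≡-trans (sym (cong (_% r) (toℕ-pick (f zero))))
          (≡-trans same (≡-trans (cong (_% r) (toℕ-pick (f (suc zero))))
            (cong (λ z → φ z % r) (≡-trans (eq (suc zero)) (≡-trans (+-suc c 0) (cong suc (sym (eq zero))))))))))
        ∷ consecutive l (f ∘ suc) {suc c} (λ i → ≡-trans (eq (suc i)) (+-suc c (toℕ i)))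

    degree-zero : degree H zero ≡ k + 1
    degree-zero = begin
      degree H zero    ≡⟨ ↭-length (unique-↭ (Unique.filter⁺ (adj? H zero) (Unique.allFin⁺ (suc m))) unique-nbrs
        (λ {u} u∈ → nbrs-complete u (proj₂ (∈-filter⁻ (adj? H zero) {xs = allFin (suc m)} u∈)))
        (λ {u} u∈ → ∈-filter⁺ (adj? H zero) (∈-allFin u) (nbrs-sound u u∈))) ⟩
      length nbrs      ≡⟨ ≡-trans (length-map suc picks) (length-tabulate pick) ⟩
      suc k            ≡⟨ +-comm 1 k ⟩
      k + 1            ∎
      where open ≡-Reasoning

    balanced : Balanced r H zero
    balanced = colour , ↭-trans (map⁺ colour others↭) (subst (_↭ residues r m) (map-∘ (allFin m)) (colours-turán r m))
      , struct
      where
      others↭ : others H zero ↭ map suc (allFin m)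
      others↭ = unique-↭ (Unique.filter⁺ (λ u → ¬? (u Fin.≟ zero)) (Unique.allFin⁺ (suc m))) (Unique.map⁺ Fin.suc-injective (Unique.allFin⁺ m))
        (λ {u} u∈ → nonzero u (∈others⁻ H zero u∈))
        (λ {u} u∈ → ∈others H zero λ { refl → zero∉ (∈-map⁻ suc u∈) })
        where
        nonzero : ∀ u → u ≢ zero → u ∈ map suc (allFin m)
        nonzero zero    u≢ = contradiction refl u≢
        nonzero (suc i) _  = ∈-map⁺ suc (∈-allFin i)
        zero∉ : ¬ (∃[ i ] i ∈ allFin m × zero ≡ suc i)
        zero∉ (_ , _ , ())
      struct : ∀ u w → u ∈ others H zero → w ∈ others H zero → adj H u w ≡ colour u ≠ᵇ colour w
      struct zero    w       u∈ w∈ = contradiction refl (∈others⁻ H zero u∈)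
      struct (suc i) zero    u∈ w∈ = contradiction refl (∈others⁻ H zero w∈)
      struct (suc i) (suc j) u∈ w∈ = refl

  member : 𝒥 k (suc m) r H
  member = record
    { clique-free = clique-free
    ; apex        = zero
    ; rest        = balanced⇒≅ r H zero balanced
    ; apex-degree = degree-zero
    ; traceable   = traceable-neighbourhood H zero nbrs unique-nbrs linked-nbrs
                      (subst (1 ≤_) (sym (≡-trans (length-map suc picks) (length-tabulate pick))) (s≤s z≤n))
                      nbrs-sound nbrs-complete
    }

module Existence (k m x : ℕ) (slack : k + 6 + 2 * (m / (3 + x)) ≤ suc m) where

  private
    r s : ℕ
    r = 3 + x
    s = 2 + x

    -- Enumerates the numbers not congruent to `s` modulo `r` = suc `s`, since one number in each
    -- block of `r` is skipped. Successive residues differ because s ≥ 2.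
    φ : ℕ → ℕ
    φ j = j % s + (j / s) * r

    small-residue : ∀ j → j % s < r
    small-residue j = m<n⇒m<1+n (m%n<n j s)

    φ% : ∀ j → φ j % r ≡ j % s
    φ% j = %-unique r (j / s) (small-residue j)

    φ/ : ∀ j → φ j / r ≡ j / s
    φ/ j = /-unique r (j / s) (small-residue j)

    φ-injective : ∀ {i j} → φ i ≡ φ j → i ≡ j
    φ-injective {i} {j} eq = begin
      i                      ≡⟨ m≡m%n+[m/n]*n i s ⟩
      i % s + (i / s) * s    ≡⟨ cong₂ (λ a b → a + b * s)
        (≡-trans (sym (φ% i)) (≡-trans (cong (_% r) eq) (φ% j)))
        (≡-trans (sym (φ/ i)) (≡-trans (cong (_/ r) eq) (φ/ j))) ⟩
      j % s + (j / s) * s    ≡⟨ sym (m≡m%n+[m/n]*n j s) ⟩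
      j                      ∎
      where open ≡-Reasoning

    φ≡ : ∀ j → φ j ≡ j + j / s
    φ≡ j = ≡-trans (arith (j % s) (j / s) x) (cong (_+ j / s) (sym (m≡m%n+[m/n]*n j s)))
      where
      arith : ∀ a q x → a + q * (3 + x) ≡ (a + q * (2 + x)) + q
      arith = solve-∀

    -- As k < m < r * (m / r + 1) and r ≤ 2s, the quotient is even below 2 * (m / r) + 2. The looser
    -- bound is the one that `slack` absorbs directly in `φ<m`, where φ k = k + k / s.
    k/s-bound : k / s ≤ 2 * (m / r) + 4
    k/s-bound = by-contra λ many → 1+n≰n (certify 1 0 (12 + 4 * x + 3 * (m / r) + x * (m / r))
      ((s · many ⊕ slack) ⊕ (≤-reflexive (m≡m%n+[m/n]*n m r) ⊕ (m%n<n m r ⊕ m/n*n≤m k s)))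
      (arith k m (m / r) (k / s) (m % r) x))
      where
      arith : ∀ k m q p a x →
        1 + (((2 + x) * p + suc m) + ((a + q * (3 + x)) + ((3 + x) + k))) + (12 + 4 * x + 3 * q + x * q) ≡
        0 + (((2 + x) * suc (2 * q + 4) + (k + 6 + 2 * q)) + (m + (suc a + p * (2 + x))))
      arith = solve-∀

    φ<m : ∀ j → j ≤ k → φ j < m
    φ<m j j≤k = s≤s⁻¹ (begin
      suc (suc (φ j))                       ≡⟨ cong (λ z → 2 + z) (φ≡ j) ⟩
      2 + (j + j / s)                       ≤⟨ s≤s (s≤s (+-mono-≤ j≤k (≤-trans (/-monoˡ-≤ s j≤k) k/s-bound))) ⟩
      2 + (k + (2 * (m / r) + 4))           ≡⟨ arith k (m / r) ⟩
      k + 6 + 2 * (m / r)                   ≤⟨ slack ⟩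
      suc m                                 ∎)
      where
      open ≤-Reasoning
      arith : ∀ k q → 2 + (k + (2 * q + 4)) ≡ k + 6 + 2 * q
      arith = solve-∀

    next-residue : ∀ j → φ j % r ≢ φ (suc j) % r
    next-residue j eq = go (j % s) (j / s) (m%n<n j s)
      (≡-trans (sym (φ% j)) (≡-trans eq (≡-trans (φ% (suc j)) (cong (λ z → suc z % s) (m≡m%n+[m/n]*n j s)))))
      where
      go : ∀ a q → a < s → a ≢ (suc a + q * s) % s
      go a q a<s a≡ with m≤n⇒m<n∨m≡n a<s
      ... | inj₁ sa<s = 1+n≢n (sym (≡-trans a≡ (%-unique s q sa<s)))
      ... | inj₂ refl = contradiction (≡-trans a≡ (%-unique s {0} (suc q) (s≤s z≤n))) (λ ())

  existence : ∃[ H ] 𝒥 k (suc m) r H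
  existence = H , member
    where
    open ApexConstruction k m s φ φ<m φ-injective (λ j → subst (_< s) (sym (φ% j)) (m%n<n j s)) next-residue

-- The equality cases and the assembly

large-≤ : ∀ {k n r} → Regime k n r → r ≤ 7 → 6 * k + 2 * r + 3 ≤ n
large-≤ {k} (three P)      _   = ≤-trans (≤-trans (≤-reflexive (+-assoc (6 * k) 6 3)) (+-monoʳ-≤ (6 * k) (m≤m+n 9 17))) P
large-≤     (middle _ _ P) _   = P
large-≤     (large r≥8 _)  r≤7 = contradiction r≤7 (<⇒≱ r≥8)

e-K₆₂₂₁ : e (K (6 ∷ 2 ∷ 2 ∷ 1 ∷ [])) ≡ turánEdges 4 10 + 1
e-K₆₂₂₁ = refl

-- Every listed graph has r ≤ 7, where n ≥ 6k + 2r + 3 holds in all regimes. All entries but K₆₂₂₁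
-- fall short of this number, which is the second argument of each `<ᵇ⇒<`.
exceptional-size : ∀ {k n r} .{{_ : NonZero r}} → Regime k n r → (G : Graph n) → Ĥ (+ k) n r G →
                   e G ≡ e (turán r (n ∸ 1)) + (k + 1)
exceptional-size {0} R G (_ , here refl , G≅K) =
  ≡-trans (e-≅ G (K (6 ∷ 2 ∷ 2 ∷ 1 ∷ [])) G≅K) (≡-trans e-K₆₂₂₁ (cong (_+ 1) (sym (e-turán 4 10))))
exceptional-size {0} R G (_ , there (here refl) , _) = contradiction (large-≤ R (m≤m+n 5 2)) (<⇒≱ (<ᵇ⇒< 7 13 tt))
exceptional-size {0} R G (_ , there (there (here refl)) , _) = contradiction (large-≤ R (m≤m+n 5 2)) (<⇒≱ (<ᵇ⇒< 9 13 tt))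
exceptional-size {1} R G (_ , here refl , _) = contradiction (large-≤ R (m≤m+n 6 1)) (<⇒≱ (<ᵇ⇒< 8 21 tt))
exceptional-size {1} R G (_ , there (here refl) , _) = contradiction (large-≤ R (m≤m+n 5 2)) (<⇒≱ (<ᵇ⇒< 10 19 tt))
exceptional-size {1} R G (_ , there (there (here refl)) , _) = contradiction (large-≤ R (m≤m+n 6 1)) (<⇒≱ (<ᵇ⇒< 10 21 tt))
exceptional-size {2} R G (_ , here refl , _) = contradiction (large-≤ R (m≤m+n 5 2)) (<⇒≱ (<ᵇ⇒< 13 25 tt))
exceptional-size {2} R G (_ , there (here refl) , _) = contradiction (large-≤ R (m≤m+n 6 1)) (<⇒≱ (<ᵇ⇒< 11 27 tt))
exceptional-size {2} R G (_ , there (there (here refl)) , _) = contradiction (large-≤ R ≤-refl) (<⇒≱ (<ᵇ⇒< 11 29 tt))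
exceptional-size {2} R G (_ , there (there (there (here refl))) , _) = contradiction (large-≤ R ≤-refl) (<⇒≱ (<ᵇ⇒< 9 29 tt))
exceptional-size {3} R G (_ , here refl , _) = contradiction (large-≤ R ≤-refl) (<⇒≱ (<ᵇ⇒< 12 35 tt))
exceptional-size {4} R G (_ , here refl , _) = contradiction (large-≤ R (m≤m+n 6 1)) (<⇒≱ (<ᵇ⇒< 15 39 tt))
exceptional-size {4} R G (_ , there (here refl) , _) = contradiction (large-≤ R ≤-refl) (<⇒≱ (<ᵇ⇒< 13 41 tt))
exceptional-size {6} R G (_ , here refl , _) = contradiction (large-≤ R ≤-refl) (<⇒≱ (<ᵇ⇒< 17 53 tt))
exceptional-size {5} R G (_ , () , _)
exceptional-size {suc (suc (suc (suc (suc (suc (suc _))))))} R G (_ , () , _)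

𝒥-size : ∀ {k n r} .{{_ : NonZero r}} (G : Graph n) → 𝒥 k n r G → e G ≡ e (turán r (n ∸ 1)) + (k + 1)
𝒥-size {k} {n} {r} G J = begin
  e G                                       ≡⟨ e-split G apex ⟩
  degree G apex + e (G -ᵛ apex)             ≡⟨ cong₂ _+_ apex-degree (e-≅ (G -ᵛ apex) (turán r (n ∸ 1)) rest) ⟩
  k + 1 + e (turán r (n ∸ 1))               ≡⟨ +-comm (k + 1) _ ⟩
  e (turán r (n ∸ 1)) + (k + 1)             ∎
  where
  open 𝒥 J
  open ≡-Reasoning

module Extremal (k n r : ℕ) .{{_ : NonZero r}} (R : Regime k n r)
  (G : Graph n) (¬K : ¬ (complete (suc r) ⊑ G)) (¬PH : ¬ PathHamiltonian k G) where

  private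
    maximum : ℕ
    maximum = turánEdges r (n ∸ 1) + (k + 1)

    q : ℕ
    q = (n ∸ 1) / r

    slack : k + 6 + 2 * q ≤ n
    slack = regime-slack₂ R q (≤-trans (m/n*n≤m (n ∸ 1) r) (m∸n≤m n 1))

    3≤n : 3 ≤ n
    3≤n = ≤-trans (≤-trans (m≤n+m 3 (k + 3)) (≤-reflexive (+-assoc k 3 3))) (≤-trans (m≤m+n (k + 6) (2 * q)) slack)

    Special : Set
    Special = k ≡ 0 × n ≡ 11 × r ≡ 4 × 6 ≤ low G 5

    Outcome : Set
    Outcome = e G ≤ maximum × (e G ≡ maximum → 1 ≤ low G (k + 1) ⊎ Special)

    strict : e G < maximum → Outcome
    strict e< = <⇒≤ e< , λ eq → contradiction eq (<⇒≢ e<)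

    via-gain : ∀ {h} → h ≤ k + low G h → Gain k n r h → Outcome
    via-gain {h} many g = strict (≤-<-trans (low-bound r G ¬K j h (+-cancelˡ-≤ k _ _ (≤-trans k+j≤h many))) (Gain.gain g))
      where open Gain g

    special : k ≡ 0 → n ≡ 11 → r ≡ 4 → 6 ≤ low G 5 → Outcome
    special refl refl refl six = low-bound 4 G ¬K 5 5 (≤-trans (n≤1+n 5) six) , λ _ → inj₂ (refl , refl , refl , six)

    low-mono : ∀ {h h′} → h ≤ h′ → low G h ≤ low G h′
    low-mono {h} {h′} h≤h′ = count-mono _ _ (allFin n) λ v _ t →
      does⁺ (degree G v ≤? h′) (≤-trans (does⁻ (degree G v ≤? h) t) h≤h′)

    outcome : Obstruction k G → Outcome
    outcome O = cases (≤-<-connex h (k + 1))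
      where
      open Obstruction O
      cases : h ≤ k + 1 ⊎ k + 1 < h → Outcome
      -- One low vertex is deleted: h + e(Tᵣ(n - 1)) with h ≤ k + 1 is already the claimed bound,
      -- and that vertex is kept as the candidate apex.
      cases (inj₁ h≤) = ≤-trans (low-bound r G ¬K 1 h some) (≤-trans (≤-reflexive (+-comm (1 * h) _))
        (+-monoʳ-≤ (turánEdges r (n ∸ 1)) (≤-trans (≤-reflexive (*-identityˡ h)) h≤)))
        , λ _ → inj₁ (≤-trans some (low-mono h≤))
      cases (inj₂ h>) = go h many h< extra (m≤n⇒∃[o]m+o≡n (subst (_≤ h) (sym (+-suc k 1)) h>))
        where
        go : ∀ h → h ≤ k + low G h → h + h < k + n → (suc (h + h) ≡ k + n → suc h ≤ k + low G h) →
             ∃[ i ] k + 2 + i ≡ h → Outcome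
        go h many h< extra (i , refl) with gain R i h<
        ... | inj₁ g = via-gain many g
        ... | inj₂ (k≡0 , n≡11 , r≡4 , i≡3) = special k≡0 n≡11 r≡4 (six k≡0 n≡11 i≡3 extra)
          where
          -- `many` yields just five low vertices; as 2 · 5 + 1 = 11 = k + n, `extra` provides the
          -- sixth.
          six : k ≡ 0 → n ≡ 11 → i ≡ 3 → (suc (k + 2 + i + (k + 2 + i)) ≡ k + n → suc (k + 2 + i) ≤ k + low G (k + 2 + i)) → 6 ≤ low G 5
          six refl refl refl tie = tie refl

    -- `kronk` and the failure of path-Hamiltonicity exclude only the absence of an obstruction. For
    -- decidable `X` this double negation suffices.
    obstructed : ∀ {X : Set} → Dec X → (Obstruction k G → X) → X
    obstructed (yes x) _ = x
    obstructed (no ¬x) f = contradiction (kronk k G 3≤n (¬x ∘ f)) ¬PH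

  bound : e G ≤ maximum
  bound = obstructed (e G ≤? maximum) (proj₁ ∘ outcome)

  private
    in-𝒥 : e G ≡ maximum → 1 ≤ low G (k + 1) → 𝒥 k n r G
    in-𝒥 eq one with v , _ , t ← count>0⁻ _ (allFin n) one = build (traceable? (neighbourhood G v))
      where
      e-G : degree G v + e (G -ᵛ v) ≡ (k + 1) + turánEdges r (n ∸ 1)
      e-G = ≡-trans (sym (e-split G v)) (≡-trans eq (+-comm _ (k + 1)))
      low-v : degree G v ≤ k + 1
      low-v = does⁻ (degree G v ≤? k + 1) t
      deg-v : degree G v ≡ k + 1
      deg-v = ≤-+-tightˡ low-v (deletion-bound r G v ¬K) e-G
      balanced : Balanced r G v
      balanced = deletion-balanced r G v ¬K (≤-+-tightʳ low-v (deletion-bound r G v ¬K) e-G)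
      rich : ∀ u w → u ≢ v → w ≢ v → (k + 2) + n ≤ degree G u + degree G w
      -- Both degrees are at least n - 2 - q by `balanced-degree`, and `slack` turns their sum into
      -- n + k + 2 with nothing to spare.
      rich u w u≢v w≢v = certify _ _ 0
        (balanced-degree r G v balanced u≢v ⊕ balanced-degree r G v balanced w≢v ⊕ slack ⊕ ≤-reflexive n≡ ⊕ ≤-reflexive n≡)
        (arith k n (n ∸ 1) q (degree G u) (degree G w))
        where
        n≡ : n ≡ suc (n ∸ 1)
        n≡ = sym (m+[n∸m]≡n (≤-trans (s≤s z≤n) 3≤n))
        arith : ∀ k n m q du dw →
          k + 2 + n + ((du + suc q) + ((dw + suc q) + (n + (suc m + suc m)))) + 0 ≡
          du + dw + (m + (m + (k + 6 + 2 * q + (n + n))))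
        arith = solve-∀
      build : Dec (Traceable (neighbourhood G v)) → 𝒥 k n r G
      build (yes trace) = record
        { clique-free = ¬K ; apex = v ; rest = balanced⇒≅ r G v balanced
        ; apex-degree = deg-v ; traceable = trace }
      build (no ¬trace) = contradiction (Apex.apex-hamiltonian G v 3≤n deg-v rich ¬trace) ¬PH

    in-Ĥ : e G ≡ maximum → Special → Ĥ (+ k) n r G
    in-Ĥ eq (refl , refl , refl , six) =
      let xs , ys , len-xs , len-ys , σ , deg = low-split G 6 5 six in
      (6 ∷ 2 ∷ 2 ∷ 1 ∷ []) , here refl , exceptional-≅ G ¬K eq xs ys len-xs len-ys σ deg

    special? : Dec Special
    special? = (k ≟ 0) ×-dec (n ≟ 11) ×-dec (r ≟ 4) ×-dec (6 ≤? low G 5)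

  extremal : e G ≡ maximum → 𝒥 k n r G ⊎ Ĥ (+ k) n r G
  extremal eq = classify (obstructed ((1 ≤? low G (k + 1)) ⊎-dec special?) (λ O → proj₂ (outcome O) eq))
    where
    classify : 1 ≤ low G (k + 1) ⊎ Special → 𝒥 k n r G ⊎ Ĥ (+ k) n r G
    classify (inj₁ one) = inj₁ (in-𝒥 eq one)
    classify (inj₂ sp)  = inj₂ (in-Ĥ eq sp)

nonempty : ∀ k n r .{{_ : NonZero r}} → r ≥ 3 → k + 6 + 2 * ((n ∸ 1) / r) ≤ n → ∃[ H ] 𝒥 k n r H
nonempty k (suc m) (suc (suc (suc x))) _ slack = Existence.existence k m x slack
nonempty k zero    r r≥3 slack = contradiction (≤-trans (m≤n+m 6 k) (≤-trans (m≤m+n (k + 6) _) slack)) (λ ())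
nonempty k (suc m) 1 (s≤s ()) slack
nonempty k (suc m) 2 (s≤s (s≤s ())) slack

theorem4p5 : ∀ (n r k : ℕ) .{{_ : NonZero r}} → r ≥ 3 → LargeEnough k n r →
    (∃[ H ] 𝒥 k n r H) ×
    (∀ (G : Graph n) → ¬ (complete (suc r) ⊑ G) → ¬ PathHamiltonian k G →
    (e G ≤ e (turán r (n ∸ 1)) + (k + 1)) ×
    (e G ≡ e (turán r (n ∸ 1)) + (k + 1) ⇔ (𝒥 k n r G ⊎ Ĥ (+ k) n r G)))
theorem4p5 n r k r≥3 n-large =
  nonempty k n r r≥3 (regime-slack₂ R ((n ∸ 1) / r) (≤-trans (m/n*n≤m (n ∸ 1) r) (m∸n≤m n 1))) ,
  λ G ¬K ¬PH →
    subst (λ t → e G ≤ t + (k + 1)) (sym (e-turán r (n ∸ 1))) (Extremal.bound k n r R G ¬K ¬PH) ,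
    mk⇔ (λ eq → Extremal.extremal k n r R G ¬K ¬PH (≡-trans eq (cong (_+ (k + 1)) (e-turán r (n ∸ 1)))))
        [ 𝒥-size G , exceptional-size R G ]′
  where
  R : Regime k n r
  R = regime n-large
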